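{- The problem of deciding, given a graph $G$ and $k\in\mathbb{N}$, whether ${\rm I}_e(G)\le k$ is ${\rm W}[1]$-hard when parameterised by the feedback vertex set number of $G$, and also ${\rm W}[1]$-hard when parameterised by the treedepth of $G$.
   Context: A graph is locally irregular if no two adjacent vertices have the same degree. For $S\subseteq E$, $G-S=(V,E\setminus S)$. An edge-irregulator of $G=(V,E)$ is a set $S\subseteq E$ such that $G-S$ is locally irregular; ${\rm I}_e(G)$ denotes the minimum cardinality of an edge-irregulator of $G$. The feedback vertex set number is the minimum size of a vertex set whose removal yields a forest. -}

module Defs where

open import Data.Bool.Base using (Bool; true; false; T; not; _∧_; if_then_else_)
open import Data.Fin.Base using (Fin; zero; suc; inject₁; fromℕ)
open import Data.Fin.Properties using (_<?_)
open import Data.Fin.Subset using (Subset; ∣_∣; ⁅_⁆; _∩_)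
open import Data.Fin.Subset.Properties using (_⊆?_; nonempty?)
open import Data.List.Base as List using (List; []; _∷_; _++_; _∷ʳ_; length)
open import Data.Maybe.Base using (Maybe; just; nothing)
open import Data.Nat.Base using (ℕ; zero; suc; _+_; _*_; _^_; _⊔_; _≤_)
import Data.Nat.Properties as ℕ
open import Data.Product.Base using (Σ; ∃; ∃-syntax; _×_; _,_; proj₁; proj₂)
open import Data.Sum.Base using (_⊎_)
open import Data.Vec.Base as Vec using (Vec; []; _∷_; lookup; tabulate; toList; _[_]%=_)
open import Function.Bundles using (_⇔_)
open import Function.Definitions using (Injective)
open import Relation.Binary.PropositionalEquality using (_≡_; _≢_; refl; cong₂)
open import Relation.Nullary.Decidable.Core using (does)
open import Relation.Nullary.Negation.Core using (¬_)

IsMinimum : (ℕ → Set) → ℕ → Set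
IsMinimum P m = P m × (∀ m′ → P m′ → m ≤ m′)

maximum : ∀ {n} → Vec ℕ n → ℕ
maximum = Vec.foldr′ _⊔_ 0

------------------------------------------------------------------------
-- Model of computation

-- A program works on s stacks of bits.  One stack is simulated by one
-- tape of a Turing machine, one tape by two stacks, and the finite
-- control of a machine by branching on a stack that stores its state,
-- always with constant overhead per step.  The running time below is
-- therefore that of multitape Turing machines up to a constant factor.

Word : Set
Word = List Bool

data Prog (s : ℕ) : Set where
  skip   : Prog s
  push   : Bool → Fin s → Prog s
  pop    : Fin s → Prog s
  _⨾_    : Prog s → Prog s → Prog s
  branch : Fin s → (empty false-on-top true-on-top : Prog s) → Prog s
  while-nonempty : Fin s → Prog s → Prog s

infixr 5 _⨾_

Store : ℕ → Set
Store s = Vec Word s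

-- ⟨ p , σ ⟩⇓[ t ] τ : started on the store σ, p halts after t steps with
-- the store τ.

data ⟨_,_⟩⇓[_]_ {s : ℕ} : Prog s → Store s → ℕ → Store s → Set where

  run-skip : ∀ {σ} → ⟨ skip , σ ⟩⇓[ 1 ] σ

  run-push : ∀ {b i σ} → ⟨ push b i , σ ⟩⇓[ 1 ] (σ [ i ]%= (b ∷_))

  run-pop : ∀ {i σ} → ⟨ pop i , σ ⟩⇓[ 1 ] (σ [ i ]%= List.drop 1)

  run-seq : ∀ {p q σ₁ σ₂ σ₃ t u} →
            ⟨ p , σ₁ ⟩⇓[ t ] σ₂ → ⟨ q , σ₂ ⟩⇓[ u ] σ₃ →
            ⟨ p ⨾ q , σ₁ ⟩⇓[ t + u ] σ₃

  run-branch-empty : ∀ {i p q r σ τ t} →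
                     lookup σ i ≡ [] →
                     ⟨ p , σ ⟩⇓[ t ] τ →
                     ⟨ branch i p q r , σ ⟩⇓[ suc t ] τ

  run-branch-false : ∀ {i p q r σ τ t w} →
                     lookup σ i ≡ false ∷ w →
                     ⟨ q , σ ⟩⇓[ t ] τ →
                     ⟨ branch i p q r , σ ⟩⇓[ suc t ] τ

  run-branch-true : ∀ {i p q r σ τ t w} →
                    lookup σ i ≡ true ∷ w →
                    ⟨ r , σ ⟩⇓[ t ] τ →
                    ⟨ branch i p q r , σ ⟩⇓[ suc t ] τ

  run-while-done : ∀ {i p σ} →
                   lookup σ i ≡ [] →
                   ⟨ while-nonempty i p , σ ⟩⇓[ 1 ] σ

  run-while-step : ∀ {i p σ₁ σ₂ σ₃ t u b w} →
                   lookup σ₁ i ≡ b ∷ w →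
                   ⟨ p , σ₁ ⟩⇓[ t ] σ₂ →
                   ⟨ while-nonempty i p , σ₂ ⟩⇓[ u ] σ₃ →
                   ⟨ while-nonempty i p , σ₁ ⟩⇓[ suc (t + u) ] σ₃

-- Input and output are on the first stack, first symbol on top.

record Program : Set where
  field
    extraStacks : ℕ
    code        : Prog (suc extraStacks)

_on_yields_within_ : Program → Word → Word → ℕ → Set
M on x yields y within T =
  ∃[ t ] ∃[ τ ] ⟨ code , x ∷ Vec.replicate extraStacks [] ⟩⇓[ t ] τ
              × Vec.head τ ≡ y × t ≤ T
  where open Program M

unary : ℕ → Word
unary n = List.replicate n true ∷ʳ false

Computable : (ℕ → ℕ) → Set
Computable f = Σ Program λ M → ∀ n → ∃[ T ] M on unary n yields unary (f n) within T

------------------------------------------------------------------------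
-- Parameterised problems and fpt-reductions

record ParameterisedProblem : Set₁ where
  field
    Instance  : Set
    encode    : Instance → Word
    Yes       : Instance → Set
    parameter : Instance → ℕ

-- The bound f(κ(x)) · (|x| + 1)^c is the usual f(κ(x)) · |x|^O(1); the
-- "+ 1" only matters for |x| = 0, and coefficients of a polynomial can be
-- absorbed by f.

record _≤fpt_ (P Q : ParameterisedProblem) : Set where
  private
    module P = ParameterisedProblem P
    module Q = ParameterisedProblem Q
  field
    reduce  : P.Instance → Q.Instance
    correct : ∀ x → P.Yes x ⇔ Q.Yes (reduce x)

    program     : Program
    f           : ℕ → ℕ
    f-computable : Computable f
    c           : ℕ
    computes    : ∀ x → program on P.encode x yields Q.encode (reduce x)
                        within (f (P.parameter x) * suc (length (P.encode x)) ^ c)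

    g           : ℕ → ℕ
    g-computable : Computable g
    parameter-bound : ∀ x → Q.parameter (reduce x) ≤ g (P.parameter x)

------------------------------------------------------------------------
-- Boolean circuits and the W-hierarchy

-- A gate whose inputs are chosen among w earlier nodes.

data Gate (w : ℕ) : Set where
  NOT : Fin w → Gate w
  AND : (s : Subset w) → 2 ≤ ∣ s ∣ → Gate w
  OR  : (s : Subset w) → 2 ≤ ∣ s ∣ → Gate w

-- Circuit n w: n input nodes and w nodes in total, in topological order.
-- The newest node has index zero.

data Circuit (n : ℕ) : ℕ → Set where
  inputs : Circuit n n
  _▷_    : ∀ {w} → Circuit n w → Gate w → Circuit n (suc w)

infixl 5 _▷_

gateInputs : ∀ {w} → Gate w → Subset w
gateInputs (NOT i)   = ⁅ i ⁆
gateInputs (AND s _) = s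
gateInputs (OR  s _) = s

-- A gate is large if its fan-in exceeds 2.

largeness : ∀ {w} → Gate w → ℕ
largeness g = if does (3 ℕ.≤? ∣ gateInputs g ∣) then 1 else 0

maximumOver : ∀ {w} → Subset w → Vec ℕ w → ℕ
maximumOver s v = maximum (Vec.zipWith (λ b m → if b then m else 0) s v)

-- For every node, the maximum number of gates (of large gates) on a path
-- from an input to that node.

depths : ∀ {n w} → Circuit n w → Vec ℕ w
depths inputs  = Vec.replicate _ 0
depths (C ▷ g) = suc (maximumOver (gateInputs g) (depths C)) ∷ depths C

wefts : ∀ {n w} → Circuit n w → Vec ℕ w
wefts inputs  = Vec.replicate _ 0
wefts (C ▷ g) = largeness g + maximumOver (gateInputs g) (wefts C) ∷ wefts C

evalGate : ∀ {w} → Gate w → Vec Bool w → Bool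
evalGate (NOT i)   v = not (lookup v i)
evalGate (AND s _) v = does (s ⊆? v)
evalGate (OR  s _) v = does (nonempty? (s ∩ v))

values : ∀ {n w} → Circuit n w → Vec Bool n → Vec Bool w
values inputs  a = a
values (C ▷ g) a = evalGate g (values C a) ∷ values C a

encodeGate : ∀ {w} → Gate w → Word
encodeGate g = kind g ++ toList (gateInputs g)
  where
  kind : ∀ {w} → Gate w → Word
  kind (NOT _)   = false ∷ false ∷ []
  kind (AND _ _) = true  ∷ false ∷ []
  kind (OR  _ _) = true  ∷ true  ∷ []

encodeGates : ∀ {n w} → Circuit n w → Word
encodeGates inputs  = []
encodeGates (C ▷ g) = encodeGates C ++ true ∷ encodeGate g

encodeCircuit : ∀ {n w} → Circuit n w → Word
encodeCircuit {n} C = unary n ++ encodeGates C ∷ʳ false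

-- The output is the newest node.  Every circuit whose output is a gate
-- that feeds no other node has a topological order of this form.

record WeightedCircuit (t d : ℕ) : Set where
  field
    {#inputs #others} : ℕ
    circuit : Circuit #inputs (suc #others)
    weft≤t  : Vec.head (wefts circuit) ≤ t
    depth≤d : Vec.head (depths circuit) ≤ d
    weight  : ℕ

-- Weighted circuit satisfiability for circuits of weft at most t and depth
-- at most d: is there a satisfying assignment of weight exactly k?
-- Encoding k in unary is harmless, since k is the parameter.

WCS : (t d : ℕ) → ParameterisedProblem
WCS t d = record
  { Instance  = WeightedCircuit t d
  ; encode    = λ I → encodeCircuit (circuit I) ++ unary (weight I)
  ; Yes       = λ I → ∃[ a ] ∣ a ∣ ≡ weight I × Vec.head (values (circuit I) a) ≡ true
  ; parameter = weight
  }
  where open WeightedCircuit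

W[_] : ℕ → ParameterisedProblem → Set
W[ t ] P = ∃[ d ] P ≤fpt WCS t d

W[_]-hard : ℕ → ParameterisedProblem → Set₁
W[ t ]-hard P = ∀ Q → W[ t ] Q → Q ≤fpt P

------------------------------------------------------------------------
-- Graphs

record SimpleGraph (V : Set) : Set where
  field
    adj       : V → V → Bool
    symmetric : ∀ u v → adj u v ≡ adj v u
    loopless  : ∀ v → adj v v ≡ false

  Adj : V → V → Set
  Adj u v = adj u v ≡ true

open SimpleGraph

FinGraph : ℕ → Set
FinGraph n = SimpleGraph (Fin n)

degree : ∀ {n} → FinGraph n → Fin n → ℕ
degree G v = ∣ tabulate (adj G v) ∣

LocallyIrregular : ∀ {n} → FinGraph n → Set
LocallyIrregular G = ∀ u v → Adj G u v → degree G u ≢ degree G v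

record EdgeSet {V : Set} (G : SimpleGraph V) : Set where
  field
    mem           : V → V → Bool
    mem-symmetric : ∀ u v → mem u v ≡ mem v u
    mem⇒Adj       : ∀ u v → mem u v ≡ true → Adj G u v

open EdgeSet

-- Each edge is counted once, from its smaller end.

cardinality : ∀ {n} {G : FinGraph n} → EdgeSet G → ℕ
cardinality S =
  Vec.sum (tabulate λ u → ∣ tabulate (λ v → does (u <? v) ∧ mem S u v) ∣)

deleteEdges : ∀ {V} (G : SimpleGraph V) → EdgeSet G → SimpleGraph V
deleteEdges G S = record
  { adj       = λ u v → adj G u v ∧ not (mem S u v)
  ; symmetric = λ u v → cong₂ (λ a b → a ∧ not b) (symmetric G u v) (mem-symmetric S u v)
  ; loopless  = λ v → cong₂ _∧_ (loopless G v) refl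
  }

IsEdgeIrregulator : ∀ {n} (G : FinGraph n) → EdgeSet G → Set
IsEdgeIrregulator G S = LocallyIrregular (deleteEdges G S)

-- Iₑ G m : the number Iₑ(G) is m.

Iₑ : ∀ {n} → FinGraph n → ℕ → Set
Iₑ G = IsMinimum λ m → Σ (EdgeSet G) λ S → IsEdgeIrregulator G S × cardinality S ≡ m

------------------------------------------------------------------------
-- Feedback vertex set number

deleteVertices : ∀ {n} → FinGraph n → (X : Subset n) →
                 SimpleGraph (Σ (Fin n) λ v → T (not (lookup X v)))
deleteVertices G X = record
  { adj       = λ u v → adj G (proj₁ u) (proj₁ v)
  ; symmetric = λ u v → symmetric G (proj₁ u) (proj₁ v)
  ; loopless  = λ v → loopless G (proj₁ v)
  }

record Cycle {V : Set} (G : SimpleGraph V) : Set where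
  field
    {excess}    : ℕ
    vertex      : Fin (3 + excess) → V
    distinct    : Injective _≡_ _≡_ vertex
    consecutive : ∀ i → Adj G (vertex (inject₁ i)) (vertex (suc i))
    closing     : Adj G (vertex (fromℕ (2 + excess))) (vertex zero)

IsForest : ∀ {V} → SimpleGraph V → Set
IsForest G = ¬ Cycle G

FeedbackVertexSetNumber : ∀ {n} → FinGraph n → ℕ → Set
FeedbackVertexSetNumber {n} G = IsMinimum λ m →
  Σ (Subset n) λ X → IsForest (deleteVertices G X) × ∣ X ∣ ≡ m

------------------------------------------------------------------------
-- Treedepth: the minimum height of a rooted forest on the vertices of G
-- such that every edge of G joins a vertex to one of its ancestors

-- The levels (roots have level 1) rule out cycles of the parent function.

record RootedForest (V : Set) : Set where
  field
    parent      : V → Maybe V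
    level       : V → ℕ
    level-root  : ∀ v → parent v ≡ nothing → level v ≡ 1
    level-child : ∀ v u → parent v ≡ just u → level v ≡ suc (level u)

open RootedForest

data Ancestor {V : Set} (F : RootedForest V) (u : V) : V → Set where
  is-parent : ∀ {v} → parent F v ≡ just u → Ancestor F u v
  further   : ∀ {v w} → parent F v ≡ just w → Ancestor F u w → Ancestor F u v

height : ∀ {n} → RootedForest (Fin n) → ℕ
height F = maximum (tabulate (level F))

Treedepth : ∀ {n} → FinGraph n → ℕ → Set
Treedepth {n} G = IsMinimum λ m → Σ (RootedForest (Fin n)) λ F →
  (∀ u v → Adj G u v → Ancestor F u v ⊎ Ancestor F v u) × height F ≡ m

------------------------------------------------------------------------
-- Deciding Iₑ(G) ≤ k, parameterised by a graph parameter

GraphParameter : Set₁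
GraphParameter = ∀ {n} → FinGraph n → ℕ → Set

-- The value of π on G is determined by G; it is recorded only so that the
-- parameter is a function of the instance, and it is not part of the input.

record EdgeIrregulatorInstance (π : GraphParameter) : Set where
  field
    {order}    : ℕ
    graph      : FinGraph order
    bound      : ℕ
    value      : ℕ
    π-is-value : π graph value

encodeGraph : ∀ {n} → FinGraph n → Word
encodeGraph {n} G =
  unary n ++ toList (Vec.concat (tabulate λ u → tabulate λ v → adj G u v))

-- Encoding k in unary is harmless: Iₑ(G) never exceeds the number of edges,
-- so larger values of k can be lowered to it.

EdgeIrregulator : GraphParameter → ParameterisedProblem
EdgeIrregulator π = record
  { Instance  = EdgeIrregulatorInstance π
  ; encode    = λ I → encodeGraph (graph I) ++ unary (bound I)
  ; Yes       = λ I → ∃[ m ] Iₑ (graph I) m × m ≤ bound I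
  ; parameter = value
  }
  where open EdgeIrregulatorInstance

{-# OPTIONS --safe #-}

-- In a circuit of weft 1 and depth d, the number of true inputs of a large
-- gate is a polynomial of degree at most 2 ^ d in the inputs of the circuit.
-- For an assignment given by k selectors it is therefore a sum, over all
-- tuples of 2 ^ d selectors, of numbers that depend only on the tuple and
-- the inputs it selects.  So satisfiability with weight k amounts to a
-- system of k ^ O(1) constraints, each requiring that a linear form with
-- polynomially bounded coefficients and variables take a value in a given
-- list.
--
-- Such a system becomes a graph in which every constraint is a hub: the
-- degree of the hub is the value of the linear form up to a constant, and
-- stars attached to the hub forbid the degrees that are not in the list.
-- The variables are represented in unary by gadgets that, within the budget
-- of deletions, delete either all their edges to the hubs or none.  Without
-- the hubs of the constraints the graph is a forest of bounded depth, which
-- bounds the feedback vertex set number and the treedepth in terms of k.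
--
-- All numbers involved are polynomially bounded, so the reduction can be
-- expressed by terms with bounded sums, and evaluating these on unary
-- numbers takes polynomial time.

module Submission where

open import Data.Bool.Base using (Bool; true; false; T; not; _∧_; _∨_; if_then_else_)
import Data.Bool.Properties as Bool
open import Data.Empty using (⊥; ⊥-elim)
open import Data.Fin.Base as Fin using (Fin; zero; suc; toℕ; fromℕ<; inject₁; fromℕ; _↑ˡ_; _↑ʳ_)
import Data.Fin.Properties as Fin
import Data.Fin.Relation.Unary.Top as Top
open import Data.Fin.Subset using (Subset; ∣_∣; ⁅_⁆; _∩_; _⊆_; Nonempty)
import Data.Fin.Subset as Subset
open import Data.Fin.Subset.Properties using (_⊆?_; nonempty?)
import Data.Fin.Subset.Properties as Subset
open import Data.List.Base as List using (List; []; _∷_; _++_; _∷ʳ_; length; replicate)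
import Data.List.Properties as List
open import Data.List.Membership.Propositional using (_∈_)
open import Data.List.Membership.Propositional.Properties
open import Data.List.Relation.Unary.All as All using (All; []; _∷_)
import Data.List.Relation.Unary.All.Properties as All
open import Data.List.Relation.Unary.AllPairs using ([]; _∷_)
open import Data.List.Relation.Unary.Any as Any using (here; there)
open import Data.List.Relation.Unary.Unique.Propositional using (Unique)
import Data.List.Relation.Unary.Unique.Propositional.Properties as Unique
open import Data.Maybe.Base as Maybe using (Maybe; just; nothing)
import Data.Maybe.Properties as Maybe
import Data.Product.Properties as Product
open import Relation.Binary.Definitions using (tri<; tri≈; tri>)
open import Data.Nat.Base
open import Data.Nat.DivMod using (_/_; _%_; m≡m%n+[m/n]*n; m%n<n)
open import Data.Nat.Properties
open import Data.Nat.Tactic.RingSolver using (solve-∀)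
open import Data.Product.Base using (Σ; ∃; ∃-syntax; ∃₂; _×_; _,_; proj₁; proj₂; uncurry)
open import Data.Sum.Base using (_⊎_; inj₁; inj₂; [_,_]′)
open import Data.Unit.Base using (⊤; tt)
open import Data.Vec.Base as Vec using (Vec; []; _∷_; lookup; tabulate; toList; _[_]%=_)
import Data.Vec.Properties as Vec
open import Function.Base using (_∘_; id; case_of_)
open import Function.Bundles using (_⇔_; mk⇔; Equivalence)
open import Function.Definitions using (Injective)
open import Relation.Binary.PropositionalEquality hiding (J)
open import Relation.Nullary.Decidable using (Dec; yes; no; does; dec-true; dec-false; map′; _×-dec_; _⊎-dec_; _→-dec_; ¬?)
open import Relation.Nullary.Negation using (¬_; contradiction)
open import Defs

-- The parameter may only depend on the number of selectors, yet the contribution of a tuple of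
-- selectors is an arbitrary function of the inputs it selects, not a linear one. The last row only
-- has to add up these variables. Weft 1 also permits small gates above large ones. Their Boolean
-- operations do not commute with a sum over tuples, but pairing two numbers in a large base does;
-- so the last row receives one number that holds the counts of all large gates involved, and
-- decodes the output from it. Negation needs subtraction, while numbers of edges cannot be
-- negative; hence everything is taken modulo a bound on that number. Only the hubs of the rows and
-- one dummy hub become centres, (k + 1)^(2^(d + 1)) + 2 vertices in all. The number of variables
-- and even the budget of deletions may grow with the input.

-- Indicators, bounded sums, division with remainder

𝟙 : Bool → ℕ
𝟙 true  = 1
𝟙 false = 0

∑ : ℕ → (ℕ → ℕ) → ℕ
∑ zero    f = 0
∑ (suc n) f = f n + ∑ n f

true≢false : ∀ {A : Set} {b} → b ≡ true → b ≡ false → A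
true≢false refl ()

if-true : ∀ {A : Set} {b} {x y : A} → b ≡ true → (if b then x else y) ≡ x
if-true refl = refl

if-false : ∀ {A : Set} {b} {x y : A} → b ≡ false → (if b then x else y) ≡ y
if-false refl = refl

T-true : ∀ {b} → b ≡ true → T b
T-true refl = _

≡ᵇ-true : ∀ {m n} → m ≡ n → (m ≡ᵇ n) ≡ true
≡ᵇ-true {m} {n} = dec-true (m ≟ n)

≡ᵇ-false : ∀ {m n} → m ≢ n → (m ≡ᵇ n) ≡ false
≡ᵇ-false {m} {n} = dec-false (m ≟ n)

≡ᵇ-true⁻ : ∀ m n → (m ≡ᵇ n) ≡ true → m ≡ n
≡ᵇ-true⁻ m n eq = ≡ᵇ⇒≡ m n (T-true eq)

<ᵇ-true : ∀ {m n} → m < n → (m <ᵇ n) ≡ true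
<ᵇ-true {m} {n} = dec-true (m <? n)

<ᵇ-false : ∀ {m n} → n ≤ m → (m <ᵇ n) ≡ false
<ᵇ-false {m} {n} n≤m = dec-false (m <? n) (≤⇒≯ n≤m)

<ᵇ-true⁻ : ∀ m n → (m <ᵇ n) ≡ true → m < n
<ᵇ-true⁻ m n eq = <ᵇ⇒< m n (T-true eq)

∧-true⁻ : ∀ {a b} → a ∧ b ≡ true → a ≡ true × b ≡ true
∧-true⁻ {true} {true} _ = refl , refl

∨-true⁻ : ∀ {a b} → a ∨ b ≡ true → a ≡ true ⊎ b ≡ true
∨-true⁻ {true}  _ = inj₁ refl
∨-true⁻ {false} p = inj₂ p

∨-trueʳ : ∀ a {b} → b ≡ true → a ∨ b ≡ true
∨-trueʳ true  _ = refl
∨-trueʳ false p = p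

∧-true : ∀ {a b} → a ≡ true → b ≡ true → a ∧ b ≡ true
∧-true refl refl = refl

𝟙-∧ : ∀ a b → 𝟙 (a ∧ b) ≡ 𝟙 a * 𝟙 b
𝟙-∧ true  b = sym (+-identityʳ (𝟙 b))
𝟙-∧ false b = refl

𝟙≤1 : ∀ b → 𝟙 b ≤ 1
𝟙≤1 true  = ≤-refl
𝟙≤1 false = z≤n

positive-𝟙 : ∀ b → (0 <ᵇ 𝟙 b) ≡ b
positive-𝟙 true  = refl
positive-𝟙 false = refl

∑-cong : ∀ n {f g} → (∀ i → i < n → f i ≡ g i) → ∑ n f ≡ ∑ n g
∑-cong zero    eq = refl
∑-cong (suc n) eq = cong₂ _+_ (eq n (n<1+n n)) (∑-cong n λ i i<n → eq i (m<n⇒m<1+n i<n))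

∑-zero : ∀ n {f} → (∀ i → i < n → f i ≡ 0) → ∑ n f ≡ 0
∑-zero zero    eq = refl
∑-zero (suc n) eq = cong₂ _+_ (eq n (n<1+n n)) (∑-zero n λ i i<n → eq i (m<n⇒m<1+n i<n))

∑-zero⁻ : ∀ n {f} → ∑ n f ≡ 0 → ∀ i → i < n → f i ≡ 0
∑-zero⁻ (suc n) {f} eq i i<n with m≤n⇒m<n∨m≡n (s≤s⁻¹ i<n)
... | inj₁ i<n′ = ∑-zero⁻ n (m+n≡0⇒n≡0 (f n) eq) i i<n′
... | inj₂ refl = m+n≡0⇒m≡0 (f n) eq

∑-mono : ∀ n {f g} → (∀ i → i < n → f i ≤ g i) → ∑ n f ≤ ∑ n g
∑-mono zero    le = z≤n
∑-mono (suc n) le = +-mono-≤ (le n (n<1+n n)) (∑-mono n λ i i<n → le i (m<n⇒m<1+n i<n))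

∑-+ : ∀ n f g → ∑ n (λ i → f i + g i) ≡ ∑ n f + ∑ n g
∑-+ zero    f g = refl
∑-+ (suc n) f g = trans (cong (f n + g n +_) (∑-+ n f g)) (lem (f n) (g n) _ _)
  where
  lem : ∀ a b c d → (a + b) + (c + d) ≡ (a + c) + (b + d)
  lem = solve-∀

∑-*ˡ : ∀ n c f → ∑ n (λ i → c * f i) ≡ c * ∑ n f
∑-*ˡ zero    c f = sym (*-zeroʳ c)
∑-*ˡ (suc n) c f = trans (cong (c * f n +_) (∑-*ˡ n c f)) (sym (*-distribˡ-+ c (f n) _))

∑-*ʳ : ∀ n c f → ∑ n (λ i → f i * c) ≡ ∑ n f * c
∑-*ʳ n c f = trans (∑-cong n λ i _ → *-comm (f i) c) (trans (∑-*ˡ n c f) (*-comm c _))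

∑-swap : ∀ m n (f : ℕ → ℕ → ℕ) → ∑ m (λ i → ∑ n (f i)) ≡ ∑ n (λ j → ∑ m (λ i → f i j))
∑-swap zero    n f = sym (∑-zero n λ _ _ → refl)
∑-swap (suc m) n f = trans (cong (∑ n (f m) +_) (∑-swap m n f)) (sym (∑-+ n (f m) _))

∑-const : ∀ n c → ∑ n (λ _ → c) ≡ n * c
∑-const zero    c = refl
∑-const (suc n) c = cong (c +_) (∑-const n c)

∑≤n*c : ∀ n c {f} → (∀ i → i < n → f i ≤ c) → ∑ n f ≤ n * c
∑≤n*c n c le = ≤-trans (∑-mono n le) (≤-reflexive (∑-const n c))

term≤∑ : ∀ n f {j} → j < n → f j ≤ ∑ n f
term≤∑ (suc n) f {j} j<n with m≤n⇒m<n∨m≡n (s≤s⁻¹ j<n)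
... | inj₁ j<n′ = m≤n⇒m≤o+n (f n) (term≤∑ n f j<n′)
... | inj₂ refl = m≤m+n (f n) _

∑-single : ∀ n (f : ℕ → ℕ) j → j < n → ∑ n (λ i → 𝟙 (i ≡ᵇ j) * f i) ≡ f j
∑-single (suc n) f j j<n with m≤n⇒m<n∨m≡n (s≤s⁻¹ j<n)
... | inj₁ j<n′ = cong₂ _+_ (cong (λ b → 𝟙 b * f n) (≡ᵇ-false (>⇒≢ j<n′))) (∑-single n f j j<n′)
... | inj₂ refl = begin
    𝟙 (n ≡ᵇ n) * f n + ∑ n (λ i → 𝟙 (i ≡ᵇ n) * f i)
  ≡⟨ cong₂ _+_ (cong (λ b → 𝟙 b * f n) (≡ᵇ-true {n} refl))
               (∑-zero n λ i i<n → cong (λ b → 𝟙 b * f i) (≡ᵇ-false (<⇒≢ i<n))) ⟩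
    1 * f n + 0
  ≡⟨ trans (+-identityʳ _) (*-identityˡ _) ⟩
    f n
  ∎ where open ≡-Reasoning

∑-append : ∀ m n (f : ℕ → ℕ) → ∑ (m + n) f ≡ ∑ m f + ∑ n (λ i → f (m + i))
∑-append m zero    f = trans (cong (λ x → ∑ x f) (+-identityʳ m)) (sym (+-identityʳ _))
∑-append m (suc n) f = begin
    ∑ (m + suc n) f
  ≡⟨ cong (λ x → ∑ x f) (+-suc m n) ⟩
    f (m + n) + ∑ (m + n) f
  ≡⟨ cong (f (m + n) +_) (∑-append m n f) ⟩
    f (m + n) + (∑ m f + ∑ n (λ i → f (m + i)))
  ≡⟨ lem (f (m + n)) (∑ m f) _ ⟩
    ∑ m f + (f (m + n) + ∑ n (λ i → f (m + i)))
  ∎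
  where
  open ≡-Reasoning
  lem : ∀ a b c → a + (b + c) ≡ b + (a + c)
  lem = solve-∀

∑-blocks : ∀ a b (f : ℕ → ℕ) → ∑ (a * b) f ≡ ∑ a (λ i → ∑ b (λ j → f (b * i + j)))
∑-blocks zero    b f = refl
∑-blocks (suc a) b f = begin
    ∑ (b + a * b) f
  ≡⟨ cong (λ x → ∑ x f) (trans (+-comm b (a * b)) (cong (_+ b) (*-comm a b))) ⟩
    ∑ (b * a + b) f
  ≡⟨ ∑-append (b * a) b f ⟩
    ∑ (b * a) f + ∑ b (λ j → f (b * a + j))
  ≡⟨ +-comm _ (∑ b (λ j → f (b * a + j))) ⟩
    ∑ b (λ j → f (b * a + j)) + ∑ (b * a) f
  ≡⟨ cong (∑ b (λ j → f (b * a + j)) +_) (trans (cong (λ x → ∑ x f) (*-comm b a)) (∑-blocks a b f)) ⟩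
    ∑ (suc a) (λ i → ∑ b (λ j → f (b * i + j)))
  ∎
  where open ≡-Reasoning

-- Numbers are read back from such counts throughout: quotients, variables in unary, lengths of runs
-- of true.
∑-threshold : ∀ m y → y ≤ m → ∑ m (λ q → 𝟙 (q <ᵇ y)) ≡ y
∑-threshold zero    .zero z≤n = refl
∑-threshold (suc m) y y≤m with m≤n⇒m<n∨m≡n y≤m
... | inj₁ y<m  = trans (cong (λ b → 𝟙 b + ∑ m (λ q → 𝟙 (q <ᵇ y))) (<ᵇ-false (s≤s⁻¹ y<m))) (∑-threshold m y (s≤s⁻¹ y<m))
... | inj₂ refl = cong₂ _+_ (cong 𝟙 (<ᵇ-true (n<1+n m)))
  (trans (∑-cong m λ i i<m → cong 𝟙 (<ᵇ-true (m<n⇒m<1+n i<m))) (trans (∑-const m 1) (*-identityʳ m)))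

∑𝟙≤ : ∀ n (p : ℕ → Bool) → ∑ n (λ i → 𝟙 (p i)) ≤ n
∑𝟙≤ n p = ≤-trans (∑≤n*c n 1 λ i _ → 𝟙≤1 (p i)) (≤-reflexive (*-identityʳ n))

-- quot m 0 = m and rem m 0 = m.

opaque
  quot rem : ℕ → ℕ → ℕ
  quot m n = ∑ m λ q → 𝟙 (suc q * n <ᵇ suc m)
  rem m n  = m ∸ n * quot m n

  -- The block is opaque so that quotients do not unfold in goals. This equation and the next one
  -- let `quotF` and `remF` see the definition: the quotient counts the positive multiples of `n` up
  -- to `m`, a bounded sum and hence expressible as a term.
  quot-def : ∀ m n → quot m n ≡ ∑ m λ q → 𝟙 (suc q * n <ᵇ suc m)
  quot-def m n = refl

  rem-def : ∀ m n → rem m n ≡ m ∸ n * quot m n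
  rem-def m n = refl

  quot-unique : ∀ n y {x} → x < n → quot (n * y + x) n ≡ y
  quot-unique n y {x} x<n = trans (∑-cong (n * y + x) λ q _ → cong 𝟙 (same q)) (∑-threshold (n * y + x) y y≤)
    where
    instance
      n≢0 : NonZero n
      n≢0 = >-nonZero (≤-<-trans z≤n x<n)
    y≤ : y ≤ n * y + x
    y≤ = ≤-trans (m≤n*m y n) (m≤m+n (n * y) x)
    same : ∀ q → (suc q * n <ᵇ suc (n * y + x)) ≡ (q <ᵇ y)
    same q with q <? y
    ... | yes q<y = trans (<ᵇ-true (s≤s (≤-trans (*-monoˡ-≤ n q<y) (≤-trans (≤-reflexive (*-comm y n)) (m≤m+n (n * y) x))))) (sym (<ᵇ-true q<y))
    ... | no  q≮y = trans (<ᵇ-false big) (sym (<ᵇ-false (≮⇒≥ q≮y)))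
      where
      big : suc (n * y + x) ≤ suc q * n
      big = begin
        suc (n * y + x) ≡⟨ sym (+-suc (n * y) x) ⟩
        n * y + suc x   ≤⟨ +-monoʳ-≤ (n * y) x<n ⟩
        n * y + n       ≡⟨ trans (+-comm (n * y) n) (cong (n +_) (*-comm n y)) ⟩
        suc y * n       ≤⟨ *-monoˡ-≤ n (s≤s (≮⇒≥ q≮y)) ⟩
        suc q * n       ∎
        where open ≤-Reasoning

  rem-unique : ∀ n y {x} → x < n → rem (n * y + x) n ≡ x
  rem-unique n y {x} x<n = trans (cong (λ z → n * y + x ∸ n * z) (quot-unique n y x<n)) (m+n∸m≡n (n * y) x)

private
  division : ∀ m n → 0 < n → ∃₂ λ y x → x < n × m ≡ n * y + x
  division m n 0<n = m / n , m % n , m%n<n m n ,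
    trans (m≡m%n+[m/n]*n m n) (trans (+-comm (m % n) _) (cong (_+ m % n) (*-comm (m / n) n)))
    where
    instance
      n≢0 : NonZero n
      n≢0 = >-nonZero 0<n

quot-rem : ∀ m {n} → 0 < n → m ≡ n * quot m n + rem m n
quot-rem m {n} 0<n with division m n 0<n
... | y , x , x<n , refl = sym (cong₂ (λ a b → n * a + b) (quot-unique n y x<n) (rem-unique n y x<n))

rem< : ∀ m {n} → 0 < n → rem m n < n
rem< m {n} 0<n with division m n 0<n
... | y , x , x<n , refl = subst (_< n) (sym (rem-unique n y x<n)) x<n

pair< : ∀ {a b i j} → i < a → j < b → b * i + j < a * b
pair< {a} {b} {i} {j} i<a j<b = begin-strict
  b * i + j <⟨ +-monoʳ-< (b * i) j<b ⟩
  b * i + b ≡⟨ trans (+-comm (b * i) b) (cong (b +_) (*-comm b i)) ⟩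
  suc i * b ≤⟨ *-monoˡ-≤ b i<a ⟩
  a * b     ∎
  where open ≤-Reasoning

quot< : ∀ {m} a b → m < a * b → quot m b < a
quot< {m} a zero    m<ab = contradiction (subst (m <_) (*-zeroʳ a) m<ab) λ ()
quot< {m} a (suc b) m<ab = *-cancelʳ-< (suc b) (quot m (suc b)) a (begin-strict
  quot m (suc b) * suc b                ≡⟨ *-comm (quot m (suc b)) (suc b) ⟩
  suc b * quot m (suc b)                ≤⟨ m≤m+n _ _ ⟩
  suc b * quot m (suc b) + rem m (suc b) ≡⟨ sym (quot-rem m z<s) ⟩
  m                                     <⟨ m<ab ⟩
  a * suc b                             ∎)
  where open ≤-Reasoning

pair-injective : ∀ b {i i′ j j′} → j < b → j′ < b → b * i + j ≡ b * i′ + j′ → i ≡ i′ × j ≡ j′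
pair-injective b {i} {i′} j<b j′<b eq =
  trans (sym (quot-unique b i j<b)) (trans (cong (λ m → quot m b) eq) (quot-unique b i′ j′<b)) ,
  trans (sym (rem-unique b i j<b)) (trans (cong (λ m → rem m b) eq) (rem-unique b i′ j′<b))

∑-quot-rem : ∀ a b (f : ℕ → ℕ → ℕ) → ∑ (a * b) (λ m → f (quot m b) (rem m b)) ≡ ∑ a (λ i → ∑ b (f i))
∑-quot-rem a b f = trans (∑-blocks a b _) (∑-cong a λ i _ → ∑-cong b λ j j<b →
  cong₂ f (quot-unique b i j<b) (rem-unique b i j<b))

-- Running programs within a time bound

Runs : ∀ {s} → Prog s → Store s → ℕ → Store s → Set
Runs p σ T τ = ∃[ t ] ⟨ p , σ ⟩⇓[ t ] τ × t ≤ T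

infixr 4 _then_

_then_ : ∀ {s} {p q : Prog s} {σ τ υ T U} → Runs p σ T τ → Runs q τ U υ → Runs (p ⨾ q) σ (T + U) υ
(t , p⇓ , t≤) then (u , q⇓ , u≤) = t + u , run-seq p⇓ q⇓ , +-mono-≤ t≤ u≤

within : ∀ {s} {p : Prog s} {σ τ T T′} → T ≤ T′ → Runs p σ T τ → Runs p σ T′ τ
within T≤T′ (t , p⇓ , t≤) = t , p⇓ , ≤-trans t≤ T≤T′

ending : ∀ {s} {p : Prog s} {σ τ τ′ T} → τ ≡ τ′ → Runs p σ T τ → Runs p σ T τ′
ending refl r = r

skips : ∀ {s} {σ : Store s} → Runs skip σ 1 σ
skips = 1 , run-skip , ≤-refl

pushes : ∀ {s b i} {σ : Store s} → Runs (push b i) σ 1 (σ [ i ]%= (b ∷_))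
pushes = 1 , run-push , ≤-refl

pops : ∀ {s i} {σ : Store s} → Runs (pop i) σ 1 (σ [ i ]%= List.drop 1)
pops = 1 , run-pop , ≤-refl

branches : ∀ {s i} {p q r : Prog s} {σ τ : Store s} {T b v} → lookup σ i ≡ b ∷ v →
           Runs (if b then r else q) σ T τ → Runs (branch i p q r) σ (suc T) τ
branches {b = false} eq (t , q⇓ , t≤) = suc t , run-branch-false eq q⇓ , s≤s t≤
branches {b = true}  eq (t , q⇓ , t≤) = suc t , run-branch-true eq q⇓ , s≤s t≤

branches-empty : ∀ {s i} {p q r : Prog s} {σ τ : Store s} {T} → lookup σ i ≡ [] →
                 Runs p σ T τ → Runs (branch i p q r) σ (suc T) τ
branches-empty eq (t , p⇓ , t≤) = suc t , run-branch-empty eq p⇓ , s≤s t≤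

while-stops : ∀ {s i} {p : Prog s} {σ : Store s} → lookup σ i ≡ [] → Runs (while-nonempty i p) σ 1 σ
while-stops eq = 1 , run-while-done eq , ≤-refl

while-goes-on : ∀ {s i} {p : Prog s} {σ τ υ : Store s} {T U b v} → lookup σ i ≡ b ∷ v →
                Runs p σ T τ → Runs (while-nonempty i p) τ U υ → Runs (while-nonempty i p) σ (suc (T + U)) υ
while-goes-on eq (t , p⇓ , t≤) (u , q⇓ , u≤) =
  suc (t + u) , run-while-step eq p⇓ q⇓ , s≤s (+-mono-≤ t≤ u≤)

-- The index runs down, like the block that controls a `loop`. The transducer therefore pushes its
-- last output symbol first and ends with the first one on top.
iter : ∀ {S : Set} → ℕ → (ℕ → S → S) → S → S
iter zero    step s = s
iter (suc n) step s = iter n step (step n s)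

-- Terms are compiled to programs on six stacks: O for the output, W for
-- the input word, E for the values of the variables and R for the results
-- of subterms (both as unary blocks), A for scratch, and F for the flags
-- that control loops.

pattern stackO = zero
pattern stackW = suc zero
pattern stackE = suc (suc zero)
pattern stackR = suc (suc (suc zero))
pattern stackA = suc (suc (suc (suc zero)))
pattern stackF = suc (suc (suc (suc (suc zero))))

-- Repeats q as often as there are symbols true on top of stack X; the
-- remaining number of rounds is visible to q.

loop : Fin 6 → Prog 6 → Prog 6
loop X q = push true stackF ⨾ while-nonempty stackF (pop stackF ⨾ branch X skip skip (pop X ⨾ q ⨾ push true stackF))

-- st s f x is a store whose stack X is x and whose flag stack is f.

record View (X : Fin 6) {S : Set} (st : S → Word → Word → Store 6) : Set where
  constructor view
  field
    lookup-flag  : ∀ {s f x} → lookup (st s f x) stackF ≡ f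
    push-flag    : ∀ {s f x b} → st s f x [ stackF ]%= (b ∷_) ≡ st s (b ∷ f) x
    pop-flag     : ∀ {s f x b} → st s (b ∷ f) x [ stackF ]%= List.drop 1 ≡ st s f x
    lookup-stack : ∀ {s f x} → lookup (st s f x) X ≡ x
    pop-stack    : ∀ {s f x b} → st s f (b ∷ x) [ X ]%= List.drop 1 ≡ st s f x

-- `while-nonempty` only tests for emptiness, but a unary block ends with false. So each round pops
-- the flag and pushes it again only if the block showed true. The body starts with an empty flag
-- stack, which lets loops nest. Of the steps of a round, 5 belong to the loop itself; the last 6
-- are the initial push and the failing round.
loops : ∀ {X S} {st : S → Word → Word → Store 6} → View X st → ∀ {q T step x} n {s} →
        (∀ i s → i < n → Runs q (st s [] (unary i ++ x)) T (st (step i s) [] (unary i ++ x))) →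
        Runs (loop X q) (st s [] (unary n ++ x)) (n * (T + 5) + 6) (st (iter n step s) [] (false ∷ x))
loops {X} {S} {st} v {q} {T} {step} {x} n {s} body =
  within (≤-reflexive (sym (+-suc (n * (T + 5)) 5))) (ending push-flag pushes then rounds n body)
  where
  open View v
  rounds : ∀ n {s} →
    (∀ i s → i < n → Runs q (st s [] (unary i ++ x)) T (st (step i s) [] (unary i ++ x))) →
    Runs (while-nonempty stackF (pop stackF ⨾ branch X skip skip (pop X ⨾ q ⨾ push true stackF)))
      (st s (true ∷ []) (unary n ++ x)) (n * (T + 5) + 5) (st (iter n step s) [] (false ∷ x))
  rounds zero body = while-goes-on lookup-flag
    (ending pop-flag pops then branches lookup-stack skips)
    (while-stops lookup-flag)
  rounds (suc n) {s} body = within (≤-reflexive (arith T _))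
    (while-goes-on lookup-flag
      (ending pop-flag pops then branches lookup-stack
        (ending pop-stack pops then body n s (n<1+n n) then ending push-flag pushes))
      (rounds n (λ i s i<n → body i s (m<n⇒m<1+n i<n))))
    where
    arith : ∀ T U → suc (suc (suc (suc (T + 1))) + (U + 5)) ≡ (T + 5 + U) + 5
    arith = solve-∀

-- st f x y is a store with stacks x, y and f at X, Y and F.

record View₂ (X Y : Fin 6) (st : Word → Word → Word → Store 6) : Set where
  constructor view₂
  field
    view-X      : View X (λ y f x → st f x y)
    push-second : ∀ {f x y b} → st f x y [ Y ]%= (b ∷_) ≡ st f x (b ∷ y)

EA : ∀ {o w r} → View₂ stackE stackA (λ f x y → o ∷ w ∷ x ∷ r ∷ y ∷ f ∷ [])
EA = view₂ (view refl refl refl refl refl) refl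

AE : ∀ {o w r} → View₂ stackA stackE (λ f x y → o ∷ w ∷ y ∷ r ∷ x ∷ f ∷ [])
AE = view₂ (view refl refl refl refl refl) refl

RA : ∀ {o w e} → View₂ stackR stackA (λ f x y → o ∷ w ∷ e ∷ x ∷ y ∷ f ∷ [])
RA = view₂ (view refl refl refl refl refl) refl

AR : ∀ {o w e} → View₂ stackA stackR (λ f x y → o ∷ w ∷ e ∷ y ∷ x ∷ f ∷ [])
AR = view₂ (view refl refl refl refl refl) refl

RE : ∀ {o w a} → View₂ stackR stackE (λ f x y → o ∷ w ∷ y ∷ x ∷ a ∷ f ∷ [])
RE = view₂ (view refl refl refl refl refl) refl

AW : ∀ {o e r} → View₂ stackA stackW (λ f x y → o ∷ y ∷ e ∷ r ∷ x ∷ f ∷ [])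
AW = view₂ (view refl refl refl refl refl) refl

OA : ∀ {w e r} → View₂ stackO stackA (λ f x y → x ∷ w ∷ e ∷ r ∷ y ∷ f ∷ [])
OA = view₂ (view refl refl refl refl refl) refl

unary-++ : ∀ n x → unary n ++ x ≡ replicate n true ++ false ∷ x
unary-++ n x = List.∷ʳ-++ (replicate n true) false x

iter-push : ∀ n (y : Word) → iter n (λ _ → true ∷_) y ≡ replicate n true ++ y
iter-push zero    y = refl
iter-push (suc n) y = trans (iter-push n (true ∷ y)) (swap n)
  where
  swap : ∀ n → replicate n true ++ true ∷ y ≡ true ∷ replicate n true ++ y
  swap zero    = refl
  swap (suc n) = cong (true ∷_) (swap n)

pour moveBlock moveAll : Fin 6 → Fin 6 → Prog 6
pour X Y      = loop X (push true Y) ⨾ pop X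
moveBlock X Y = push false Y ⨾ pour X Y
moveAll X Y   = while-nonempty X (branch X skip (pop X ⨾ push false Y) (pop X ⨾ push true Y))

module _ {X Y st} (v : View₂ X Y st) where
  open View₂ v
  open View view-X

  pours : ∀ n {x y} → Runs (pour X Y) (st [] (unary n ++ x) y) (n * 6 + 7) (st [] x (replicate n true ++ y))
  pours n {x} {y} = within (≤-reflexive (+-assoc (n * 6) 6 1))
    (ending (cong (λ y → st [] (false ∷ x) y) (iter-push n y))
       (loops view-X n (λ _ _ _ → ending push-second pushes))
     then ending pop-stack pops)

  moves-block : ∀ n {x y} → Runs (moveBlock X Y) (st [] (unary n ++ x) y) (n * 6 + 8) (st [] x (unary n ++ y))
  moves-block n {x} {y} = within (≤-reflexive (sym (+-suc (n * 6) 7)))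
    (ending push-second pushes then ending (cong (st [] x) (sym (unary-++ n y))) (pours n))

  moves-all : ∀ x {f y} → Runs (moveAll X Y) (st f x y) (length x * 4 + 1) (st f [] (x List.ʳ++ y))
  moves-all []      = while-stops lookup-stack
  moves-all (b ∷ x) = while-goes-on lookup-stack
    (branches lookup-stack (moved b))
    (moves-all x)
    where
    moved : ∀ b {f x y} → Runs (if b then pop X ⨾ push true Y else (pop X ⨾ push false Y))
                   (st f (b ∷ x) y) 2 (st f x (b ∷ y))
    moved false = ending pop-stack pops then ending push-second pushes
    moved true  = ending pop-stack pops then ending push-second pushes

encs : ∀ {m} → Vec ℕ m → Word
encs []       = []
encs (v ∷ vs) = unary v ++ encs vs

-- The blocks above block `i` are parked on `A`. Reading block `i` destroys it, so it is copied to
-- `A` as well as to `R`, and the copy goes back to `E`.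
pick : ∀ {m} → Fin m → Prog 6
pick zero    = push false stackA ⨾ push false stackR ⨾ loop stackE (push true stackA ⨾ push true stackR) ⨾ pop stackE ⨾ moveBlock stackA stackE
pick (suc i) = moveBlock stackE stackA ⨾ pick i ⨾ moveBlock stackA stackE

picks : ∀ {m} (i : Fin m) {vs : Vec ℕ m} {M} → (∀ j → lookup vs j ≤ M) → ∀ {o w r a} →
        Runs (pick i) (o ∷ w ∷ encs vs ∷ r ∷ a ∷ [] ∷ []) (suc (toℕ i) * (M * 13 + 17))
                      (o ∷ w ∷ encs vs ∷ (unary (lookup vs i) ++ r) ∷ a ∷ [] ∷ [])
picks zero {v ∷ vs} {M} ≤M {o} {w} {r} {a} =
  within bound (pushes then pushes
    then ending (cong (λ ra → o ∷ w ∷ (false ∷ encs vs) ∷ proj₁ ra ∷ proj₂ ra ∷ [] ∷ []) (both v))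
           (loops {st = λ ra f x → o ∷ w ∷ x ∷ proj₁ ra ∷ proj₂ ra ∷ f ∷ []} (view refl refl refl refl refl)
             {step = pushBoth} v (λ _ _ _ → pushes then pushes))
    then pops
    then moves-block AE v)
  where
  pushBoth : ℕ → Word × Word → Word × Word
  pushBoth _ (r , a) = true ∷ r , true ∷ a
  bothIter : ∀ n y z → iter n pushBoth (y , z) ≡ (iter n (λ _ → true ∷_) y , iter n (λ _ → true ∷_) z)
  bothIter zero    y z = refl
  bothIter (suc n) y z = bothIter n (true ∷ y) (true ∷ z)
  both : ∀ n → iter n pushBoth (false ∷ r , false ∷ a) ≡ (unary n ++ r , unary n ++ a)
  both n = trans (bothIter n _ _) (cong₂ _,_ (trans (iter-push n _) (sym (unary-++ n r))) (trans (iter-push n _) (sym (unary-++ n a))))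
  bound : 1 + (1 + ((v * (2 + 5) + 6) + (1 + (v * 6 + 8)))) ≤ 1 * (M * 13 + 17)
  bound = ≤-trans (≤-reflexive (arith v)) (*-monoʳ-≤ 1 (+-monoˡ-≤ 17 (*-monoˡ-≤ 13 (≤M zero))))
    where
    arith : ∀ v → 1 + (1 + ((v * (2 + 5) + 6) + (1 + (v * 6 + 8)))) ≡ 1 * (v * 13 + 17)
    arith = solve-∀
picks (suc i) {v ∷ vs} {M} ≤M = within bound (moves-block EA v then picks i {vs} (λ j → ≤M (suc j)) then moves-block AE v)
  where
  bound : (v * 6 + 8) + (suc (toℕ i) * (M * 13 + 17) + (v * 6 + 8)) ≤ suc (suc (toℕ i)) * (M * 13 + 17)
  bound = ≤-trans (≤-reflexive (arith v (suc (toℕ i) * (M * 13 + 17))))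
    (+-monoˡ-≤ (suc (toℕ i) * (M * 13 + 17))
      (+-mono-≤ (≤-trans (*-monoˡ-≤ 12 (≤M zero)) (*-monoʳ-≤ M (n≤1+n 12))) (n≤1+n 16)))
    where
    arith : ∀ v U → (v * 6 + 8) + (U + (v * 6 + 8)) ≡ (v * 12 + 16) + U
    arith = solve-∀

-- `pour` drops the separator, so the symbols of the upper block land on the lower one and the two
-- blocks merge.
add : Prog 6
add = moveBlock stackR stackA ⨾ pour stackA stackR

replicate-unary : ∀ a b x → replicate a true ++ (unary b ++ x) ≡ unary (a + b) ++ x
replicate-unary zero    b x = refl
replicate-unary (suc a) b x = cong (true ∷_) (replicate-unary a b x)

adds : ∀ {o w e a} m n {r} → Runs add (o ∷ w ∷ e ∷ (unary m ++ unary n ++ r) ∷ a ∷ [] ∷ []) (m * 12 + 15)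
                                      (o ∷ w ∷ e ∷ (unary (m + n) ++ r) ∷ a ∷ [] ∷ [])
adds {o} {w} {e} {a} m n {r} = within (≤-reflexive (arith m))
  (moves-block RA m then ending (cong (λ r → o ∷ w ∷ e ∷ r ∷ a ∷ [] ∷ []) (replicate-unary m n r)) (pours AR m))
  where
  arith : ∀ m → (m * 6 + 8) + (m * 6 + 7) ≡ m * 12 + 15
  arith = solve-∀

monus : Prog 6
monus = moveBlock stackR stackA ⨾ loop stackA (branch stackR skip skip (pop stackR)) ⨾ pop stackA

monuses : ∀ {o w e a} m n {r} → Runs monus (o ∷ w ∷ e ∷ (unary n ++ unary m ++ r) ∷ a ∷ [] ∷ []) (n * 13 + 15)
                                           (o ∷ w ∷ e ∷ (unary (m ∸ n) ++ r) ∷ a ∷ [] ∷ [])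
monuses {o} {w} {e} {a} m n {r} = within (≤-reflexive (arith n))
  (moves-block RA n
   then ending (cong (λ r → o ∷ w ∷ e ∷ r ∷ (false ∷ a) ∷ [] ∷ []) (minus m n))
     (loops {st = λ r f x → o ∷ w ∷ e ∷ r ∷ x ∷ f ∷ []} (view refl refl refl refl refl) n (λ _ r _ → drops r))
   then pops)
  where
  dropTrue : Word → Word
  dropTrue (true ∷ x) = x
  dropTrue x          = x
  drops : ∀ r {x} → Runs (branch stackR skip skip (pop stackR)) (o ∷ w ∷ e ∷ r ∷ x ∷ [] ∷ []) 2 (o ∷ w ∷ e ∷ dropTrue r ∷ x ∷ [] ∷ [])
  drops []          = branches-empty refl skips
  drops (false ∷ r) = branches refl skips
  drops (true ∷ r)  = branches refl pops
  minus : ∀ m n → iter n (λ _ → dropTrue) (unary m ++ r) ≡ unary (m ∸ n) ++ r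
  minus m       zero    = refl
  minus zero    (suc n) = trans (minus zero n) (cong (λ k → unary k ++ r) (0∸n≡0 n))
  minus (suc m) (suc n) = minus m n
  arith : ∀ n → (n * 6 + 8) + ((n * (2 + 5) + 6) + 1) ≡ n * 13 + 15
  arith = solve-∀

bitAt : Word → ℕ → Bool
bitAt []      _       = false
bitAt (b ∷ w) zero    = b
bitAt (b ∷ w) (suc i) = bitAt w i

readBit : Prog 6
readBit = loop stackR (branch stackW skip (pop stackW ⨾ push false stackA) (pop stackW ⨾ push true stackA)) ⨾ pop stackR ⨾
          -- Beyond the end of the word `W` is empty by now, and the result stays 0, in accordance
          -- with `bitAt`.
          push false stackR ⨾ branch stackW skip skip (push true stackR) ⨾ moveAll stackA stackW

reads-bit : ∀ {o e} w i {r} → Runs readBit (o ∷ w ∷ e ∷ (unary i ++ r) ∷ [] ∷ [] ∷ []) (i * 8 + length w * 4 + 11)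
                                           (o ∷ w ∷ e ∷ (unary (𝟙 (bitAt w i)) ++ r) ∷ [] ∷ [] ∷ [])
reads-bit {o} {e} w i {r} =
  within (≤-trans (+-monoʳ-≤ (i * (3 + 5) + 6) (+-monoʳ-≤ 4 (+-monoˡ-≤ 1 (*-monoˡ-≤ 4 short)))) (≤-reflexive (arith (i * 8) (length w * 4))))
    (loops {st = λ aw f x → o ∷ proj₂ aw ∷ e ∷ x ∷ proj₁ aw ∷ f ∷ []} (view refl refl refl refl refl) {T = 3} {step = λ _ → shift} i (λ { _ (a , w) _ → shifts a w })
     then pops
     then pushes
     then result (proj₂ final) (bitAt w i) (trans (top i [] w) refl)
     then ending (cong (λ w → o ∷ w ∷ e ∷ (unary (𝟙 (bitAt w₀ i)) ++ r) ∷ [] ∷ [] ∷ []) (restore i [] w))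
            (moves-all AW (proj₁ final)))
  where
  w₀ = w
  shift : Word × Word → Word × Word
  shift (a , [])    = a , []
  shift (a , b ∷ w) = b ∷ a , w
  final = iter i (λ _ → shift) ([] , w)
  shifts : ∀ a w {x} → Runs (branch stackW skip (pop stackW ⨾ push false stackA) (pop stackW ⨾ push true stackA))
                          (o ∷ w ∷ e ∷ x ∷ a ∷ [] ∷ []) 3 (o ∷ proj₂ (shift (a , w)) ∷ e ∷ x ∷ proj₁ (shift (a , w)) ∷ [] ∷ [])
  shifts a []          = within (s≤s (s≤s z≤n)) (branches-empty refl skips)
  shifts a (false ∷ w) = branches refl (pops then pushes)
  shifts a (true ∷ w)  = branches refl (pops then pushes)
  restore : ∀ i a w → proj₁ (iter i (λ _ → shift) (a , w)) List.ʳ++ proj₂ (iter i (λ _ → shift) (a , w)) ≡ a List.ʳ++ w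
  restore zero    a w       = refl
  restore (suc i) a []      = restore i a []
  restore (suc i) a (b ∷ w) = restore i (b ∷ a) w
  top : ∀ i a w → bitAt (proj₂ (iter i (λ _ → shift) (a , w))) 0 ≡ bitAt w i
  top zero    a []      = refl
  top zero    a (b ∷ w) = refl
  top (suc i) a []      = top i a []
  top (suc i) a (b ∷ w) = top i (b ∷ a) w
  short : length (proj₁ final) ≤ length w
  short = begin
    length (proj₁ final)                          ≤⟨ m≤m+n _ _ ⟩
    length (proj₁ final) + length (proj₂ final)   ≡⟨ sym (List.length-ʳ++ (proj₁ final)) ⟩
    length (proj₁ final List.ʳ++ proj₂ final)     ≡⟨ cong length (restore i [] w) ⟩
    length w                                      ∎
    where open ≤-Reasoning
  result : ∀ w {a} c → bitAt w 0 ≡ c → Runs (branch stackW skip skip (push true stackR)) (o ∷ w ∷ e ∷ (false ∷ r) ∷ a ∷ [] ∷ []) 2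
                                          (o ∷ w ∷ e ∷ (unary (𝟙 c) ++ r) ∷ a ∷ [] ∷ [])
  result []          .false refl = branches-empty refl skips
  result (false ∷ w) .false refl = branches refl skips
  result (true ∷ w)  .true  refl = branches refl pushes
  arith : ∀ a b → (a + 6) + (1 + (1 + (2 + (b + 1)))) ≡ a + b + 11
  arith = solve-∀

ʳ++-involutive : ∀ (w : Word) → (w List.ʳ++ []) List.ʳ++ [] ≡ w
ʳ++-involutive w = trans (List.ʳ++-defn (w List.ʳ++ [])) (trans (List.++-identityʳ _)
  (trans (cong List.reverse (trans (List.ʳ++-defn w) (List.++-identityʳ _))) (List.reverse-involutive w)))

inputLength : Prog 6
inputLength = push false stackR ⨾
  while-nonempty stackW (branch stackW skip (pop stackW ⨾ push false stackA ⨾ push true stackR) (pop stackW ⨾ push true stackA ⨾ push true stackR)) ⨾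
  moveAll stackA stackW

measures : ∀ {o e} w {r} → Runs inputLength (o ∷ w ∷ e ∷ r ∷ [] ∷ [] ∷ []) (length w * 9 + 3)
                                            (o ∷ w ∷ e ∷ (unary (length w) ++ r) ∷ [] ∷ [] ∷ [])
measures {o} {e} w {r} = within (≤-reflexive bound)
  (pushes
   then count [] w
   then ending (cong₂ (λ w r → o ∷ w ∷ e ∷ r ∷ [] ∷ [] ∷ []) (ʳ++-involutive w) (trans (iter-push (length w) (false ∷ r)) (sym (unary-++ (length w) r))))
          (moves-all AW (w List.ʳ++ [])))
  where
  count : ∀ a w {r} → Runs (while-nonempty stackW (branch stackW skip (pop stackW ⨾ push false stackA ⨾ push true stackR) (pop stackW ⨾ push true stackA ⨾ push true stackR)))
                      (o ∷ w ∷ e ∷ r ∷ a ∷ [] ∷ []) (length w * 5 + 1)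
                      (o ∷ [] ∷ e ∷ iter (length w) (λ _ → true ∷_) r ∷ (w List.ʳ++ a) ∷ [] ∷ [])
  count a [] = while-stops refl
  count a (false ∷ w) = while-goes-on refl (branches refl (pops then pushes then pushes)) (count (false ∷ a) w)
  count a (true ∷ w)  = while-goes-on refl (branches refl (pops then pushes then pushes)) (count (true ∷ a) w)
  bound : 1 + ((length w * 5 + 1) + (length (w List.ʳ++ []) * 4 + 1)) ≡ length w * 9 + 3
  bound = trans (cong (λ l → 1 + ((length w * 5 + 1) + (l * 4 + 1))) (trans (List.length-ʳ++ w) (+-identityʳ _))) (arith (length w))
    where
    arith : ∀ l → 1 + ((l * 5 + 1) + (l * 4 + 1)) ≡ l * 9 + 3
    arith = solve-∀

dropBlock : Fin 6 → Prog 6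
dropBlock X = loop X skip ⨾ pop X

drops-block : ∀ {X st} → View X {⊤} (λ _ → st) → ∀ n {x} →
              Runs (dropBlock X) (st [] (unary n ++ x)) (n * 6 + 7) (st [] x)
drops-block {st = st} v n = within (≤-reflexive (+-assoc (n * 6) 6 1))
  (loops v n (λ _ _ _ → skips) then ending (View.pop-stack v {s = tt}) pops)

infixl 6 _⊕_ _⊖_

-- Bounded sums are the only form of iteration, which keeps values and running times polynomial in
-- the length of the input word and the variables (`valP`, `timeP`). `call` evaluates a body in an
-- environment that consists of the arguments alone, so definitions can be reused in any context
-- without renaming.
data Term : ℕ → Set where
  var     : ∀ {r} → Fin r → Term r
  lit     : ∀ {r} → ℕ → Term r
  _⊕_ _⊖_ : ∀ {r} → Term r → Term r → Term r
  sumOf     : ∀ {r} → Term r → Term (suc r) → Term r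
  call    : ∀ {k r} → Term k → Vec (Term r) k → Term r
  bitOf     : ∀ {r} → Term r → Term r
  inputLen     : ∀ {r} → Term r

eval    : ∀ {r} → Word → Term r → Vec ℕ r → ℕ
evalAll : ∀ {k r} → Word → Vec (Term r) k → Vec ℕ r → Vec ℕ k
eval w (var i)     ρ = lookup ρ i
eval w (lit n)     ρ = n
eval w (t ⊕ u)     ρ = eval w t ρ + eval w u ρ
eval w (t ⊖ u)     ρ = eval w t ρ ∸ eval w u ρ
eval w (sumOf t u)   ρ = ∑ (eval w t ρ) λ i → eval w u (i ∷ ρ)
eval w (call f ts) ρ = eval w f (evalAll w ts ρ)
eval w (bitOf t)     ρ = 𝟙 (bitAt w (eval w t ρ))
eval w inputLen         ρ = length w
evalAll w []       ρ = []
evalAll w (t ∷ ts) ρ = eval w t ρ ∷ evalAll w ts ρ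

pushLit : ℕ → Prog 6
pushLit zero    = push false stackR
pushLit (suc n) = pushLit n ⨾ push true stackR

dropBlocks : ℕ → Prog 6
dropBlocks zero    = skip
dropBlocks (suc k) = dropBlock stackE ⨾ dropBlocks k

-- compile ρ t computes t on R, where variable i of t is the value number
-- ρ i on E.

compile    : ∀ {r m} → Vec (Fin m) r → Term r → Prog 6
compileAll : ∀ {k r m} → Vec (Fin m) r → Vec (Term r) k → Prog 6
compile ρ (var i)   = pick (lookup ρ i)
compile ρ (lit n)   = pushLit n
compile ρ (t ⊕ u)   = compile ρ t ⨾ compile ρ u ⨾ add
compile ρ (t ⊖ u)   = compile ρ t ⨾ compile ρ u ⨾ monus
-- The bound becomes a block on `E`, and what is left of it in a round is the value of the summation
-- index. The accumulator waits on `R`.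
compile ρ (sumOf t u) = compile ρ t ⨾ moveBlock stackR stackE ⨾ push false stackR ⨾
                      loop stackE (compile (zero ∷ Vec.map suc ρ) u ⨾ add) ⨾ pop stackE
compile {m = m} ρ (call {k} f ts) =
  compileAll ρ ts ⨾ compile (tabulate (_↑ˡ m)) f ⨾ dropBlocks k
compile ρ (bitOf t)   = compile ρ t ⨾ readBit
compile ρ inputLen       = inputLength
compileAll ρ [] = skip
-- The last argument is computed first, so that the first one ends up on top. The `k` results
-- already on `E` shift the positions of the variables.
compileAll ρ (_∷_ {n = k} t ts) = compileAll ρ ts ⨾ compile (Vec.map (k ↑ʳ_) ρ) t ⨾ moveBlock stackR stackE

-- Polynomials bounding values and running times

data Poly : Set where
  constant         : ℕ → Poly
  arg           : Poly
  _:+_ _:*_ _∘ₚ_ : Poly → Poly → Poly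

infixl 6 _:+_
infixl 7 _:*_

⟦_⟧ : Poly → ℕ → ℕ
⟦ constant n ⟧  M = n
⟦ arg ⟧      M = M
⟦ p :+ q ⟧ M = ⟦ p ⟧ M + ⟦ q ⟧ M
⟦ p :* q ⟧ M = ⟦ p ⟧ M * ⟦ q ⟧ M
⟦ p ∘ₚ q ⟧ M = ⟦ p ⟧ (⟦ q ⟧ M)

-- Not the degree, but an exponent of `2 + M` that suffices for `⟦⟧≤power`. A constant is absorbed
-- by n ≤ 2^n; a sum costs one factor, as a + b ≤ 2ab for positive a and b; a composition costs two
-- factors in the inner bound B, as 2 + B ≤ (2 + M)^2 B.
deg : Poly → ℕ
deg (constant n)  = n
deg arg        = 1
deg (p :+ q) = suc (deg p + deg q)
deg (p :* q) = deg p + deg q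
deg (p ∘ₚ q) = (2 + deg q) * deg p

n≤2^n : ∀ M n → n ≤ (2 + M) ^ n
n≤2^n M zero    = z≤n
n≤2^n M (suc n) = begin
  suc n                       ≤⟨ +-mono-≤ {1} (m^n>0 (2 + M) n) (n≤2^n M n) ⟩
  (2 + M) ^ n + (2 + M) ^ n   ≡⟨ cong ((2 + M) ^ n +_) (sym (+-identityʳ _)) ⟩
  2 * (2 + M) ^ n             ≤⟨ *-monoˡ-≤ ((2 + M) ^ n) (m≤m+n 2 M) ⟩
  (2 + M) ^ suc n             ∎
  where open ≤-Reasoning

+≤2* : ∀ {a b} → 0 < a → 0 < b → a + b ≤ 2 * (a * b)
+≤2* {suc a} {suc b} _ _ = ≤-trans (m≤m+n _ (a + b + 2 * (a * b))) (≤-reflexive (arith a b))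
  where
  arith : ∀ a b → suc a + suc b + (a + b + 2 * (a * b)) ≡ 2 * (suc a * suc b)
  arith = solve-∀

⟦⟧≤power : ∀ p M → ⟦ p ⟧ M ≤ (2 + M) ^ deg p
⟦⟧≤power (constant n)  M = n≤2^n M n
⟦⟧≤power arg        M = ≤-trans (m≤n+m M 2) (≤-reflexive (sym (*-identityʳ (2 + M))))
⟦⟧≤power (p :+ q) M = begin
  ⟦ p ⟧ M + ⟦ q ⟧ M                       ≤⟨ +-mono-≤ (⟦⟧≤power p M) (⟦⟧≤power q M) ⟩
  (2 + M) ^ deg p + (2 + M) ^ deg q       ≤⟨ +≤2* (m^n>0 (2 + M) (deg p)) (m^n>0 (2 + M) (deg q)) ⟩
  2 * ((2 + M) ^ deg p * (2 + M) ^ deg q) ≤⟨ *-monoˡ-≤ ((2 + M) ^ deg p * (2 + M) ^ deg q) (m≤m+n 2 M) ⟩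
  (2 + M) * ((2 + M) ^ deg p * (2 + M) ^ deg q) ≡⟨ cong ((2 + M) *_) (sym (^-distribˡ-+-* (2 + M) (deg p) (deg q))) ⟩
  (2 + M) ^ suc (deg p + deg q)           ∎
  where open ≤-Reasoning
⟦⟧≤power (p :* q) M = ≤-trans (*-mono-≤ (⟦⟧≤power p M) (⟦⟧≤power q M)) (≤-reflexive (sym (^-distribˡ-+-* (2 + M) (deg p) (deg q))))
⟦⟧≤power (p ∘ₚ q) M = begin
  ⟦ p ⟧ (⟦ q ⟧ M)                   ≤⟨ ⟦⟧≤power p _ ⟩
  (2 + ⟦ q ⟧ M) ^ deg p             ≤⟨ ^-monoˡ-≤ (deg p) (+-monoʳ-≤ 2 (⟦⟧≤power q M)) ⟩
  (2 + (2 + M) ^ deg q) ^ deg p     ≤⟨ ^-monoˡ-≤ (deg p) step ⟩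
  ((2 + M) ^ (2 + deg q)) ^ deg p   ≡⟨ ^-*-assoc (2 + M) (2 + deg q) (deg p) ⟩
  (2 + M) ^ ((2 + deg q) * deg p)   ∎
  where
  open ≤-Reasoning
  B = (2 + M) ^ deg q
  step : 2 + B ≤ (2 + M) * ((2 + M) * B)
  step = begin
    2 + B                     ≤⟨ +-monoˡ-≤ B (*-monoʳ-≤ 2 (m^n>0 (2 + M) (deg q))) ⟩
    2 * B + B                 ≤⟨ m≤m+n _ B ⟩
    2 * B + B + B             ≡⟨ arith B ⟩
    2 * (2 * B)               ≤⟨ *-mono-≤ (m≤m+n 2 M) (*-monoˡ-≤ B (m≤m+n 2 M)) ⟩
    (2 + M) * ((2 + M) * B)   ∎
    where
    arith : ∀ B → 2 * B + B + B ≡ 2 * (2 * B)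
    arith = solve-∀

-- The argument bounds the variables and the length of the input word at once. Under a sum or a call
-- the environment contains values of other terms, so the argument is increased by the bound on
-- these.
valP  : ∀ {r} → Term r → Poly
valPs : ∀ {k r} → Vec (Term r) k → Poly
valP (var i)     = arg
valP (lit n)     = constant n
valP (t ⊕ u)     = valP t :+ valP u
valP (t ⊖ u)     = valP t
valP (sumOf t u)   = valP t :* (valP u ∘ₚ (arg :+ valP t))
valP (call f ts) = valP f ∘ₚ (arg :+ valPs ts)
valP (bitOf t)     = constant 1
valP inputLen         = arg
valPs []         = constant 0
valPs (t ∷ ts)   = valP t :+ valPs ts

record AllUpTo {m} (M : ℕ) (vs : Vec ℕ m) : Set where
  constructor upTo
  field
    at : ∀ i → lookup vs i ≤ M

open AllUpTo

AllUpTo-[] : ∀ {M} → AllUpTo M []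
AllUpTo-[] .at ()

AllUpTo-∷ : ∀ {m M v} {vs : Vec ℕ m} → v ≤ M → AllUpTo M vs → AllUpTo M (v ∷ vs)
AllUpTo-∷ v≤ vs≤ .at zero    = v≤
AllUpTo-∷ v≤ vs≤ .at (suc i) = vs≤ .at i

AllUpTo-++ : ∀ {k m M} (us : Vec ℕ k) {vs : Vec ℕ m} → AllUpTo M us → AllUpTo M vs → AllUpTo M (us Vec.++ vs)
AllUpTo-++ []       us≤ vs≤ = vs≤
AllUpTo-++ (u ∷ us) us≤ vs≤ = AllUpTo-∷ (us≤ .at zero) (AllUpTo-++ us (upTo λ i → us≤ .at (suc i)) vs≤)

AllUpTo-≤ : ∀ {m M N} {vs : Vec ℕ m} → M ≤ N → AllUpTo M vs → AllUpTo N vs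
AllUpTo-≤ le vs≤ .at i = ≤-trans (vs≤ .at i) le

AllUpTo-map : ∀ {k m M} {vs : Vec ℕ m} (ρ : Vec (Fin m) k) → AllUpTo M vs → AllUpTo M (Vec.map (lookup vs) ρ)
AllUpTo-map {vs = vs} ρ vs≤ .at i = subst (_≤ _) (sym (Vec.lookup-map i (lookup vs) ρ)) (vs≤ .at (lookup ρ i))

eval≤    : ∀ {r} w (t : Term r) {ρ M} → AllUpTo M ρ → length w ≤ M → eval w t ρ ≤ ⟦ valP t ⟧ M
evalAll≤ : ∀ {k r} w (ts : Vec (Term r) k) {ρ M} → AllUpTo M ρ → length w ≤ M → AllUpTo (⟦ valPs ts ⟧ M) (evalAll w ts ρ)
eval≤ w (var i)     ρ≤ w≤ = ρ≤ .at i
eval≤ w (lit n)     ρ≤ w≤ = ≤-refl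
eval≤ w (t ⊕ u)     ρ≤ w≤ = +-mono-≤ (eval≤ w t ρ≤ w≤) (eval≤ w u ρ≤ w≤)
eval≤ w (t ⊖ u) {ρ} ρ≤ w≤ = ≤-trans (m∸n≤m (eval w t ρ) (eval w u ρ)) (eval≤ w t ρ≤ w≤)
eval≤ w (sumOf t u) {M = M} ρ≤ w≤ = ≤-trans
  (∑≤n*c _ (⟦ valP u ⟧ (M + ⟦ valP t ⟧ M)) λ i i<t →
    eval≤ w u (AllUpTo-∷ (≤-trans (<⇒≤ i<t) (≤-trans (eval≤ w t ρ≤ w≤) (m≤n+m _ M))) (AllUpTo-≤ (m≤m+n M _) ρ≤)) (m≤n⇒m≤n+o _ w≤))
  (*-monoˡ-≤ _ (eval≤ w t ρ≤ w≤))
eval≤ w (call f ts) {M = M} ρ≤ w≤ = eval≤ w f (AllUpTo-≤ (m≤n+m _ M) (evalAll≤ w ts ρ≤ w≤)) (m≤n⇒m≤n+o _ w≤)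
eval≤ w (bitOf t)     ρ≤ w≤ = 𝟙≤1 _
eval≤ w inputLen         ρ≤ w≤ = w≤
evalAll≤ w []       ρ≤ w≤ = AllUpTo-[]
evalAll≤ w (t ∷ ts) ρ≤ w≤ .at zero    = m≤n⇒m≤n+o _ (eval≤ w t ρ≤ w≤)
evalAll≤ w (t ∷ ts) ρ≤ w≤ .at (suc i) = m≤n⇒m≤o+n _ (evalAll≤ w ts ρ≤ w≤ .at i)

moveP : Poly → Poly
moveP p = p :* constant 6 :+ constant 8

timeP  : ∀ {r m} → Vec (Fin m) r → Term r → Poly
timePs : ∀ {k r m} → Vec (Fin m) r → Vec (Term r) k → Poly
timeP ρ (var i)   = constant (suc (toℕ (lookup ρ i))) :* (arg :* constant 13 :+ constant 17)
timeP ρ (lit n)   = constant (n + 1)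
timeP ρ (t ⊕ u)   = timeP ρ t :+ (timeP ρ u :+ (valP u :* constant 12 :+ constant 15))
timeP ρ (t ⊖ u)   = timeP ρ t :+ (timeP ρ u :+ (valP u :* constant 13 :+ constant 15))
timeP ρ (sumOf t u) = timeP ρ t :+ (moveP (valP t) :+ (constant 1 :+ ((valP t :* (round :+ constant 5) :+ constant 6) :+ constant 1)))
  where
  round = (timeP (zero ∷ Vec.map suc ρ) u :+ (valP u :* constant 12 :+ constant 15)) ∘ₚ (arg :+ valP t)
timeP {m = m} ρ (call {k} f ts) =
  timePs ρ ts :+ ((timeP (tabulate (_↑ˡ m)) f ∘ₚ (arg :+ valPs ts)) :+ (constant k :* (valPs ts :* constant 6 :+ constant 7) :+ constant 1))
timeP ρ (bitOf t)   = timeP ρ t :+ ((valP t :* constant 8 :+ arg :* constant 4) :+ constant 11)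
timeP ρ inputLen       = arg :* constant 9 :+ constant 3
timePs ρ []       = constant 1
timePs ρ (_∷_ {n = k} t ts) = timePs ρ ts :+ ((timeP (Vec.map (k ↑ʳ_) ρ) t ∘ₚ (arg :+ valPs ts)) :+ moveP (valP t))

pushes-lit : ∀ n {o w e r a} → Runs (pushLit n) (o ∷ w ∷ e ∷ r ∷ a ∷ [] ∷ []) (n + 1) (o ∷ w ∷ e ∷ (unary n ++ r) ∷ a ∷ [] ∷ [])
pushes-lit zero    = pushes
pushes-lit (suc n) = within (≤-reflexive (+-comm (n + 1) 1)) (pushes-lit n then pushes)

map-lookup-∷ : ∀ {r m} v (vs : Vec ℕ m) (ρ : Vec (Fin m) r) → Vec.map (lookup (v ∷ vs)) (Vec.map suc ρ) ≡ Vec.map (lookup vs) ρ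
map-lookup-∷ v vs ρ = sym (Vec.map-∘ (lookup (v ∷ vs)) suc ρ)

map-lookup-++ʳ : ∀ {k r m} (us : Vec ℕ k) (vs : Vec ℕ m) (ρ : Vec (Fin m) r) →
                 Vec.map (lookup (us Vec.++ vs)) (Vec.map (k ↑ʳ_) ρ) ≡ Vec.map (lookup vs) ρ
map-lookup-++ʳ {k} us vs ρ = trans (sym (Vec.map-∘ (lookup (us Vec.++ vs)) (k ↑ʳ_) ρ)) (Vec.map-cong (Vec.lookup-++ʳ us vs) ρ)

map-lookup-++ˡ : ∀ {k m} (us : Vec ℕ k) (vs : Vec ℕ m) → Vec.map (lookup (us Vec.++ vs)) (tabulate (_↑ˡ m)) ≡ us
map-lookup-++ˡ {m = m} us vs = trans (sym (Vec.tabulate-∘ (lookup (us Vec.++ vs)) (_↑ˡ m)))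
  (trans (Vec.tabulate-cong (Vec.lookup-++ˡ us vs)) (Vec.tabulate∘lookup us))

drops-blocks : ∀ {k m N} (us : Vec ℕ k) {vs : Vec ℕ m} → AllUpTo N us → ∀ {o w r} →
               Runs (dropBlocks k) (o ∷ w ∷ encs (us Vec.++ vs) ∷ r ∷ [] ∷ [] ∷ []) (k * (N * 6 + 7) + 1)
                                   (o ∷ w ∷ encs vs ∷ r ∷ [] ∷ [] ∷ [])
drops-blocks []       us≤ = skips
drops-blocks {suc k} {N = N} (u ∷ us) us≤ {o} {w} {r} =
  within (≤-trans (+-monoˡ-≤ _ (+-monoˡ-≤ 7 (*-monoˡ-≤ 6 (us≤ .at zero)))) (≤-reflexive (sym (+-assoc (N * 6 + 7) (k * (N * 6 + 7)) 1))))
    (drops-block {st = λ f x → o ∷ w ∷ x ∷ r ∷ [] ∷ f ∷ []} (view refl refl refl refl refl) u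
     then drops-blocks us (upTo λ i → us≤ .at (suc i)))

iter-∑ : ∀ n f s → iter n (λ i s → f i + s) s ≡ ∑ n f + s
iter-∑ zero    f s = refl
iter-∑ (suc n) f s = trans (iter-∑ n f (f n + s)) (trans (sym (+-assoc (∑ n f) (f n) s)) (cong (_+ s) (+-comm (∑ n f) (f n))))

module _ {w : Word} where

  compiled    : ∀ {r m} (t : Term r) (ρ : Vec (Fin m) r) (vs : Vec ℕ m) {M} → AllUpTo M vs → length w ≤ M → ∀ {o x} →
                Runs (compile ρ t) (o ∷ w ∷ encs vs ∷ x ∷ [] ∷ [] ∷ []) (⟦ timeP ρ t ⟧ M)
                                   (o ∷ w ∷ encs vs ∷ (unary (eval w t (Vec.map (lookup vs) ρ)) ++ x) ∷ [] ∷ [] ∷ [])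
  compiledAll : ∀ {k r m} (ts : Vec (Term r) k) (ρ : Vec (Fin m) r) (vs : Vec ℕ m) {M} → AllUpTo M vs → length w ≤ M → ∀ {o x} →
                Runs (compileAll ρ ts) (o ∷ w ∷ encs vs ∷ x ∷ [] ∷ [] ∷ []) (⟦ timePs ρ ts ⟧ M)
                                       (o ∷ w ∷ encs (evalAll w ts (Vec.map (lookup vs) ρ) Vec.++ vs) ∷ x ∷ [] ∷ [] ∷ [])
  compiled (var i) ρ vs vs≤ w≤ {o} {x} =
    ending (cong (λ v → o ∷ w ∷ encs vs ∷ (unary v ++ x) ∷ [] ∷ [] ∷ []) (sym (Vec.lookup-map i (lookup vs) ρ)))
      (picks (lookup ρ i) {vs} (vs≤ .at))
  compiled (lit n) ρ vs vs≤ w≤ = pushes-lit n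
  compiled (t ⊕ u) ρ vs vs≤ w≤ {o} {x} = compiled t ρ vs vs≤ w≤ then compiled u ρ vs vs≤ w≤ then
    within (+-monoˡ-≤ 15 (*-monoˡ-≤ 12 (eval≤ w u (AllUpTo-map ρ vs≤) w≤)))
      (ending (cong (λ v → o ∷ w ∷ encs vs ∷ (unary v ++ x) ∷ [] ∷ [] ∷ []) (+-comm (eval w u _) (eval w t _)))
        (adds (eval w u _) (eval w t _)))
  compiled (t ⊖ u) ρ vs vs≤ w≤ = compiled t ρ vs vs≤ w≤ then compiled u ρ vs vs≤ w≤ then
    within (+-monoˡ-≤ 15 (*-monoˡ-≤ 13 (eval≤ w u (AllUpTo-map ρ vs≤) w≤))) (monuses (eval w t _) (eval w u _))
  compiled (sumOf t u) ρ vs {M} vs≤ w≤ {o} {x} =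
    compiled t ρ vs vs≤ w≤
    then within (+-monoˡ-≤ 8 (*-monoˡ-≤ 6 t≤)) (moves-block RE n)
    then pushes
    then within (+-monoˡ-≤ 6 (*-monoˡ-≤ (⟦ round ⟧ M + 5) t≤))
           (loops {st = λ acc f x′ → o ∷ w ∷ x′ ∷ (unary acc ++ x) ∷ [] ∷ f ∷ []} (view refl refl refl refl refl) {T = ⟦ round ⟧ M} {step = λ i acc → f i + acc} n
             {0} (λ i acc i<n →
               ending (cong (λ ρ′ → o ∷ w ∷ encs (i ∷ vs) ∷ (unary (eval w u (i ∷ ρ′) + acc) ++ x) ∷ [] ∷ [] ∷ []) (map-lookup-∷ i vs ρ))
                 (compiled u (zero ∷ Vec.map suc ρ) (i ∷ vs) (bound i i<n) (m≤n⇒m≤n+o _ w≤)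
                  then within (+-monoˡ-≤ 15 (*-monoˡ-≤ 12 (eval≤ w u (AllUpTo-map (zero ∷ Vec.map suc ρ) (bound i i<n)) (m≤n⇒m≤n+o _ w≤))))
                         (adds (eval w u _) acc))))
    then ending (cong (λ v → o ∷ w ∷ encs vs ∷ (unary v ++ x) ∷ [] ∷ [] ∷ []) (trans (iter-∑ n f 0) (+-identityʳ _))) pops
    where
    ρs = Vec.map (lookup vs) ρ
    n = eval w t ρs
    f = λ i → eval w u (i ∷ ρs)
    round = (timeP (zero ∷ Vec.map suc ρ) u :+ (valP u :* constant 12 :+ constant 15)) ∘ₚ (arg :+ valP t)
    t≤ : n ≤ ⟦ valP t ⟧ M
    t≤ = eval≤ w t (AllUpTo-map ρ vs≤) w≤
    bound : ∀ i → i < n → AllUpTo (M + ⟦ valP t ⟧ M) (i ∷ vs)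
    bound i i<n = AllUpTo-∷ (≤-trans (<⇒≤ i<n) (≤-trans t≤ (m≤n+m _ M))) (AllUpTo-≤ (m≤m+n M _) vs≤)
  compiled {m = m} (call {k} f ts) ρ vs {M} vs≤ w≤ {o} {x} =
    compiledAll ts ρ vs vs≤ w≤
    then ending (cong (λ as → o ∷ w ∷ encs (us Vec.++ vs) ∷ (unary (eval w f as) ++ x) ∷ [] ∷ [] ∷ []) (map-lookup-++ˡ us vs))
           (compiled f (tabulate (_↑ˡ m)) (us Vec.++ vs) (AllUpTo-++ us (AllUpTo-≤ (m≤n+m _ M) us≤) (AllUpTo-≤ (m≤m+n M _) vs≤)) (m≤n⇒m≤n+o _ w≤))
    then drops-blocks us us≤
    where
    us = evalAll w ts (Vec.map (lookup vs) ρ)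
    us≤ : AllUpTo (⟦ valPs ts ⟧ M) us
    us≤ = evalAll≤ w ts (AllUpTo-map ρ vs≤) w≤
  compiled (bitOf t) ρ vs vs≤ w≤ = compiled t ρ vs vs≤ w≤ then
    within (+-monoˡ-≤ 11 (+-mono-≤ (*-monoˡ-≤ 8 (eval≤ w t (AllUpTo-map ρ vs≤) w≤)) (*-monoˡ-≤ 4 w≤))) (reads-bit w (eval w t _))
  compiled inputLen ρ vs vs≤ w≤ = within (+-monoˡ-≤ 3 (*-monoˡ-≤ 9 w≤)) (measures w)
  compiledAll [] ρ vs vs≤ w≤ = skips
  compiledAll (t ∷ ts) ρ vs {M} vs≤ w≤ {o} {x} =
    compiledAll ts ρ vs vs≤ w≤
    then ending (cong (λ ρ′ → o ∷ w ∷ encs (us Vec.++ vs) ∷ (unary (eval w t ρ′) ++ x) ∷ [] ∷ [] ∷ []) (map-lookup-++ʳ us vs ρ))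
           (compiled t (Vec.map (_ ↑ʳ_) ρ) (us Vec.++ vs) (AllUpTo-++ us (AllUpTo-≤ (m≤n+m _ M) us≤) (AllUpTo-≤ (m≤m+n M _) vs≤)) (m≤n⇒m≤n+o _ w≤))
    then within (+-monoˡ-≤ 8 (*-monoˡ-≤ 6 (eval≤ w t (AllUpTo-map ρ vs≤) w≤))) (moves-block RE (eval w t _))
    where
    us = evalAll w ts (Vec.map (lookup vs) ρ)
    us≤ : AllUpTo (⟦ valPs ts ⟧ M) us
    us≤ = evalAll≤ w ts (AllUpTo-map ρ vs≤) w≤

-- Transducers: programs that compute each output symbol by a term

emit : Prog 6
emit = branch stackR skip (push false stackO) (push true stackO) ⨾ dropBlock stackR

emits : ∀ v {o w e} → Runs emit (o ∷ w ∷ e ∷ (unary v ++ []) ∷ [] ∷ [] ∷ []) (2 + (v * 6 + 7))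
                                (((0 <ᵇ v) ∷ o) ∷ w ∷ e ∷ [] ∷ [] ∷ [] ∷ [])
emits v {o} {w} {e} = decide v then drops-block {stackR} {λ f x → ((0 <ᵇ v) ∷ o) ∷ w ∷ e ∷ x ∷ [] ∷ f ∷ []} (view refl refl refl refl refl) v
  where
  decide : ∀ v → Runs (branch stackR skip (push false stackO) (push true stackO)) (o ∷ w ∷ e ∷ (unary v ++ []) ∷ [] ∷ [] ∷ []) 2
                   (((0 <ᵇ v) ∷ o) ∷ w ∷ e ∷ (unary v ++ []) ∷ [] ∷ [] ∷ [])
  decide zero    = branches refl pushes
  decide (suc v) = branches refl pushes

-- Input and output share a stack. Each `moveAll` reverses the word, so two of them restore it and
-- leave `O` free.
fetchInput : Prog 6
fetchInput = moveAll stackO stackA ⨾ moveAll stackA stackW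

fetches : ∀ w → Runs fetchInput (w ∷ [] ∷ [] ∷ [] ∷ [] ∷ [] ∷ []) (length w * 8 + 2) ([] ∷ w ∷ [] ∷ [] ∷ [] ∷ [] ∷ [])
fetches w = within (≤-reflexive bound) (moves-all OA w then
  ending (cong (λ w → [] ∷ w ∷ [] ∷ [] ∷ [] ∷ [] ∷ []) (ʳ++-involutive w)) (moves-all AW (w List.ʳ++ [])))
  where
  bound : (length w * 4 + 1) + (length (w List.ʳ++ []) * 4 + 1) ≡ length w * 8 + 2
  bound = trans (cong (λ l → (length w * 4 + 1) + (l * 4 + 1)) (trans (List.length-ʳ++ w) (+-identityʳ _))) (arith (length w))
    where
    arith : ∀ l → (l * 4 + 1) + (l * 4 + 1) ≡ l * 8 + 2
    arith = solve-∀

-- Every output symbol is computed from scratch from its position. The only state is the block on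
-- `E`, which controls the loop and is at the same time the variable of `b`.
transducer : Term 0 → Term 1 → Prog 6
transducer l b = fetchInput ⨾ compile {m = 0} [] l ⨾ moveBlock stackR stackE ⨾ loop stackE (compile {m = 1} (zero ∷ []) b ⨾ emit)

transduce : Term 0 → Term 1 → Program
transduce l b = record { extraStacks = 5 ; code = transducer l b }

transduced : Term 0 → Term 1 → Word → Word
transduced l b w = List.applyUpTo (λ i → 0 <ᵇ eval w b (i ∷ [])) (eval w l [])

transducerTime : Term 0 → Term 1 → Poly
transducerTime l b = (arg :* constant 8 :+ constant 2) :+ (timeP {m = 0} [] l :+ (moveP (valP l) :+ (valP l :* (roundTime :+ constant 5) :+ constant 6)))
  where
  roundTime = (timeP {m = 1} (zero ∷ []) b :+ (constant 2 :+ (valP b :* constant 6 :+ constant 7))) ∘ₚ (arg :+ valP l)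

iter-applyUpTo : ∀ n (p : ℕ → Bool) s → iter n (λ i → p i ∷_) s ≡ List.applyUpTo p n ++ s
iter-applyUpTo zero    p s = refl
iter-applyUpTo (suc n) p s = trans (iter-applyUpTo n p (p n ∷ s))
  (trans (sym (List.∷ʳ-++ (List.applyUpTo p n) (p n) s)) (cong (_++ s) (List.applyUpTo-∷ʳ p n)))

transducer-runs : ∀ l b w → Runs (transducer l b) (w ∷ [] ∷ [] ∷ [] ∷ [] ∷ [] ∷ []) (⟦ transducerTime l b ⟧ (length w))
                                 (iter (eval w l []) (λ i → (0 <ᵇ eval w b (i ∷ [])) ∷_) [] ∷ w ∷ (false ∷ []) ∷ [] ∷ [] ∷ [] ∷ [])
transducer-runs l b w =
  fetches w then compiled l [] [] AllUpTo-[] ≤-refl then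
  within (+-monoˡ-≤ 8 (*-monoˡ-≤ 6 l≤)) (moves-block RE n) then
  within (+-monoˡ-≤ 6 (*-monoˡ-≤ (roundBound + 5) l≤))
    (loops {stackE} {Word} {λ o f x → o ∷ w ∷ x ∷ [] ∷ [] ∷ f ∷ []} (view refl refl refl refl refl)
      {T = roundBound} {step = λ i → (0 <ᵇ value i) ∷_} n rounds)
  where
  M = length w
  n = eval w l []
  value : ℕ → ℕ
  value i = eval w b (i ∷ [])
  roundBound = ⟦ timeP {m = 1} (zero ∷ []) b ⟧ (M + ⟦ valP l ⟧ M) + (2 + (⟦ valP b ⟧ (M + ⟦ valP l ⟧ M) * 6 + 7))
  l≤ : n ≤ ⟦ valP l ⟧ M
  l≤ = eval≤ w l AllUpTo-[] ≤-refl
  bound : ∀ i → i < n → AllUpTo (M + ⟦ valP l ⟧ M) (i ∷ [])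
  bound i i<n = AllUpTo-∷ (≤-trans (<⇒≤ i<n) (≤-trans l≤ (m≤n+m _ M))) AllUpTo-[]
  rounds : ∀ i o → i < n → Runs (compile {m = 1} (zero ∷ []) b ⨾ emit) (o ∷ w ∷ (unary i ++ []) ∷ [] ∷ [] ∷ [] ∷ []) roundBound
                                (((0 <ᵇ value i) ∷ o) ∷ w ∷ (unary i ++ []) ∷ [] ∷ [] ∷ [] ∷ [])
  rounds i o i<n = compiled b (zero ∷ []) (i ∷ []) (bound i i<n) (m≤m+n M _) then
    within (+-monoʳ-≤ 2 (+-monoˡ-≤ 7 (*-monoˡ-≤ 6 (eval≤ w b (bound i i<n) (m≤m+n M _))))) (emits (value i))

opaque
  -- Opaque because the exponent is enormous for the terms of the reduction and only its existence
  -- matters.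
  transduces : ∀ l b → ∃ λ c → ∀ w → transduce l b on w yields transduced l b w within ((2 + length w) ^ c)
  transduces l b = deg (transducerTime l b) , λ w →
    let (t , code⇓ , t≤) = transducer-runs l b w
    in t , _ , code⇓ , trans (iter-applyUpTo (eval w l []) _ []) (List.++-identityʳ _) ,
       ≤-trans t≤ (⟦⟧≤power (transducerTime l b) (length w))

-- Composition of programs

renameStacks : ∀ {s s′} → (Fin s → Fin s′) → Prog s → Prog s′
renameStacks ι skip                 = skip
renameStacks ι (push b i)           = push b (ι i)
renameStacks ι (pop i)              = pop (ι i)
renameStacks ι (p ⨾ q)              = renameStacks ι p ⨾ renameStacks ι q
renameStacks ι (branch i p q r)     = branch (ι i) (renameStacks ι p) (renameStacks ι q) (renameStacks ι r)
renameStacks ι (while-nonempty i p) = while-nonempty (ι i) (renameStacks ι p)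

module Simulation {s s′} (ι : Fin s → Fin s′) (ι-injective : Injective _≡_ _≡_ ι) where

  Agree : Store s′ → Store s → Set
  Agree σ′ σ = ∀ i → lookup σ′ (ι i) ≡ lookup σ i

  Simulated : Prog s → Store s′ → ℕ → Store s → Set
  Simulated p σ′ t τ = ∃[ τ′ ] ⟨ renameStacks ι p , σ′ ⟩⇓[ t ] τ′ × Agree τ′ τ
                       × (∀ j → (∀ i → ι i ≢ j) → lookup τ′ j ≡ lookup σ′ j)

  private
    update : ∀ {σ σ′} (f : Word → Word) k → Agree σ′ σ → Agree (σ′ [ ι k ]%= f) (σ [ k ]%= f)
    update {σ} {σ′} f k agree i with i Fin.≟ k
    ... | yes refl = trans (Vec.lookup∘updateAt (ι i) σ′) (trans (cong f (agree i)) (sym (Vec.lookup∘updateAt i σ)))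
    ... | no  i≢k  = trans (Vec.lookup∘updateAt′ (ι i) (ι k) (λ eq → i≢k (ι-injective eq)) σ′)
                       (trans (agree i) (sym (Vec.lookup∘updateAt′ i k i≢k σ)))

    elsewhere : ∀ (f : Word → Word) k (σ′ : Store s′) j → (∀ i → ι i ≢ j) → lookup (σ′ [ ι k ]%= f) j ≡ lookup σ′ j
    elsewhere f k σ′ j ≢j = Vec.lookup∘updateAt′ j (ι k) (λ eq → ≢j k (sym eq)) σ′

  simulate : ∀ {p σ t τ} → ⟨ p , σ ⟩⇓[ t ] τ → ∀ σ′ → Agree σ′ σ → Simulated p σ′ t τ
  simulate run-skip σ′ agree = σ′ , run-skip , agree , λ _ _ → refl
  simulate {σ = σ} (run-push {b} {k}) σ′ agree = _ , run-push , update {σ} {σ′} (b ∷_) k agree , elsewhere (b ∷_) k σ′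
  simulate {σ = σ} (run-pop {k}) σ′ agree = _ , run-pop , update {σ} {σ′} (List.drop 1) k agree , elsewhere (List.drop 1) k σ′
  simulate (run-seq p⇓ q⇓) σ′ agree with simulate p⇓ σ′ agree
  ... | τ′ , p⇓′ , agree′ , frame with simulate q⇓ τ′ agree′
  ... | υ′ , q⇓′ , agree″ , frame′ = υ′ , run-seq p⇓′ q⇓′ , agree″ , λ j ≢j → trans (frame′ j ≢j) (frame j ≢j)
  simulate (run-branch-empty eq p⇓) σ′ agree with simulate p⇓ σ′ agree
  ... | τ′ , p⇓′ , agree′ , frame = τ′ , run-branch-empty (trans (agree _) eq) p⇓′ , agree′ , frame
  simulate (run-branch-false eq p⇓) σ′ agree with simulate p⇓ σ′ agree
  ... | τ′ , p⇓′ , agree′ , frame = τ′ , run-branch-false (trans (agree _) eq) p⇓′ , agree′ , frame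
  simulate (run-branch-true eq p⇓) σ′ agree with simulate p⇓ σ′ agree
  ... | τ′ , p⇓′ , agree′ , frame = τ′ , run-branch-true (trans (agree _) eq) p⇓′ , agree′ , frame
  simulate (run-while-done eq) σ′ agree = σ′ , run-while-done (trans (agree _) eq) , agree , λ _ _ → refl
  simulate (run-while-step eq p⇓ q⇓) σ′ agree with simulate p⇓ σ′ agree
  ... | τ′ , p⇓′ , agree′ , frame with simulate q⇓ τ′ agree′
  ... | υ′ , q⇓′ , agree″ , frame′ =
    υ′ , run-while-step (trans (agree _) eq) p⇓′ q⇓′ , agree″ , λ j ≢j → trans (frame′ j ≢j) (frame j ≢j)

module _ (M N : Program) where
  private
    module M = Program M
    module N = Program N

    ι₁ : Fin (suc M.extraStacks) → Fin (suc (M.extraStacks + N.extraStacks))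
    ι₁ zero    = zero
    ι₁ (suc i) = suc (i ↑ˡ N.extraStacks)

    ι₂ : Fin (suc N.extraStacks) → Fin (suc (M.extraStacks + N.extraStacks))
    ι₂ zero    = zero
    ι₂ (suc i) = suc (M.extraStacks ↑ʳ i)

    ι₁-injective : Injective _≡_ _≡_ ι₁
    ι₁-injective {zero}  {zero}  eq = refl
    ι₁-injective {suc i} {suc j} eq = cong suc (Fin.↑ˡ-injective N.extraStacks i j (Fin.suc-injective eq))

    ι₂-injective : Injective _≡_ _≡_ ι₂
    ι₂-injective {zero}  {zero}  eq = refl
    ι₂-injective {suc i} {suc j} eq = cong suc (Fin.↑ʳ-injective M.extraStacks i j (Fin.suc-injective eq))

    apart : ∀ i j → ι₁ i ≢ suc (M.extraStacks ↑ʳ j)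
    apart (suc i) j eq with trans (sym (Fin.splitAt-↑ˡ M.extraStacks i N.extraStacks))
                        (trans (cong (Fin.splitAt M.extraStacks) (Fin.suc-injective eq)) (Fin.splitAt-↑ʳ M.extraStacks N.extraStacks j))
    ... | ()

  -- The programs share only the first stack. The first one may leave anything on its other stacks,
  -- so the second one gets its own; the frame property of `simulate` shows that these are still
  -- empty when it starts.
  _followed-by_ : Program
  _followed-by_ = record { extraStacks = M.extraStacks + N.extraStacks ; code = renameStacks ι₁ M.code ⨾ renameStacks ι₂ N.code }

  followed-by-yields : ∀ {x y z T U} → M on x yields y within T → N on y yields z within U →
                       _followed-by_ on x yields z within (T + U)
  followed-by-yields {x} {y} (t , τ , M⇓ , head-τ , t≤) (u , υ , N⇓ , head-υ , u≤)
    with Simulation.simulate ι₁ ι₁-injective M⇓ (x ∷ Vec.replicate _ [])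
           (λ { zero → refl ; (suc i) → trans (Vec.lookup-replicate (i ↑ˡ N.extraStacks) []) (sym (Vec.lookup-replicate i [])) })
  ... | τ′ , M⇓′ , agree , frame
    with Simulation.simulate ι₂ ι₂-injective N⇓ τ′
           (λ { zero    → trans (agree zero) (trans (first τ) head-τ)
              ; (suc j) → trans (frame _ λ i → apart i j) (trans (Vec.lookup-replicate (M.extraStacks ↑ʳ j) []) (sym (Vec.lookup-replicate j []))) })
    where
    first : ∀ {n} (v : Store (suc n)) → lookup v zero ≡ Vec.head v
    first (x ∷ v) = refl
  ... | υ′ , N⇓′ , agree′ , _ = _ , υ′ , run-seq M⇓′ N⇓′ , trans (sym (first υ′)) (trans (agree′ zero) (trans (first υ) head-υ)) , +-mono-≤ t≤ u≤
    where
    first : ∀ {n} (v : Store (suc n)) → lookup v zero ≡ Vec.head v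
    first (x ∷ v) = refl

-- A step adds at most one symbol. Through `output-length` this bounds the encoding of an
-- intermediate instance, in which the time of the second program is measured.
stack-growth : ∀ {s} {p : Prog s} {σ t τ} → ⟨ p , σ ⟩⇓[ t ] τ → ∀ i → length (lookup τ i) ≤ length (lookup σ i) + t
stack-growth {σ = σ} run-skip i = m≤m+n _ _
stack-growth {σ = σ} (run-push {b} {k}) i with i Fin.≟ k
... | yes refl = ≤-reflexive (trans (cong length (Vec.lookup∘updateAt i σ)) (+-comm 1 _))
... | no  i≢k  = ≤-trans (≤-reflexive (cong length (Vec.lookup∘updateAt′ i k i≢k σ))) (m≤m+n _ 1)
stack-growth {σ = σ} (run-pop {k}) i with i Fin.≟ k
... | yes refl = ≤-trans (≤-reflexive (trans (cong length (Vec.lookup∘updateAt i σ)) (List.length-drop 1 (lookup σ i)))) (≤-trans (m∸n≤m _ 1) (m≤m+n _ 1))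
... | no  i≢k  = ≤-trans (≤-reflexive (cong length (Vec.lookup∘updateAt′ i k i≢k σ))) (m≤m+n _ 1)
stack-growth (run-seq {t = t} {u} p⇓ q⇓) i =
  ≤-trans (stack-growth q⇓ i) (≤-trans (+-monoˡ-≤ u (stack-growth p⇓ i)) (≤-reflexive (+-assoc _ t u)))
stack-growth (run-branch-empty {t = t} _ p⇓) i = ≤-trans (stack-growth p⇓ i) (+-monoʳ-≤ _ (n≤1+n t))
stack-growth (run-branch-false {t = t} _ p⇓) i = ≤-trans (stack-growth p⇓ i) (+-monoʳ-≤ _ (n≤1+n t))
stack-growth (run-branch-true {t = t} _ p⇓) i = ≤-trans (stack-growth p⇓ i) (+-monoʳ-≤ _ (n≤1+n t))
stack-growth (run-while-done _) i = m≤m+n _ 1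
stack-growth (run-while-step {t = t} {u} _ p⇓ q⇓) i =
  ≤-trans (stack-growth q⇓ i) (≤-trans (+-monoˡ-≤ u (stack-growth p⇓ i)) (≤-trans (≤-reflexive (+-assoc _ t u)) (+-monoʳ-≤ _ (n≤1+n (t + u)))))

output-length : ∀ {M x y T} → M on x yields y within T → length y ≤ length x + T
output-length {M} {x} {y} (t , (o ∷ τ) , M⇓ , refl , t≤) = ≤-trans (stack-growth M⇓ zero) (+-monoʳ-≤ (length x) t≤)

-- Computable bounds, composition of reductions, hardness

Computable-∘ : ∀ {f g} → Computable f → Computable g → Computable (g ∘ f)
Computable-∘ {f} (M , M-computes) (N , N-computes) = (M followed-by N) , λ n →
  let (T , M⇓) = M-computes n
      (U , N⇓) = N-computes (f n)
  in T + U , followed-by-yields M N M⇓ N⇓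

_⊗_ : ∀ {r} → Term r → Term r → Term r
t ⊗ u = call (sumOf (var zero) (var (suc (suc zero)))) (t ∷ u ∷ [])

eval-⊗ : ∀ {r} w (t u : Term r) ρ → eval w (t ⊗ u) ρ ≡ eval w t ρ * eval w u ρ
eval-⊗ w t u ρ = ∑-const (eval w t ρ) (eval w u ρ)

power : ∀ {r} → Term r → ℕ → Term r
power t zero    = lit 1
power t (suc c) = t ⊗ power t c

eval-power : ∀ {r} w (t : Term r) c ρ → eval w (power t c) ρ ≡ eval w t ρ ^ c
eval-power w t zero    ρ = refl
eval-power w t (suc c) ρ = trans (eval-⊗ w t (power t c) ρ) (cong (eval w t ρ *_) (eval-power w t c ρ))

applyUpTo-const : ∀ n (p : ℕ → Bool) b → (∀ i → i < n → p i ≡ b) → List.applyUpTo p n ≡ replicate n b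
applyUpTo-const zero    p b eq = refl
applyUpTo-const (suc n) p b eq = cong₂ _∷_ (eq 0 z<s) (applyUpTo-const n (p ∘ suc) b λ i i<n → eq (suc i) (s≤s i<n))

0<ᵇ∸ : ∀ m n → (0 <ᵇ m ∸ n) ≡ (n <ᵇ m)
0<ᵇ∸ zero    n       = cong (0 <ᵇ_) (0∸n≡0 n)
0<ᵇ∸ (suc m) zero    = refl
0<ᵇ∸ (suc m) (suc n) = 0<ᵇ∸ m n

applyUpTo-unary : ∀ n (p : ℕ → Bool) → (∀ i → p i ≡ (i <ᵇ n)) → List.applyUpTo p (n + 1) ≡ unary n
applyUpTo-unary n p eq = trans (cong (List.applyUpTo p) (+-comm n 1)) (trans (sym (List.applyUpTo-∷ʳ p n))
  (cong₂ _∷ʳ_ (applyUpTo-const n p true λ i i<n → trans (eq i) (<ᵇ-true i<n)) (trans (eq n) (<ᵇ-false {n} ≤-refl))))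

length-unary : ∀ n → length (unary n) ≡ n + 1
length-unary n = trans (List.length-++ (replicate n true)) (cong (_+ 1) (List.length-replicate n))

Computable-power : ∀ c → Computable (λ n → (2 + n) ^ c)
Computable-power c = transduce l b , λ n → (2 + length (unary n)) ^ proj₁ (transduces l b) ,
  subst (λ y → transduce l b on unary n yields y within ((2 + length (unary n)) ^ proj₁ (transduces l b)))
    (output n) (proj₂ (transduces l b) (unary n))
  where
  base : ∀ {r} → Term r
  -- The input `unary n` has `n + 1` symbols, so the value is `2 + n`.
  base = lit 1 ⊕ inputLen
  l : Term 0
  l = power base c ⊕ lit 1
  b : Term 1
  b = power base c ⊖ var zero
  value : ∀ {r} n ρ → eval (unary n) (power {r} base c) ρ ≡ (2 + n) ^ c
  value n ρ = trans (eval-power (unary n) base c ρ) (cong (_^ c) (cong suc (trans (length-unary n) (+-comm n 1))))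
  output : ∀ n → transduced l b (unary n) ≡ unary ((2 + n) ^ c)
  output n = trans (cong (List.applyUpTo _) (cong (_+ 1) (value n [])))
    (applyUpTo-unary _ _ λ i → trans (cong (λ v → 0 <ᵇ v ∸ i) (value n (i ∷ []))) (0<ᵇ∸ _ i))

^-distribˡ-* : ∀ c a b → (a * b) ^ c ≡ a ^ c * b ^ c
^-distribˡ-* zero    a b = refl
^-distribˡ-* (suc c) a b = trans (cong (a * b *_) (^-distribˡ-* c a b)) (arith a b (a ^ c) (b ^ c))
  where
  arith : ∀ a b c d → (a * b) * (c * d) ≡ (a * c) * (b * d)
  arith = solve-∀

-- A problem in W[t] comes with a reduction to some `WCS t d`, so hardness requires one such record
-- for each `d`, to be appended by `≤fpt-polynomial`. The two terms see nothing but the encoding of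
-- an instance.
record PolynomialReduction (P Q : ParameterisedProblem) : Set where
  private
    module P = ParameterisedProblem P
    module Q = ParameterisedProblem Q
  field
    reduce    : P.Instance → Q.Instance
    correct   : ∀ x → P.Yes x ⇔ Q.Yes (reduce x)
    size      : Term 0
    symbol    : Term 1
    encodes   : ∀ x → transduced size symbol (P.encode x) ≡ Q.encode (reduce x)
    exponent  : ℕ
    parameter : ∀ x → Q.parameter (reduce x) ≤ (2 + P.parameter x) ^ exponent

module _ {P Q R : ParameterisedProblem} (P≤Q : P ≤fpt Q) (Q≤R : PolynomialReduction Q R) where
  private
    module P = ParameterisedProblem P
    module Q = ParameterisedProblem Q
    module R = ParameterisedProblem R
    module I = _≤fpt_ P≤Q
    module J = PolynomialReduction Q≤R
    e = proj₁ (transduces J.size J.symbol)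

    computes : ∀ x → (I.program followed-by transduce J.size J.symbol) on P.encode x yields R.encode (J.reduce (I.reduce x))
                      within ((2 + I.f (P.parameter x)) ^ (2 + e) * suc (length (P.encode x)) ^ (suc I.c * (2 + e)))
    computes x with followed-by-yields I.program (transduce J.size J.symbol) (I.computes x)
                      (subst (λ z → transduce J.size J.symbol on Q.encode (I.reduce x) yields z within _)
                        (J.encodes (I.reduce x)) (proj₂ (transduces J.size J.symbol) (Q.encode (I.reduce x))))
    ... | t , τ , M⇓ , head-τ , t≤ = t , τ , M⇓ , head-τ , ≤-trans t≤ bound
      where
      open ≤-Reasoning
      φ = I.f (P.parameter x)
      n = length (P.encode x)
      B = suc n
      T₁ = φ * B ^ I.c
      y = length (Q.encode (I.reduce x))
      -- A common bound: both `T₁` and `2 + y` are at most `D`, and `D` is at least 2. The total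
      -- time is then at most D + D^e ≤ 2 D D^e ≤ D^(2 + e), which splits into a function of the
      -- parameter and a power of `B`.
      D = (2 + φ) * B ^ suc I.c
      2≤D : 2 ≤ D
      2≤D = *-mono-≤ (m≤m+n 2 φ) (m^n>0 B (suc I.c))
      T₁≤ : T₁ ≤ φ * B ^ suc I.c
      T₁≤ = *-monoʳ-≤ φ (m≤n*m (B ^ I.c) B)
      2+y≤D : 2 + y ≤ D
      2+y≤D = begin
        2 + y                             ≤⟨ +-monoʳ-≤ 2 (output-length {I.program} (I.computes x)) ⟩
        2 + (n + T₁)                      ≡⟨ arith n T₁ ⟩
        1 + B + T₁                        ≤⟨ +-monoˡ-≤ T₁ (+-monoˡ-≤ B z<s) ⟩
        B + B + T₁                        ≡⟨ cong (_+ T₁) (cong (B +_) (sym (+-identityʳ B))) ⟩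
        2 * B + T₁                        ≤⟨ +-mono-≤ (*-monoʳ-≤ 2 (m≤m*n B (B ^ I.c) {{>-nonZero (m^n>0 B I.c)}})) T₁≤ ⟩
        2 * B ^ suc I.c + φ * B ^ suc I.c ≡⟨ sym (*-distribʳ-+ (B ^ suc I.c) 2 φ) ⟩
        D                                 ∎
        where
        arith : ∀ n T → 2 + (n + T) ≡ 1 + suc n + T
        arith = solve-∀
      bound : T₁ + (2 + y) ^ e ≤ (2 + φ) ^ (2 + e) * B ^ (suc I.c * (2 + e))
      bound = begin
        T₁ + (2 + y) ^ e                             ≤⟨ +-mono-≤ (≤-trans T₁≤ (*-monoˡ-≤ (B ^ suc I.c) (m≤n+m φ 2))) (^-monoˡ-≤ e 2+y≤D) ⟩
        D + D ^ e                                    ≤⟨ +≤2* (≤-trans z<s 2≤D) (m^n>0 D {{>-nonZero (≤-trans z<s 2≤D)}} e) ⟩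
        2 * (D * D ^ e)                              ≤⟨ *-monoˡ-≤ (D * D ^ e) 2≤D ⟩
        D ^ (2 + e)                                  ≡⟨ ^-distribˡ-* (2 + e) (2 + φ) (B ^ suc I.c) ⟩
        (2 + φ) ^ (2 + e) * (B ^ suc I.c) ^ (2 + e)  ≡⟨ cong ((2 + φ) ^ (2 + e) *_) (^-*-assoc B (suc I.c) (2 + e)) ⟩
        (2 + φ) ^ (2 + e) * B ^ (suc I.c * (2 + e))  ∎

  ≤fpt-polynomial : P ≤fpt R
  ≤fpt-polynomial = record
    { reduce          = J.reduce ∘ I.reduce
    ; correct         = λ x → mk⇔ (λ y → Equivalence.to (J.correct (I.reduce x)) (Equivalence.to (I.correct x) y))
                                  (λ y → Equivalence.from (I.correct x) (Equivalence.from (J.correct (I.reduce x)) y))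
    ; program         = I.program followed-by transduce J.size J.symbol
    ; f               = λ n → (2 + I.f n) ^ (2 + e)
    ; f-computable    = Computable-∘ I.f-computable (Computable-power (2 + e))
    ; c               = suc I.c * (2 + e)
    ; computes        = computes
    ; g               = λ n → (2 + I.g n) ^ J.exponent
    ; g-computable    = Computable-∘ I.g-computable (Computable-power J.exponent)
    ; parameter-bound = λ x → ≤-trans (J.parameter (I.reduce x)) (^-monoˡ-≤ J.exponent (+-monoʳ-≤ 2 (I.parameter-bound x)))
    }

W[]-hardness : ∀ {t R} → (∀ d → PolynomialReduction (WCS t d) R) → W[ t ]-hard R
W[]-hardness reductions Q (d , Q≤WCS) = ≤fpt-polynomial Q≤WCS (reductions d)

-- Counting by duplicate-free lists

private
  remove : ∀ {A : Set} {x : A} {ys} → x ∈ ys → ∃[ zs ] length ys ≡ suc (length zs) × (∀ {y} → y ≢ x → y ∈ ys → y ∈ zs)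
  remove {ys = y ∷ ys} (here refl) = ys , refl , λ { ≢x (here refl) → contradiction refl ≢x ; ≢x (there y∈) → y∈ }
  remove {ys = y ∷ ys} (there x∈) with remove x∈
  ... | zs , eq , keep = y ∷ zs , cong suc eq , λ { ≢x (here refl) → here refl ; ≢x (there y∈) → there (keep ≢x y∈) }

unique-⊆⇒length≤ : ∀ {A : Set} {xs ys : List A} → Unique xs → (∀ {x} → x ∈ xs → x ∈ ys) → length xs ≤ length ys
unique-⊆⇒length≤ [] sub = z≤n
unique-⊆⇒length≤ {ys = ys} (x∉ ∷ unique) sub with remove (sub (here refl))
... | zs , eq , keep = subst (suc _ ≤_) (sym eq) (s≤s (unique-⊆⇒length≤ unique λ {y} y∈ →
  keep (λ y≡x → All.lookup x∉ y∈ (sym y≡x)) (sub (there y∈))))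

-- Pigeonhole: if `y` were missing from `xs`, then `xs` would fit into `ys` without `y`, which is
-- too short. For irregulators this turns a tight budget into the fact that nothing else is deleted.
unique-⊆-full : ∀ {A : Set} → (∀ (x y : A) → Dec (x ≡ y)) → {xs ys : List A} → Unique xs → (∀ {x} → x ∈ xs → x ∈ ys) →
                length ys ≤ length xs → ∀ {y} → y ∈ ys → y ∈ xs
unique-⊆-full _≟_ {xs} unique sub le {y} y∈ with Any.any? (y ≟_) xs
... | yes y∈xs = y∈xs
... | no  y∉xs with remove y∈
... | zs , eq , keep = contradiction (≤-trans le (unique-⊆⇒length≤ unique λ {x} x∈ → keep (λ { refl → y∉xs x∈ }) (sub x∈)))
                         (<⇒≱ (≤-reflexive (sym eq)))

count : ∀ {A : Set} → (A → Bool) → List A → ℕ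
count p []       = 0
count p (x ∷ xs) = 𝟙 (p x) + count p xs

select : ∀ {A : Set} → (A → Bool) → List A → List A
select p []       = []
select p (x ∷ xs) = if p x then x ∷ select p xs else select p xs

length-select : ∀ {A : Set} (p : A → Bool) xs → length (select p xs) ≡ count p xs
length-select p []       = refl
length-select p (x ∷ xs) with p x
... | true  = cong suc (length-select p xs)
... | false = length-select p xs

∈-select⁺ : ∀ {A : Set} (p : A → Bool) {xs x} → x ∈ xs → p x ≡ true → x ∈ select p xs
∈-select⁺ p {x ∷ xs} (here refl) px with p x
... | true = here refl
∈-select⁺ p {y ∷ xs} (there x∈) px with p y
... | true  = there (∈-select⁺ p x∈ px)
... | false = ∈-select⁺ p x∈ px

∈-select⁻ : ∀ {A : Set} (p : A → Bool) {xs x} → x ∈ select p xs → x ∈ xs × p x ≡ true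
∈-select⁻ p {y ∷ xs} x∈ with p y in eq | x∈
... | true  | here refl = here refl , eq
... | true  | there x∈′ = let (x∈xs , px) = ∈-select⁻ p x∈′ in there x∈xs , px
... | false | x∈′       = let (x∈xs , px) = ∈-select⁻ p x∈′ in there x∈xs , px

unique-select : ∀ {A : Set} (p : A → Bool) {xs} → Unique xs → Unique (select p xs)
unique-select p [] = []
unique-select p {x ∷ xs} (x∉ ∷ unique) with p x
... | true  = All.tabulate (λ y∈ → All.lookup x∉ (proj₁ (∈-select⁻ p y∈))) ∷ unique-select p unique
... | false = unique-select p unique

count-++ : ∀ {A : Set} (p : A → Bool) xs ys → count p (xs ++ ys) ≡ count p xs + count p ys
count-++ p []       ys = refl
count-++ p (x ∷ xs) ys = trans (cong (𝟙 (p x) +_) (count-++ p xs ys)) (sym (+-assoc (𝟙 (p x)) _ _))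

count-cong : ∀ {A : Set} {p q : A → Bool} xs → (∀ {x} → x ∈ xs → p x ≡ q x) → count p xs ≡ count q xs
count-cong []       eq = refl
count-cong (x ∷ xs) eq = cong₂ _+_ (cong 𝟙 (eq (here refl))) (count-cong xs (eq ∘ there))

count-map : ∀ {A B : Set} (p : B → Bool) (f : A → B) xs → count p (List.map f xs) ≡ count (p ∘ f) xs
count-map p f []       = refl
count-map p f (x ∷ xs) = cong (𝟙 (p (f x)) +_) (count-map p f xs)

count-downFrom : ∀ p n → count p (List.downFrom n) ≡ ∑ n (λ i → 𝟙 (p i))
count-downFrom p zero    = refl
count-downFrom p (suc n) = cong (𝟙 (p n) +_) (count-downFrom p n)

unique-map : ∀ {A B : Set} {f : A → B} {xs} → (∀ {x y} → x ∈ xs → y ∈ xs → f x ≡ f y → x ≡ y) → Unique xs → Unique (List.map f xs)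
unique-map inj [] = []
unique-map {f = f} inj (x∉ ∷ unique) =
  All.tabulate (λ y∈ eq → let (x , x∈ , y≡) = ∈-map⁻ f y∈ in All.lookup x∉ x∈ (inj (here refl) (there x∈) (trans eq y≡)))
  ∷ unique-map (λ x∈ y∈ → inj (there x∈) (there y∈)) unique

-- Degrees and cardinalities are defined as sizes of Boolean vectors. Listing the positions of true
-- reduces their comparison to duplicate-free lists.
support : ∀ {n} (p : Fin n → Bool) → ∃[ xs ] length xs ≡ ∣ tabulate p ∣ × Unique xs × (∀ {i} → i ∈ xs ⇔ p i ≡ true)
support {zero}  p = [] , refl , [] , λ {i} → ⊥-elim (Fin.¬Fin0 i)
support {suc n} p with support (p ∘ suc) | p zero in eq
... | xs , len , unique , members | true =
  zero ∷ List.map suc xs , cong suc (trans (List.length-map suc xs) len) ,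
  All.tabulate (λ i∈ → λ { refl → case ∈-map⁻ suc i∈ of λ { (_ , _ , ()) } }) ∷ Unique.map⁺ Fin.suc-injective unique ,
  λ { {zero}  → mk⇔ (λ _ → eq) (λ _ → here refl)
    ; {suc i} → mk⇔ (λ { (here ()) ; (there i∈) → case ∈-map⁻ suc i∈ of λ { (_ , j∈ , refl) → Equivalence.to members j∈ } })
                    (λ pi → there (∈-map⁺ suc (Equivalence.from members pi))) }
... | xs , len , unique , members | false =
  List.map suc xs , trans (List.length-map suc xs) len , Unique.map⁺ Fin.suc-injective unique ,
  λ { {zero}  → mk⇔ (λ i∈ → case ∈-map⁻ suc i∈ of λ { (_ , _ , ()) }) (λ pz → true≢false pz eq)
    ; {suc i} → mk⇔ (λ i∈ → case ∈-map⁻ suc i∈ of λ { (_ , j∈ , refl) → Equivalence.to members j∈ })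
                    (λ pi → ∈-map⁺ suc (Equivalence.from members pi)) }

supports : ∀ {m n} (p : Fin m → Fin n → Bool) →
           ∃[ xs ] length xs ≡ Vec.sum (tabulate λ i → ∣ tabulate (p i) ∣) × Unique xs
           × (∀ {i j} → (i , j) ∈ xs ⇔ p i j ≡ true)
supports {zero}  p = [] , refl , [] , λ {i} → ⊥-elim (Fin.¬Fin0 i)
supports {suc m} p with support (p zero) | supports (p ∘ suc)
... | xs , len , unique , members | ys , len′ , unique′ , members′ =
  List.map (zero ,_) xs ++ List.map shift ys ,
  trans (List.length-++ (List.map (zero ,_) xs)) (cong₂ _+_ (trans (List.length-map _ xs) len) (trans (List.length-map _ ys) len′)) ,
  Unique.++⁺ (Unique.map⁺ (λ { refl → refl }) unique) (Unique.map⁺ (λ { refl → refl }) unique′)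
    (λ { (x∈ , y∈) → case ∈-map⁻ _ x∈ , ∈-map⁻ shift y∈ of λ { ((_ , _ , refl) , (_ , _ , ())) } }) ,
  λ {i} {j} → mk⇔ (to i j) (from i j)
  where
  shift : ∀ {m n} → Fin m × Fin n → Fin (suc m) × Fin n
  shift (i , j) = suc i , j
  to : ∀ i j → (i , j) ∈ List.map (zero ,_) xs ++ List.map shift ys → p i j ≡ true
  to i j ij∈ with ∈-++⁻ (List.map (zero ,_) xs) ij∈
  ... | inj₁ x∈ = case ∈-map⁻ _ x∈ of λ { (_ , j∈ , refl) → Equivalence.to members j∈ }
  ... | inj₂ y∈ = case ∈-map⁻ shift y∈ of λ { (_ , y∈ys , refl) → Equivalence.to members′ y∈ys }
  from : ∀ i j → p i j ≡ true → (i , j) ∈ List.map (zero ,_) xs ++ List.map shift ys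
  from zero    j pij = ∈-++⁺ˡ (∈-map⁺ _ (Equivalence.from members pij))
  from (suc i) j pij = ∈-++⁺ʳ (List.map (zero ,_) xs) (∈-map⁺ shift (Equivalence.from members′ pij))

degree-deleteEdges : ∀ {n} (G : FinGraph n) (S : EdgeSet G) v ys → Unique ys → (∀ {u} → u ∈ ys ⇔ SimpleGraph.Adj G v u) →
                     degree (deleteEdges G S) v ≡ count (λ u → not (EdgeSet.mem S v u)) ys
degree-deleteEdges G S v ys unique neighbours with support (SimpleGraph.adj (deleteEdges G S) v)
... | xs , len , unique-xs , members = trans (sym len) (trans
  (≤-antisym (unique-⊆⇒length≤ unique-xs to) (unique-⊆⇒length≤ (unique-select survives unique) from))
  (length-select survives ys))
  where
  survives = λ u → not (EdgeSet.mem S v u)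
  to : ∀ {u} → u ∈ xs → u ∈ select survives ys
  to u∈ with ∧-true⁻ (Equivalence.to members u∈)
  ... | adjacent , kept = ∈-select⁺ survives (Equivalence.from neighbours adjacent) kept
  from : ∀ {u} → u ∈ select survives ys → u ∈ xs
  from u∈ with ∈-select⁻ survives u∈
  ... | u∈ys , kept = Equivalence.from members (∧-true (Equivalence.to neighbours u∈ys) kept)

-- Exhaustive search, and the existence of the minima

Searchable : Set → Set₁
Searchable A = ∀ {P : A → Set} → (∀ x → Dec (P x)) → Dec (∃ P)

search-Bool : Searchable Bool
search-Bool P? with P? true | P? false
... | yes p | _     = yes (true , p)
... | no _  | yes p = yes (false , p)
... | no ¬t | no ¬f = no λ { (true , p) → ¬t p ; (false , p) → ¬f p }

search-Maybe : ∀ {A} → Searchable A → Searchable (Maybe A)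
search-Maybe search P? with P? nothing | search (P? ∘ just)
... | yes p | _           = yes (nothing , p)
... | no _  | yes (x , p) = yes (just x , p)
... | no ¬n | no ¬j       = no λ { (nothing , p) → ¬n p ; (just x , p) → ¬j (x , p) }

extend : ∀ {A : Set} {n} → A → (Fin n → A) → Fin (suc n) → A
extend a f zero    = a
extend a f (suc i) = f i

absent : ∀ {A : Set} → Fin 0 → A
absent ()

-- Functions are searched value by value. Without extensionality the function rebuilt from its
-- values is only pointwise equal to the given one, hence the assumption that `P` respects pointwise
-- equality.
search-function : ∀ {A} → Searchable A → ∀ n {P : (Fin n → A) → Set} →
                  (∀ {f g} → f ≗ g → P f → P g) → (∀ f → Dec (P f)) → Dec (∃ P)
search-function search zero    resp P? = map′ (absent ,_) (λ { (f , p) → resp {f} {absent} (λ ()) p }) (P? absent)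
search-function search (suc n) resp P? = map′
  (λ { (a , f , p) → extend a f , p })
  (λ { (f , p) → f zero , f ∘ suc , resp (λ { zero → refl ; (suc i) → refl }) p })
  (search λ a → search-function search n (λ f≗g → resp λ { zero → refl ; (suc i) → f≗g i }) (P? ∘ extend a))

-- `Iₑ` and both graph parameters are relations with a minimum. Constructively, a witness yields the
-- minimum only for a decidable property; this is the purpose of the exhaustive searches for
-- irregulators, feedback vertex sets and elimination forests.
minimum : ∀ {P : ℕ → Set} → (∀ m → Dec (P m)) → ∀ {n} → P n → ∃[ m ] IsMinimum P m × m ≤ n
minimum {P} P? {n} p = [ id , (λ none → contradiction p (none n ≤-refl)) ]′ (upTo-bound n)
  where
  upTo-bound : ∀ n → (∃[ m ] IsMinimum P m × m ≤ n) ⊎ (∀ m → m ≤ n → ¬ P m)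
  upTo-bound zero with P? 0
  ... | yes p = inj₁ (0 , (p , λ _ _ → z≤n) , z≤n)
  ... | no ¬p = inj₂ λ { .0 z≤n → ¬p }
  upTo-bound (suc n) with upTo-bound n | P? (suc n)
  ... | inj₁ (m , min , m≤n) | _     = inj₁ (m , min , m≤n⇒m≤1+n m≤n)
  ... | inj₂ none            | yes p = inj₁ (suc n , (p , λ m pm → ≰⇒> λ m≤n → none m m≤n pm) , ≤-refl)
  ... | inj₂ none            | no ¬p = inj₂ λ m m≤ pm → [ (λ m<suc → none m (s≤s⁻¹ m<suc) pm) , (λ { refl → ¬p pm }) ]′ (m≤n⇒m<n∨m≡n m≤)

module _ {n} (G : FinGraph n) where
  private
    module G = SimpleGraph G

    degreeAfter : (Fin n → Fin n → Bool) → Fin n → ℕ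
    degreeAfter S v = ∣ tabulate (λ u → G.adj v u ∧ not (S v u)) ∣

    sizeOf : (Fin n → Fin n → Bool) → ℕ
    sizeOf S = Vec.sum (tabulate λ u → ∣ tabulate (λ v → does (u Fin.<? v) ∧ S u v) ∣)

    Good : ℕ → (Fin n → Fin n → Bool) → Set
    Good m S = (∀ u v → S u v ≡ S v u) × (∀ u v → S u v ≡ true → G.Adj u v)
             × (∀ u v → G.adj u v ∧ not (S u v) ≡ true → degreeAfter S u ≢ degreeAfter S v) × sizeOf S ≡ m

    good? : ∀ m S → Dec (Good m S)
    good? m S = (Fin.all? λ u → Fin.all? λ v → S u v Bool.≟ S v u)
      ×-dec (Fin.all? λ u → Fin.all? λ v → (S u v Bool.≟ true) →-dec (G.adj u v Bool.≟ true))
      ×-dec (Fin.all? λ u → Fin.all? λ v → ((G.adj u v ∧ not (S u v)) Bool.≟ true) →-dec ¬? (degreeAfter S u ≟ degreeAfter S v))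
      ×-dec (sizeOf S ≟ m)

    degreeAfter-cong : ∀ {S S′} → (∀ u v → S u v ≡ S′ u v) → ∀ v → degreeAfter S v ≡ degreeAfter S′ v
    degreeAfter-cong eq v = cong ∣_∣ (Vec.tabulate-cong λ u → cong (λ b → G.adj v u ∧ not b) (eq v u))

    good-cong : ∀ {m S S′} → (∀ u v → S u v ≡ S′ u v) → Good m S → Good m S′
    good-cong eq (sym-S , ⊆-S , irr-S , size-S) =
      (λ u v → trans (sym (eq u v)) (trans (sym-S u v) (eq v u))) ,
      (λ u v s → ⊆-S u v (trans (eq u v) s)) ,
      (λ u v s d → irr-S u v (trans (cong (λ b → G.adj u v ∧ not b) (eq u v)) s)
        (trans (degreeAfter-cong eq u) (trans d (sym (degreeAfter-cong eq v))))) ,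
      trans (cong Vec.sum (Vec.tabulate-cong λ u → cong ∣_∣ (Vec.tabulate-cong λ v → cong (does (u Fin.<? v) ∧_) (sym (eq u v))))) size-S

    search-matrix : ∀ m (rows : ℕ) {P : (Fin rows → Fin m → Bool) → Set} →
                    (∀ {f g} → (∀ i j → f i j ≡ g i j) → P f → P g) → (∀ f → Dec (P f)) → Dec (∃ P)
    search-matrix m zero    resp P? = map′ (absent ,_) (λ { (f , p) → resp {f} {absent} (λ ()) p }) (P? absent)
    search-matrix m (suc rows) {P} resp P? = map′
      (λ { (a , f , p) → extend a f , p })
      (λ { (f , p) → f zero , f ∘ suc , resp (λ { zero j → refl ; (suc i) j → refl }) p })
      (search-function search-Bool m {λ a → ∃ λ f → P (extend a f)}
        (λ { a≗ (f , p) → f , resp (λ { zero j → a≗ j ; (suc i) j → refl }) p })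
        (λ a → search-matrix m rows (λ f≗g → resp λ { zero j → refl ; (suc i) j → f≗g i j }) (P? ∘ extend a)))

  irregulator-of-size? : ∀ m → Dec (Σ (EdgeSet G) λ S → IsEdgeIrregulator G S × cardinality S ≡ m)
  irregulator-of-size? m = map′
    (λ { (S , sym-S , ⊆-S , irr-S , size-S) → record { mem = S ; mem-symmetric = sym-S ; mem⇒Adj = ⊆-S } , irr-S , size-S })
    (λ { (S , irr-S , size-S) → EdgeSet.mem S , EdgeSet.mem-symmetric S , EdgeSet.mem⇒Adj S , irr-S , size-S })
    (search-matrix n n good-cong (good? m))

  Iₑ-exists : ∀ {S : EdgeSet G} → IsEdgeIrregulator G S → ∃[ m ] Iₑ G m × m ≤ cardinality S
  Iₑ-exists {S} irregular = minimum irregulator-of-size? (S , irregular , refl)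

remaining-≡ : ∀ {n} {X : Subset n} {u v : Σ (Fin n) λ v → T (not (lookup X v))} → proj₁ u ≡ proj₁ v → u ≡ v
remaining-≡ {u = u , r} {.u , s} refl = cong (u ,_) (Bool.T-irrelevant r s)

module _ {n} (G : FinGraph n) (X : Subset n) where
  private
    module G = SimpleGraph G

    Remaining : Fin n → Set
    Remaining v = T (not (lookup X v))

    CycleOf : ∀ e → (Fin (3 + e) → Fin n) → Set
    CycleOf e f = (∀ i → Remaining (f i)) × (∀ i j → f i ≡ f j → i ≡ j)
                × (∀ i → G.Adj (f (inject₁ i)) (f (suc i))) × G.Adj (f (fromℕ (2 + e))) (f zero)

    cycleOf? : ∀ e f → Dec (CycleOf e f)
    cycleOf? e f = (Fin.all? λ i → Bool.T? (not (lookup X (f i))))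
      ×-dec (Fin.all? λ i → Fin.all? λ j → (f i Fin.≟ f j) →-dec (i Fin.≟ j))
      ×-dec (Fin.all? λ i → G.adj (f (inject₁ i)) (f (suc i)) Bool.≟ true)
      ×-dec (G.adj (f (fromℕ (2 + e))) (f zero) Bool.≟ true)

    cycleOf-cong : ∀ {e f g} → f ≗ g → CycleOf e f → CycleOf e g
    cycleOf-cong eq (rem , inj , con , clo) =
      (λ i → subst Remaining (eq i) (rem i)) ,
      (λ i j gi≡gj → inj i j (trans (eq i) (trans gi≡gj (sym (eq j))))) ,
      (λ i → subst₂ G.Adj (eq (inject₁ i)) (eq (suc i)) (con i)) ,
      subst₂ G.Adj (eq _) (eq zero) clo

  cycle? : Dec (Cycle (deleteVertices G X))
  cycle? = map′
    (λ { (e , f , rem , inj , con , clo) → record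
         { excess      = toℕ e
         ; vertex      = λ i → f i , rem i
         ; distinct    = λ eq → inj _ _ (cong proj₁ eq)
         ; consecutive = con
         ; closing     = clo
         } })
    (λ C → let open Cycle C
               injective : ∀ {i j} → proj₁ (vertex i) ≡ proj₁ (vertex j) → i ≡ j
               injective eq = distinct (remaining-≡ {X = X} eq)
               -- A cycle has `3 + excess` distinct vertices among `n`, so only finitely many
               -- lengths have to be searched.
               e<n = ≤-trans (m≤n+m (suc excess) 2) (Fin.injective⇒≤ injective)
           in fromℕ< e<n , subst (λ e → ∃ (CycleOf e)) (sym (Fin.toℕ-fromℕ< e<n))
                (proj₁ ∘ vertex , proj₂ ∘ vertex , (λ _ _ → injective) , consecutive , closing))
    (Fin.any? λ e → search-function Fin.any? (3 + toℕ e) cycleOf-cong (cycleOf? (toℕ e)))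

module _ {n} (G : FinGraph n) where

  feedback-set-of-size? : ∀ m → Dec (Σ (Subset n) λ X → IsForest (deleteVertices G X) × ∣ X ∣ ≡ m)
  feedback-set-of-size? m = Subset.anySubset? λ X → ¬? (cycle? G X) ×-dec (∣ X ∣ ≟ m)

  FeedbackVertexSetNumber-exists : ∀ {X} → IsForest (deleteVertices G X) → ∃[ m ] FeedbackVertexSetNumber G m × m ≤ ∣ X ∣
  FeedbackVertexSetNumber-exists {X} forest = minimum feedback-set-of-size? (X , forest , refl)

module _ {V : Set} where
  open RootedForest

  ancestor? : (∀ (u v : V) → Dec (u ≡ v)) → ∀ F u v → Dec (Ancestor F u v)
  -- The level of `v` is enough fuel, since levels fall by one from a vertex to its parent.
  ancestor? _≟ᵥ_ F u v = go (level F v) v ≤-refl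
    where
    go : ∀ fuel v → level F v ≤ fuel → Dec (Ancestor F u v)
    go fuel v le with parent F v in eq
    go fuel v le | nothing = no λ { (is-parent eq′) → case trans (sym eq) eq′ of λ () ; (further eq′ _) → case trans (sym eq) eq′ of λ () }
    go zero v le | just w = contradiction (subst (_≤ 0) (level-child F v w eq) le) λ ()
    go (suc fuel) v le | just w with w ≟ᵥ u | go fuel w (s≤s⁻¹ (subst (_≤ suc fuel) (level-child F v w eq) le))
    ... | yes refl | _     = yes (is-parent eq)
    ... | no _     | yes a = yes (further eq a)
    ... | no w≢u   | no ¬a = no λ
      { (is-parent eq′) → w≢u (Maybe.just-injective (trans (sym eq) eq′))
      ; (further eq′ a) → ¬a (subst (Ancestor F u) (Maybe.just-injective (trans (sym eq′) eq)) a) }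

  ancestor-cong : ∀ {F F′ : RootedForest V} → (∀ v → parent F v ≡ parent F′ v) → ∀ {u v} → Ancestor F u v → Ancestor F′ u v
  ancestor-cong eq (is-parent p) = is-parent (trans (sym (eq _)) p)
  ancestor-cong eq (further p a) = further (trans (sym (eq _)) p) (ancestor-cong eq a)

level≤height : ∀ {n} (F : RootedForest (Fin n)) v → RootedForest.level F v ≤ height F
level≤height F v = go (RootedForest.level F) v
  where
  go : ∀ {n} (g : Fin n → ℕ) v → g v ≤ maximum (tabulate g)
  go g zero    = m≤m⊔n _ _
  go g (suc v) = ≤-trans (go (g ∘ suc) v) (m≤n⊔m (g zero) _)

height≤ : ∀ {n} (F : RootedForest (Fin n)) b → (∀ v → RootedForest.level F v ≤ b) → height F ≤ b
height≤ F b = go (RootedForest.level F)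
  where
  go : ∀ {n} (g : Fin n → ℕ) → (∀ v → g v ≤ b) → maximum (tabulate g) ≤ b
  go {zero}  g le = z≤n
  go {suc n} g le = ⊔-lub (le zero) (go (g ∘ suc) (le ∘ suc))

module _ {n} (G : FinGraph n) where
  private
    module G = SimpleGraph G

    IsLevel : (Fin n → Maybe (Fin n)) → (Fin n → ℕ) → Set
    IsLevel par lev = (∀ v → par v ≡ nothing → lev v ≡ 1) × (∀ v u → par v ≡ just u → lev v ≡ suc (lev u))

    forest : ∀ par lev → IsLevel par lev → RootedForest (Fin n)
    forest par lev (root , child) = record { parent = par ; level = lev ; level-root = root ; level-child = child }

    Elimination : ℕ → (Fin n → Maybe (Fin n)) → (Fin n → ℕ) → Set
    Elimination m par lev = Σ (IsLevel par lev) λ l →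
      (∀ u v → G.Adj u v → Ancestor (forest par lev l) u v ⊎ Ancestor (forest par lev l) v u) × height (forest par lev l) ≡ m

    elimination? : ∀ m par lev → Dec (Elimination m par lev)
    elimination? m par lev with
      (Fin.all? λ v → Maybe.≡-dec Fin._≟_ (par v) nothing →-dec (lev v ≟ 1))
      ×-dec (Fin.all? λ v → Fin.all? λ u → Maybe.≡-dec Fin._≟_ (par v) (just u) →-dec (lev v ≟ suc (lev u)))
    ... | no ¬l = no (¬l ∘ proj₁)
    ... | yes l = map′ (l ,_) (λ { (l′ , edges , h) → (λ u v a → [ inj₁ ∘ ancestor-cong (λ _ → refl) , inj₂ ∘ ancestor-cong (λ _ → refl) ]′ (edges u v a)) , h })
      ((Fin.all? λ u → Fin.all? λ v → (G.adj u v Bool.≟ true) →-dec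
          (ancestor? Fin._≟_ (forest par lev l) u v ⊎-dec ancestor? Fin._≟_ (forest par lev l) v u))
        ×-dec (height (forest par lev l) ≟ m))

    elimination-cong : ∀ {m par par′ lev lev′} → par ≗ par′ → lev ≗ lev′ → Elimination m par lev → Elimination m par′ lev′
    elimination-cong p≗ l≗ ((root , child) , edges , h) =
      ((λ v eq → trans (sym (l≗ v)) (root v (trans (p≗ v) eq))) ,
       (λ v u eq → trans (sym (l≗ v)) (trans (child v u (trans (p≗ v) eq)) (cong suc (l≗ u))))) ,
      (λ u v a → [ inj₁ ∘ ancestor-cong p≗ , inj₂ ∘ ancestor-cong p≗ ]′ (edges u v a)) ,
      trans (cong maximum (Vec.tabulate-cong (sym ∘ l≗))) h

  elimination-of-height? : ∀ m → Dec (Σ (RootedForest (Fin n)) λ F → (∀ u v → G.Adj u v → Ancestor F u v ⊎ Ancestor F v u) × height F ≡ m)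
  elimination-of-height? m = map′
    (λ { (par , lev , l , edges , h) → forest par (toℕ ∘ lev) l , edges , h })
    (λ { (F , edges , h) →
         let open RootedForest F
             bounded : ∀ v → level v < suc m
             bounded v = s≤s (subst (level v ≤_) h (level≤height F v))
         in parent , (λ v → fromℕ< (bounded v)) ,
            elimination-cong (λ _ → refl) (λ v → sym (Fin.toℕ-fromℕ< (bounded v))) ((level-root , level-child) ,
              (λ u v a → [ inj₁ ∘ ancestor-cong (λ _ → refl) , inj₂ ∘ ancestor-cong (λ _ → refl) ]′ (edges u v a)) , h) })
    -- In a forest of height `m` no level exceeds `m`, which makes the search over levels finite.
    (search-function (search-Maybe Fin.any?) n {λ par → ∃ λ (lev : Fin n → Fin (suc m)) → Elimination m par (toℕ ∘ lev)}
      (λ p≗ (lev , e) → lev , elimination-cong p≗ (λ _ → refl) e)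
      (λ par → search-function Fin.any? n (λ l≗ → elimination-cong (λ _ → refl) (cong toℕ ∘ l≗)) (λ lev → elimination? m par (toℕ ∘ lev))))

  Treedepth-exists : ∀ (F : RootedForest (Fin n)) → (∀ u v → G.Adj u v → Ancestor F u v ⊎ Ancestor F v u) → ∃[ m ] Treedepth G m × m ≤ height F
  Treedepth-exists F edges = minimum elimination-of-height? (F , edges , refl)

-- Acyclicity from a rank function

argmax : ∀ {n} (g : Fin (suc n) → ℕ) → ∃ λ i → ∀ j → g j ≤ g i
argmax {zero}  g = zero , λ { zero → ≤-refl }
argmax {suc n} g with argmax (g ∘ suc)
... | i , max with g zero ≤? g (suc i)
... | yes le = suc i , λ { zero → le ; (suc j) → max j }
... | no ¬le = zero , λ { zero → ≤-refl ; (suc j) → ≤-trans (max j) (<⇒≤ (≰⇒> ¬le)) }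

-- A cycle has a vertex of maximal rank, and both its neighbours on the
-- cycle have smaller rank.

forest-by-rank : ∀ {V} (G : SimpleGraph V) (r : V → ℕ) → (∀ {x y} → SimpleGraph.Adj G x y → r x ≢ r y) →
                 (∀ {x y z} → SimpleGraph.Adj G x y → SimpleGraph.Adj G x z → r y < r x → r z < r x → y ≡ z) → IsForest G
forest-by-rank G r ranked unique-below C with argmax (r ∘ Cycle.vertex C)
... | i , max = let (j , l , j≢l , ij , il) = around i in
  j≢l (distinct (unique-below ij il (≤∧≢⇒< (max j) (ranked ij ∘ sym)) (≤∧≢⇒< (max l) (ranked il ∘ sym))))
  where
  open Cycle C
  open SimpleGraph G
  Adj-sym : ∀ {x y} → Adj x y → Adj y x
  Adj-sym {x} {y} a = trans (symmetric y x) a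
  around : ∀ i → ∃₂ λ j l → j ≢ l × Adj (vertex i) (vertex j) × Adj (vertex i) (vertex l)
  around zero = suc zero , fromℕ _ , (λ ()) , consecutive zero , Adj-sym closing
  around (suc i) with Top.view i
  ... | Top.‵fromℕ = inject₁ (fromℕ _) , zero , (λ { () }) , Adj-sym (consecutive (fromℕ _)) , closing
  ... | Top.‵inject₁ i′ = inject₁ (inject₁ i′) , suc (suc i′) ,
    (λ eq → m≢1+n+m (toℕ i′) {1} (trans (sym (trans (Fin.toℕ-inject₁ (inject₁ i′)) (Fin.toℕ-inject₁ i′))) (cong toℕ eq))) ,
    Adj-sym (consecutive (inject₁ i′)) , consecutive (suc i′)

-- The hub graph.  Every switch is joined to two hubs, and deleting one of
-- these two edges is the only cheap way to repair the conflict between the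
-- switch and its joint, both of degree 3; deleting another edge at the
-- joint moves the conflict to one of its arms.  The guards of a hub forbid
-- certain degrees of the hub.

data Kind : Set where
  hub guard pendant switch joint arm₁ arm₂ hand₁ hand₂ : Kind

Vertex : Set
Vertex = Kind × ℕ

tag : Kind → ℕ
tag hub     = 0
tag guard   = 1
tag pendant = 2
tag switch  = 3
tag joint   = 4
tag arm₁    = 5
tag arm₂    = 6
tag hand₁   = 7
tag hand₂   = 8

kindOf : ℕ → Kind
kindOf 0 = hub
kindOf 1 = guard
kindOf 2 = pendant
kindOf 3 = switch
kindOf 4 = joint
kindOf 5 = arm₁
kindOf 6 = arm₂
kindOf 7 = hand₁
kindOf _ = hand₂

-- The kind is the residue modulo 9 and the index the quotient, so terms can decode a vertex by
-- `rem` and `quot`.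
code : Vertex → ℕ
code (κ , m) = 9 * m + tag κ

decode : ℕ → Vertex
decode a = kindOf (rem a 9) , quot a 9

tag<9 : ∀ κ → tag κ < 9
tag<9 hub     = <ᵇ⇒< 0 9 _
tag<9 guard   = <ᵇ⇒< 1 9 _
tag<9 pendant = <ᵇ⇒< 2 9 _
tag<9 switch  = <ᵇ⇒< 3 9 _
tag<9 joint   = <ᵇ⇒< 4 9 _
tag<9 arm₁    = <ᵇ⇒< 5 9 _
tag<9 arm₂    = <ᵇ⇒< 6 9 _
tag<9 hand₁   = <ᵇ⇒< 7 9 _
tag<9 hand₂   = <ᵇ⇒< 8 9 _

kindOf-tag : ∀ κ → kindOf (tag κ) ≡ κ
kindOf-tag hub     = refl
kindOf-tag guard   = refl
kindOf-tag pendant = refl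
kindOf-tag switch  = refl
kindOf-tag joint   = refl
kindOf-tag arm₁    = refl
kindOf-tag arm₂    = refl
kindOf-tag hand₁   = refl
kindOf-tag hand₂   = refl

tag-kindOf : ∀ {τ} → τ < 9 → tag (kindOf τ) ≡ τ
tag-kindOf {0} _ = refl
tag-kindOf {1} _ = refl
tag-kindOf {2} _ = refl
tag-kindOf {3} _ = refl
tag-kindOf {4} _ = refl
tag-kindOf {5} _ = refl
tag-kindOf {6} _ = refl
tag-kindOf {7} _ = refl
tag-kindOf {8} _ = refl
tag-kindOf {suc (suc (suc (suc (suc (suc (suc (suc (suc τ))))))))} (s≤s (s≤s (s≤s (s≤s (s≤s (s≤s (s≤s (s≤s (s≤s ())))))))))

decode-code : ∀ x → decode (code x) ≡ x
decode-code (κ , m) = cong₂ _,_ (trans (cong kindOf (rem-unique 9 m (tag<9 κ))) (kindOf-tag κ)) (quot-unique 9 m (tag<9 κ))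

code-decode : ∀ a → code (decode a) ≡ a
code-decode a = trans (cong (9 * quot a 9 +_) (tag-kindOf (rem< a {9} z<s))) (sym (quot-rem a {9} z<s))

code-injective : ∀ {x y} → code x ≡ code y → x ≡ y
code-injective eq = trans (sym (decode-code _)) (trans (cong decode eq) (decode-code _))

_≟ᵥ_ : (x y : Vertex) → Dec (x ≡ y)
x ≟ᵥ y = map′ code-injective (cong code) (code x ≟ code y)

-- Guard h * y + v is the y-th guard of hub v.  It has the degree that hub
-- v has when it keeps y of its switches, unless that is allowed.

module HubEdges (h k : ℕ) (e₁ e₂ : ℕ → ℕ) (allowed : ℕ → ℕ → Bool) where

  guards pendants order : ℕ
  -- A hub keeps between 0 and `k` switches and gets one guard for each of these values. A guard for
  -- `y` has at most `k + y` pendants, hence fewer than `suc (k + k)`.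
  guards   = suc k * h
  pendants = suc (k + k) * guards
  -- All kinds get the index range of the pendants, the largest one. Numbers that denote no vertex
  -- of a gadget become isolated vertices, which violate nothing.
  order    = pendants * 9

  forbidding : ℕ → Bool
  forbidding c = not (allowed (rem c h) (quot c h))

  present : ℕ → Bool
  -- A hub has `suc k` guards besides its switches, so its degree is `suc k + y` if it keeps `y` of
  -- them. The guard for `y` reaches this degree with `k + y` pendants and the edge to the hub.
  present m = (quot m guards <ᵇ k + quot (rem m guards) h) ∧ forbidding (rem m guards)

  link : Kind → ℕ → ℕ → Bool
  link hub     m b = false
  link guard   m b = (m <ᵇ guards) ∧ (code (hub , rem m h) ≡ᵇ b)
  link pendant m b = ((m <ᵇ pendants) ∧ present m) ∧ (code (guard , rem m guards) ≡ᵇ b)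
  link switch  m b = (m <ᵇ k) ∧ ((code (hub , e₁ m) ≡ᵇ b) ∨ (code (hub , e₂ m) ≡ᵇ b))
  link joint   m b = (m <ᵇ k) ∧ (code (switch , m) ≡ᵇ b)
  link arm₁    m b = (m <ᵇ k) ∧ (code (joint , m) ≡ᵇ b)
  link arm₂    m b = (m <ᵇ k) ∧ (code (joint , m) ≡ᵇ b)
  link hand₁   m b = (m <ᵇ k) ∧ (code (arm₁ , m) ≡ᵇ b)
  link hand₂   m b = (m <ᵇ k) ∧ (code (arm₂ , m) ≡ᵇ b)

  edge : ℕ → ℕ → Bool
  edge a b = link (kindOf (rem a 9)) (quot a 9) b ∨ link (kindOf (rem b 9)) (quot b 9) a

  -- The number of switches that hub v keeps if σ tells which switches are
  -- cut off from their first hub.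

  kept : (ℕ → Bool) → ℕ → ℕ
  kept σ v = ∑ k λ u → 𝟙 (((e₁ u ≡ᵇ v) ∧ not (σ u)) ∨ ((e₂ u ≡ᵇ v) ∧ σ u))

  -- The edges, directed towards lower `rank`, in a form that allows case analysis where `link` only
  -- computes a Boolean.
  data Up : Vertex → Vertex → Set where
    guard↑   : ∀ {m} → m < guards → Up (guard , m) (hub , rem m h)
    pendant↑ : ∀ {m} → m < pendants → present m ≡ true → Up (pendant , m) (guard , rem m guards)
    first↑   : ∀ {u} → u < k → Up (switch , u) (hub , e₁ u)
    second↑  : ∀ {u} → u < k → Up (switch , u) (hub , e₂ u)
    joint↑   : ∀ {u} → u < k → Up (joint , u) (switch , u)
    arm₁↑    : ∀ {u} → u < k → Up (arm₁ , u) (joint , u)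
    arm₂↑    : ∀ {u} → u < k → Up (arm₂ , u) (joint , u)
    hand₁↑   : ∀ {u} → u < k → Up (hand₁ , u) (arm₁ , u)
    hand₂↑   : ∀ {u} → u < k → Up (hand₂ , u) (arm₂ , u)

  link-complete : ∀ {κ m y} → Up (κ , m) y → link κ m (code y) ≡ true
  link-complete {m = m} (guard↑ m<)     = ∧-true (<ᵇ-true m<) (≡ᵇ-true {code (hub , rem m h)} refl)
  link-complete {m = m} (pendant↑ m< p) = ∧-true (∧-true (<ᵇ-true m<) p) (≡ᵇ-true {code (guard , rem m guards)} refl)
  link-complete {m = u} (first↑ u<)  = ∧-true (<ᵇ-true u<) (cong (_∨ (code (hub , e₂ u) ≡ᵇ code (hub , e₁ u))) (≡ᵇ-true {code (hub , e₁ u)} refl))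
  link-complete {m = u} (second↑ u<) = ∧-true (<ᵇ-true u<) (∨-trueʳ (code (hub , e₁ u) ≡ᵇ code (hub , e₂ u)) (≡ᵇ-true {code (hub , e₂ u)} refl))
  link-complete {m = u} (joint↑ u<) = ∧-true (<ᵇ-true u<) (≡ᵇ-true {code (switch , u)} refl)
  link-complete {m = u} (arm₁↑ u<)  = ∧-true (<ᵇ-true u<) (≡ᵇ-true {code (joint , u)} refl)
  link-complete {m = u} (arm₂↑ u<)  = ∧-true (<ᵇ-true u<) (≡ᵇ-true {code (joint , u)} refl)
  link-complete {m = u} (hand₁↑ u<) = ∧-true (<ᵇ-true u<) (≡ᵇ-true {code (arm₁ , u)} refl)
  link-complete {m = u} (hand₂↑ u<) = ∧-true (<ᵇ-true u<) (≡ᵇ-true {code (arm₂ , u)} refl)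

  private
    target : ∀ {κ m} x y → Up (κ , m) x → (code x ≡ᵇ code y) ≡ true → Up (κ , m) y
    target x y up eq = subst (Up _) (code-injective (≡ᵇ-true⁻ (code x) (code y) eq)) up

  link-sound : ∀ κ m y → link κ m (code y) ≡ true → Up (κ , m) y
  link-sound guard m y eq with ∧-true⁻ {m <ᵇ guards} eq
  ... | m< , eq′ = target (hub , rem m h) y (guard↑ (<ᵇ-true⁻ m guards m<)) eq′
  link-sound pendant m y eq with ∧-true⁻ {(m <ᵇ pendants) ∧ present m} eq
  ... | m<p , eq′ with ∧-true⁻ {m <ᵇ pendants} m<p
  ... | m< , p = target (guard , rem m guards) y (pendant↑ (<ᵇ-true⁻ m pendants m<) p) eq′
  link-sound switch m y eq with ∧-true⁻ {m <ᵇ k} eq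
  ... | m< , eq′ with ∨-true⁻ {code (hub , e₁ m) ≡ᵇ code y} eq′
  ... | inj₁ eq₁ = target (hub , e₁ m) y (first↑ (<ᵇ-true⁻ m k m<)) eq₁
  ... | inj₂ eq₂ = target (hub , e₂ m) y (second↑ (<ᵇ-true⁻ m k m<)) eq₂
  link-sound joint m y eq with ∧-true⁻ {m <ᵇ k} eq
  ... | m< , eq′ = target (switch , m) y (joint↑ (<ᵇ-true⁻ m k m<)) eq′
  link-sound arm₁ m y eq with ∧-true⁻ {m <ᵇ k} eq
  ... | m< , eq′ = target (joint , m) y (arm₁↑ (<ᵇ-true⁻ m k m<)) eq′
  link-sound arm₂ m y eq with ∧-true⁻ {m <ᵇ k} eq
  ... | m< , eq′ = target (joint , m) y (arm₂↑ (<ᵇ-true⁻ m k m<)) eq′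
  link-sound hand₁ m y eq with ∧-true⁻ {m <ᵇ k} eq
  ... | m< , eq′ = target (arm₁ , m) y (hand₁↑ (<ᵇ-true⁻ m k m<)) eq′
  link-sound hand₂ m y eq with ∧-true⁻ {m <ᵇ k} eq
  ... | m< , eq′ = target (arm₂ , m) y (hand₂↑ (<ᵇ-true⁻ m k m<)) eq′

  rank : Kind → ℕ
  rank hub     = 0
  rank guard   = 1
  rank pendant = 2
  rank switch  = 1
  rank joint   = 2
  rank arm₁    = 3
  rank arm₂    = 3
  rank hand₁   = 4
  rank hand₂   = 4

  Up-rank : ∀ {x y} → Up x y → rank (proj₁ x) ≡ suc (rank (proj₁ y))
  Up-rank (guard↑ _)     = refl
  Up-rank (pendant↑ _ _) = refl
  Up-rank (first↑ _)     = refl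
  Up-rank (second↑ _)    = refl
  Up-rank (joint↑ _)     = refl
  Up-rank (arm₁↑ _)      = refl
  Up-rank (arm₂↑ _)      = refl
  Up-rank (hand₁↑ _)     = refl
  Up-rank (hand₂↑ _)     = refl

  Up-asym : ∀ {x y} → Up x y → ¬ Up y x
  Up-asym up up′ = m≢1+n+m _ {1} (trans (Up-rank up) (cong suc (Up-rank up′)))

  edge-sound : ∀ a b → edge a b ≡ true → Up (decode a) (decode b) ⊎ Up (decode b) (decode a)
  edge-sound a b eq with ∨-true⁻ {link (kindOf (rem a 9)) (quot a 9) b} eq
  ... | inj₁ eq₁ = inj₁ (link-sound (kindOf (rem a 9)) (quot a 9) (decode b) (subst (λ b → link (kindOf (rem a 9)) (quot a 9) b ≡ true) (sym (code-decode b)) eq₁))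
  ... | inj₂ eq₂ = inj₂ (link-sound (kindOf (rem b 9)) (quot b 9) (decode a) (subst (λ a → link (kindOf (rem b 9)) (quot b 9) a ≡ true) (sym (code-decode a)) eq₂))

  edge-complete : ∀ a b → Up (decode a) (decode b) ⊎ Up (decode b) (decode a) → edge a b ≡ true
  edge-complete a b (inj₁ up) = cong (_∨ link (kindOf (rem b 9)) (quot b 9) a) (subst (λ b → link (kindOf (rem a 9)) (quot a 9) b ≡ true) (code-decode b) (link-complete up))
  edge-complete a b (inj₂ up) = ∨-trueʳ (link (kindOf (rem a 9)) (quot a 9) b) (subst (λ a → link (kindOf (rem b 9)) (quot b 9) a ≡ true) (code-decode a) (link-complete up))

  edge-irreflexive : ∀ a → edge a a ≡ false
  edge-irreflexive a with edge a a in eq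
  ... | false = refl
  ... | true with edge-sound a a eq
  ... | inj₁ up = contradiction up (Up-asym up)
  ... | inj₂ up = contradiction up (Up-asym up)

  graph : FinGraph order
  graph = record
    { adj       = λ u v → edge (toℕ u) (toℕ v)
    ; symmetric = λ u v → Bool.∨-comm (link (kindOf (rem (toℕ u) 9)) (quot (toℕ u) 9) (toℕ v)) _
    ; loopless  = λ v → edge-irreflexive (toℕ v)
    }

-- Small irregulators of the hub graph, and its structural parameters

module HubGraph (h k : ℕ) (e₁ e₂ : ℕ → ℕ) (allowed : ℕ → ℕ → Bool) (2≤k : 2 ≤ k)
                (e₁<h : ∀ u → u < k → e₁ u < h) (e₂<h : ∀ u → u < k → e₂ u < h) (e₁≢e₂ : ∀ u → u < k → e₁ u ≢ e₂ u) where

  open HubEdges h k e₁ e₂ allowed public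

  0<h : 0 < h
  0<h = ≤-<-trans z≤n (e₁<h 0 (≤-trans z<s 2≤k))

  h≤guards : h ≤ guards
  h≤guards = m≤n*m h (suc k)

  0<guards : 0 < guards
  0<guards = ≤-trans 0<h h≤guards

  guards≤pendants : guards ≤ pendants
  guards≤pendants = m≤n*m guards (suc (k + k))

  k<pendants : k < pendants
  k<pendants = ≤-trans (s≤s (m≤m+n k k)) (m≤m*n (suc (k + k)) guards {{>-nonZero 0<guards}})

  InRange : Vertex → Set
  InRange (_ , m) = m < pendants

  code<order : ∀ {x} → InRange x → code x < order
  code<order {κ , m} m< = pair< {pendants} {9} m< (tag<9 κ)

  0<order : 0 < order
  0<order = ≤-<-trans z≤n (code<order {hub , 0} (≤-<-trans z≤n k<pendants))

  vertex : Vertex → Fin order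
  vertex x with code x <? order
  ... | yes c< = fromℕ< c<
  ... | no  _  = fromℕ< 0<order

  toℕ-vertex : ∀ {x} → InRange x → toℕ (vertex x) ≡ code x
  toℕ-vertex {x} x< with code x <? order
  ... | yes c< = Fin.toℕ-fromℕ< c<
  ... | no  c≮ = contradiction (code<order x<) c≮

  decode-vertex : ∀ {x} → InRange x → decode (toℕ (vertex x)) ≡ x
  decode-vertex {x} x< = trans (cong decode (toℕ-vertex x<)) (decode-code x)

  decoded : Fin order → Vertex
  decoded v = decode (toℕ v)

  decoded-InRange : ∀ v → InRange (decoded v)
  decoded-InRange v = quot< pendants 9 (Fin.toℕ<n v)

  vertex-decoded : ∀ v → vertex (decoded v) ≡ v
  vertex-decoded v = Fin.toℕ-injective (trans (toℕ-vertex (decoded-InRange v)) (code-decode (toℕ v)))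

  vertex-injective : ∀ {x y} → InRange x → InRange y → vertex x ≡ vertex y → x ≡ y
  vertex-injective x< y< eq = trans (sym (decode-vertex x<)) (trans (cong decoded eq) (decode-vertex y<))

  Up-InRange : ∀ {x y} → Up x y → InRange x × InRange y
  Up-InRange {guard , m} (guard↑ m<) = <-≤-trans m< guards≤pendants , <-≤-trans (rem< m 0<h) (≤-trans h≤guards guards≤pendants)
  Up-InRange {pendant , m} (pendant↑ m< _) = m< , <-≤-trans (rem< m 0<guards) guards≤pendants
  Up-InRange (first↑ u<)  = <-trans u< k<pendants , <-≤-trans (e₁<h _ u<) (≤-trans h≤guards guards≤pendants)
  Up-InRange (second↑ u<) = <-trans u< k<pendants , <-≤-trans (e₂<h _ u<) (≤-trans h≤guards guards≤pendants)
  Up-InRange (joint↑ u<)  = <-trans u< k<pendants , <-trans u< k<pendants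
  Up-InRange (arm₁↑ u<)   = <-trans u< k<pendants , <-trans u< k<pendants
  Up-InRange (arm₂↑ u<)   = <-trans u< k<pendants , <-trans u< k<pendants
  Up-InRange (hand₁↑ u<)  = <-trans u< k<pendants , <-trans u< k<pendants
  Up-InRange (hand₂↑ u<)  = <-trans u< k<pendants , <-trans u< k<pendants

  Joined : Vertex → Vertex → Set
  Joined x y = Up x y ⊎ Up y x

  Joined-InRange : ∀ {x y} → Joined x y → InRange x × InRange y
  Joined-InRange (inj₁ up) = Up-InRange up
  Joined-InRange (inj₂ up) = let (y< , x<) = Up-InRange up in x< , y<

  open SimpleGraph graph using (Adj)

  Adj⇒Joined : ∀ {u v} → Adj u v → Joined (decoded u) (decoded v)
  Adj⇒Joined {u} {v} = edge-sound (toℕ u) (toℕ v)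

  Joined⇒Adj : ∀ {x y} → Joined x y → Adj (vertex x) (vertex y)
  Joined⇒Adj {x} {y} joined = edge-complete _ _ (subst₂ Joined (sym (decode-vertex x<)) (sym (decode-vertex y<)) joined)
    where
    x< = proj₁ (Joined-InRange joined)
    y< = proj₂ (Joined-InRange joined)

  record Neighbours (x : Vertex) (ys : List Vertex) : Set where
    constructor neighbours
    field
      unique   : Unique ys
      sound    : ∀ {y} → y ∈ ys → Joined x y
      complete : ∀ {y} → Joined x y → y ∈ ys

  hub-neighbours : ∀ v → v < h → Neighbours (hub , v) (List.map (λ y → guard , h * y + v) (List.downFrom (suc k)) ++
                                  List.map (switch ,_) (select (λ u → (e₁ u ≡ᵇ v) ∨ (e₂ u ≡ᵇ v)) (List.downFrom k)))
  hub-neighbours v v<h = neighbours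
    (Unique.++⁺ (unique-map (λ _ _ eq → proj₁ (pair-injective h v<h v<h (cong proj₂ eq))) (Unique.downFrom⁺ (suc k)))
                (unique-map (λ { _ _ refl → refl }) (unique-select incident (Unique.downFrom⁺ k)))
                (λ { (x∈ , y∈) → case ∈-map⁻ _ x∈ , ∈-map⁻ _ y∈ of λ { ((_ , _ , refl) , (_ , _ , ())) } }))
    sound complete
    where
    incident = λ u → (e₁ u ≡ᵇ v) ∨ (e₂ u ≡ᵇ v)
    sound : ∀ {x} → x ∈ List.map (λ y → guard , h * y + v) (List.downFrom (suc k)) ++ List.map (switch ,_) (select incident (List.downFrom k)) → Joined (hub , v) x
    sound x∈ with ∈-++⁻ (List.map (λ y → guard , h * y + v) (List.downFrom (suc k))) x∈
    ... | inj₁ x∈₁ with ∈-map⁻ _ x∈₁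
    ... | y , y∈ , refl = inj₂ (subst (λ r → Up (guard , h * y + v) (hub , r)) (rem-unique h y v<h) (guard↑ (pair< (∈-downFrom⁻ y∈) v<h)))
    sound x∈ | inj₂ x∈₂ with ∈-map⁻ _ x∈₂
    ... | u , u∈ , refl with ∈-select⁻ incident u∈
    ... | u∈k , inc with ∨-true⁻ {e₁ u ≡ᵇ v} inc
    ... | inj₁ eq = inj₂ (subst (λ r → Up (switch , u) (hub , r)) (≡ᵇ-true⁻ (e₁ u) v eq) (first↑ (∈-downFrom⁻ u∈k)))
    ... | inj₂ eq = inj₂ (subst (λ r → Up (switch , u) (hub , r)) (≡ᵇ-true⁻ (e₂ u) v eq) (second↑ (∈-downFrom⁻ u∈k)))
    complete : ∀ {x} → Joined (hub , v) x → x ∈ List.map (λ y → guard , h * y + v) (List.downFrom (suc k)) ++ List.map (switch ,_) (select incident (List.downFrom k))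
    complete (inj₂ (guard↑ {m} m<)) = ∈-++⁺ˡ (subst (_∈ List.map (λ y → guard , h * y + rem m h) (List.downFrom (suc k)))
      (cong (guard ,_) (sym (quot-rem m 0<h))) (∈-map⁺ _ (∈-downFrom⁺ (quot< (suc k) h m<))))
    complete (inj₂ (first↑ {u} u<)) = ∈-++⁺ʳ (List.map (λ y → guard , h * y + v) (List.downFrom (suc k)))
      (∈-map⁺ _ (∈-select⁺ incident (∈-downFrom⁺ u<) (cong (_∨ (e₂ u ≡ᵇ v)) (≡ᵇ-true {e₁ u} refl))))
    complete (inj₂ (second↑ {u} u<)) = ∈-++⁺ʳ (List.map (λ y → guard , h * y + v) (List.downFrom (suc k)))
      (∈-map⁺ _ (∈-select⁺ incident (∈-downFrom⁺ u<) (∨-trueʳ (e₁ u ≡ᵇ v) (≡ᵇ-true {e₂ u} refl))))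

  guard-pendants : ℕ → List Vertex
  guard-pendants c = if forbidding c then List.map (λ l → pendant , guards * l + c) (List.downFrom (k + quot c h)) else []

  guard-neighbours : ∀ c → c < guards → Neighbours (guard , c) ((hub , rem c h) ∷ guard-pendants c)
  guard-neighbours c c< with forbidding c in eq
  ... | false = neighbours ([] ∷ []) (λ { (here refl) → inj₁ (guard↑ c<) }) complete
    where
    complete : ∀ {y} → Joined (guard , c) y → y ∈ (hub , rem c h) ∷ []
    complete (inj₁ (guard↑ _)) = here refl
    complete (inj₂ (pendant↑ {m} m< p)) = true≢false (proj₂ (∧-true⁻ {quot m guards <ᵇ k + quot (rem m guards) h} p)) eq
  ... | true = neighbours
    (All.tabulate (λ y∈ → λ { refl → case ∈-map⁻ _ y∈ of λ { (_ , _ , ()) } }) ∷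
      unique-map (λ _ _ eq → proj₁ (pair-injective guards c< c< (cong proj₂ eq))) (Unique.downFrom⁺ (k + quot c h)))
    (λ { (here refl) → inj₁ (guard↑ c<) ; (there y∈) → sound (∈-map⁻ _ y∈) }) complete
    where
    quot≤k : quot c h ≤ k
    quot≤k = s≤s⁻¹ (quot< (suc k) h c<)
    sound : ∀ {y} → (∃ λ l → l ∈ List.downFrom (k + quot c h) × y ≡ (pendant , guards * l + c)) → Joined (guard , c) y
    sound (l , l∈ , refl) = inj₂ (subst (λ r → Up (pendant , guards * l + c) (guard , r)) (rem-unique guards l c<)
      (pendant↑ (pair< (≤-trans (∈-downFrom⁻ l∈) (≤-trans (+-monoʳ-≤ k quot≤k) (n≤1+n (k + k)))) c<) is-present))
      where
      is-present : present (guards * l + c) ≡ true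
      is-present = subst₂ (λ q r → ((q <ᵇ k + quot r h) ∧ forbidding r) ≡ true) (sym (quot-unique guards l c<)) (sym (rem-unique guards l c<))
        (∧-true (<ᵇ-true (∈-downFrom⁻ l∈)) eq)
    complete : ∀ {y} → Joined (guard , c) y → y ∈ (hub , rem c h) ∷ List.map (λ l → pendant , guards * l + c) (List.downFrom (k + quot c h))
    complete (inj₁ (guard↑ _)) = here refl
    complete (inj₂ (pendant↑ {m} m< p)) = there (subst (_∈ List.map (λ l → pendant , guards * l + rem m guards) (List.downFrom (k + quot (rem m guards) h)))
      (cong (pendant ,_) (sym (quot-rem m 0<guards)))
      (∈-map⁺ _ (∈-downFrom⁺ (<ᵇ-true⁻ (quot m guards) _ (proj₁ (∧-true⁻ {quot m guards <ᵇ k + quot (rem m guards) h} p))))))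

  pendant-neighbours : ∀ m → m < pendants → present m ≡ true → Neighbours (pendant , m) ((guard , rem m guards) ∷ [])
  pendant-neighbours m m< p = neighbours ([] ∷ []) (λ { (here refl) → inj₁ (pendant↑ m< p) }) λ { (inj₁ (pendant↑ _ _)) → here refl }

  module _ {u} (u<k : u < k) where

    switch-neighbours : Neighbours (switch , u) ((hub , e₁ u) ∷ (hub , e₂ u) ∷ (joint , u) ∷ [])
    switch-neighbours = neighbours
      (((λ eq → e₁≢e₂ u u<k (cong proj₂ eq)) ∷ (λ ()) ∷ []) ∷ ((λ ()) ∷ []) ∷ [] ∷ [])
      (λ { (here refl) → inj₁ (first↑ u<k) ; (there (here refl)) → inj₁ (second↑ u<k) ; (there (there (here refl))) → inj₂ (joint↑ u<k) })
      (λ { (inj₁ (first↑ _)) → here refl ; (inj₁ (second↑ _)) → there (here refl) ; (inj₂ (joint↑ _)) → there (there (here refl)) })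

    joint-neighbours : Neighbours (joint , u) ((switch , u) ∷ (arm₁ , u) ∷ (arm₂ , u) ∷ [])
    joint-neighbours = neighbours
      (((λ ()) ∷ (λ ()) ∷ []) ∷ ((λ ()) ∷ []) ∷ [] ∷ [])
      (λ { (here refl) → inj₁ (joint↑ u<k) ; (there (here refl)) → inj₂ (arm₁↑ u<k) ; (there (there (here refl))) → inj₂ (arm₂↑ u<k) })
      (λ { (inj₁ (joint↑ _)) → here refl ; (inj₂ (arm₁↑ _)) → there (here refl) ; (inj₂ (arm₂↑ _)) → there (there (here refl)) })

    arm₁-neighbours : Neighbours (arm₁ , u) ((joint , u) ∷ (hand₁ , u) ∷ [])
    arm₁-neighbours = neighbours (((λ ()) ∷ []) ∷ [] ∷ [])
      (λ { (here refl) → inj₁ (arm₁↑ u<k) ; (there (here refl)) → inj₂ (hand₁↑ u<k) })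
      (λ { (inj₁ (arm₁↑ _)) → here refl ; (inj₂ (hand₁↑ _)) → there (here refl) })

    arm₂-neighbours : Neighbours (arm₂ , u) ((joint , u) ∷ (hand₂ , u) ∷ [])
    arm₂-neighbours = neighbours (((λ ()) ∷ []) ∷ [] ∷ [])
      (λ { (here refl) → inj₁ (arm₂↑ u<k) ; (there (here refl)) → inj₂ (hand₂↑ u<k) })
      (λ { (inj₁ (arm₂↑ _)) → here refl ; (inj₂ (hand₂↑ _)) → there (here refl) })

    hand₁-neighbours : Neighbours (hand₁ , u) ((arm₁ , u) ∷ [])
    hand₁-neighbours = neighbours ([] ∷ []) (λ { (here refl) → inj₁ (hand₁↑ u<k) }) (λ { (inj₁ (hand₁↑ _)) → here refl })

    hand₂-neighbours : Neighbours (hand₂ , u) ((arm₂ , u) ∷ [])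
    hand₂-neighbours = neighbours ([] ∷ []) (λ { (here refl) → inj₁ (hand₂↑ u<k) }) (λ { (inj₁ (hand₂↑ _)) → here refl })

  module Deletion (S : EdgeSet graph) where

    open EdgeSet S using (mem; mem-symmetric; mem⇒Adj)

    deleted : Vertex → Vertex → Bool
    deleted x y = mem (vertex x) (vertex y)

    deleted-sym : ∀ x y → deleted x y ≡ deleted y x
    deleted-sym x y = mem-symmetric (vertex x) (vertex y)

    survivors : Vertex → List Vertex → ℕ
    survivors x = count (λ y → not (deleted x y))

    degree-survivors : ∀ {x ys} → InRange x → Neighbours x ys → degree (deleteEdges graph S) (vertex x) ≡ survivors x ys
    degree-survivors {x} {ys} x< nbrs = trans
      (degree-deleteEdges graph S (vertex x) (List.map vertex ys)
        (unique-map (λ y∈ z∈ → vertex-injective (range y∈) (range z∈)) unique)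
        (mk⇔ (λ v∈ → case ∈-map⁻ vertex v∈ of λ { (y , y∈ , refl) → Joined⇒Adj (sound y∈) })
             (λ adj → subst (_∈ List.map vertex ys) (vertex-decoded _)
               (∈-map⁺ vertex (complete (subst (λ x → Joined x _) (decode-vertex x<) (Adj⇒Joined adj)))))))
      (count-map _ vertex ys)
      where
      open Neighbours nbrs
      range : ∀ {y} → y ∈ ys → InRange y
      range y∈ = proj₂ (Joined-InRange (sound y∈))

    surviving-edge : ∀ {x y} → Joined x y → deleted x y ≡ false →
                     SimpleGraph.Adj (deleteEdges graph S) (vertex x) (vertex y)
    surviving-edge joined eq = ∧-true (Joined⇒Adj joined) (cong not eq)

  -- The deletions that `σ` stands for: one of the two hub edges at every switch and no other edge.
  -- Both directions of the correctness pass through this record, as all degrees are then fixed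
  -- except those of the hubs, which depend on `kept σ` alone.
  record Chosen (S : EdgeSet graph) (σ : ℕ → Bool) : Set where
    open Deletion S
    field
      at-first  : ∀ u → u < k → deleted (switch , u) (hub , e₁ u) ≡ σ u
      at-second : ∀ u → u < k → deleted (switch , u) (hub , e₂ u) ≡ not (σ u)
      elsewhere : ∀ {x y} → Up x y → proj₁ x ≢ switch → deleted x y ≡ false

  kept≤k : ∀ σ v → kept σ v ≤ k
  kept≤k σ v = ∑𝟙≤ k λ u → ((e₁ u ≡ᵇ v) ∧ not (σ u)) ∨ ((e₂ u ≡ᵇ v) ∧ σ u)

  count-true : ∀ {A : Set} {p : A → Bool} xs → (∀ {x} → x ∈ xs → p x ≡ true) → count p xs ≡ length xs
  count-true []       eq = refl
  count-true (x ∷ xs) eq = cong₂ _+_ (cong 𝟙 (eq (here refl))) (count-true xs (eq ∘ there))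

  count-select : ∀ {A : Set} (p q : A → Bool) xs → count p (select q xs) ≡ count (λ x → q x ∧ p x) xs
  count-select p q [] = refl
  count-select p q (x ∷ xs) with q x
  ... | true  = cong (𝟙 (p x) +_) (count-select p q xs)
  ... | false = count-select p q xs

  module _ {S : EdgeSet graph} {σ : ℕ → Bool} (chosen : Chosen S σ) where
    open Deletion S
    open Chosen chosen

    private
      degreeOf : Vertex → ℕ
      degreeOf x = degree (deleteEdges graph S) (vertex x)

      stays : ∀ {x y} → Up x y → proj₁ x ≢ switch → not (deleted x y) ≡ true
      stays up ≢switch = cong not (elsewhere up ≢switch)

      stays′ : ∀ {x y} → Up x y → proj₁ x ≢ switch → not (deleted y x) ≡ true
      stays′ {x} {y} up ≢switch = trans (cong not (deleted-sym y x)) (stays up ≢switch)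

      kept-at : ∀ v u → u < k → (((e₁ u ≡ᵇ v) ∨ (e₂ u ≡ᵇ v)) ∧ not (deleted (hub , v) (switch , u)))
                              ≡ (((e₁ u ≡ᵇ v) ∧ not (σ u)) ∨ ((e₂ u ≡ᵇ v) ∧ σ u))
      kept-at v u u<k with e₁ u ≟ v | e₂ u ≟ v
      ... | yes refl | yes eq = contradiction (sym eq) (e₁≢e₂ u u<k)
      ... | yes refl | no ≢v rewrite ≡ᵇ-true {e₁ u} refl | ≡ᵇ-false ≢v | deleted-sym (hub , e₁ u) (switch , u) | at-first u u<k =
        sym (Bool.∨-identityʳ _)
      ... | no ≢v | yes refl rewrite ≡ᵇ-true {e₂ u} refl | ≡ᵇ-false ≢v | deleted-sym (hub , e₂ u) (switch , u) | at-second u u<k =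
        Bool.not-involutive (σ u)
      ... | no ≢v | no ≢v′ rewrite ≡ᵇ-false ≢v | ≡ᵇ-false ≢v′ = refl

    hub-degree : ∀ v → v < h → degreeOf (hub , v) ≡ suc k + kept σ v
    hub-degree v v<h = trans (degree-survivors (<-≤-trans v<h (≤-trans h≤guards guards≤pendants)) nbrs) (trans (count-++ q gs (List.map (switch ,_) (select p (List.downFrom k))))
      (cong₂ _+_ (trans (count-true gs at-guard) (trans (List.length-map _ (List.downFrom (suc k))) (List.length-downFrom (suc k)))) at-switches))
      where
      nbrs = hub-neighbours v v<h
      p = λ u → (e₁ u ≡ᵇ v) ∨ (e₂ u ≡ᵇ v)
      q = λ y → not (deleted (hub , v) y)
      gs = List.map (λ y → guard , h * y + v) (List.downFrom (suc k))
      at-guard : ∀ {y} → y ∈ gs → q y ≡ true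
      at-guard y∈ with ∈-map⁻ _ y∈
      ... | y , y∈′ , refl with Neighbours.sound nbrs (∈-++⁺ˡ y∈)
      ... | inj₂ up = stays′ up λ ()
      at-switches : count q (List.map (switch ,_) (select p (List.downFrom k))) ≡ kept σ v
      at-switches = trans (count-map q (switch ,_) (select p (List.downFrom k))) (trans (count-select (q ∘ (switch ,_)) p (List.downFrom k))
        (trans (count-cong (List.downFrom k) (λ {u} u∈ → kept-at v u (∈-downFrom⁻ u∈))) (count-downFrom _ k)))

    guard-degree : ∀ c → c < guards → degreeOf (guard , c) ≡ suc (if forbidding c then k + quot c h else 0)
    guard-degree c c< = trans (degree-survivors (<-≤-trans c< guards≤pendants) nbrs)
      (trans (count-true ((hub , rem c h) ∷ guard-pendants c) remains) (cong suc size))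
      where
      nbrs = guard-neighbours c c<
      size : length (guard-pendants c) ≡ (if forbidding c then k + quot c h else 0)
      size with forbidding c
      ... | true  = trans (List.length-map _ (List.downFrom (k + quot c h))) (List.length-downFrom (k + quot c h))
      ... | false = refl
      remains : ∀ {y} → y ∈ (hub , rem c h) ∷ guard-pendants c → not (deleted (guard , c) y) ≡ true
      remains y∈ with Neighbours.sound nbrs y∈
      ... | inj₁ up                = stays up λ ()
      ... | inj₂ up@(pendant↑ _ _) = stays′ up λ ()

    pendant-degree : ∀ m → m < pendants → present m ≡ true → degreeOf (pendant , m) ≡ 1
    pendant-degree m m< p = trans (degree-survivors m< (pendant-neighbours m m< p)) (cong (λ b → 𝟙 b + 0) (stays (pendant↑ m< p) λ ()))

    module _ {u} (u<k : u < k) where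

      switch-degree : degreeOf (switch , u) ≡ 2
      switch-degree = trans (degree-survivors (<-trans u<k k<pendants) (switch-neighbours u<k))
        (trans (cong₂ (λ a b → 𝟙 (not a) + (𝟙 (not b) + (𝟙 (not (deleted (switch , u) (joint , u))) + 0))) (at-first u u<k) (at-second u u<k))
        (trans (cong (λ c → 𝟙 (not (σ u)) + (𝟙 (not (not (σ u))) + (𝟙 c + 0))) (stays′ (joint↑ u<k) λ ())) (one-of (σ u))))
        where
        one-of : ∀ b → 𝟙 (not b) + (𝟙 (not (not b)) + 1) ≡ 2
        one-of true  = refl
        one-of false = refl

      joint-degree : degreeOf (joint , u) ≡ 3
      joint-degree = trans (degree-survivors (<-trans u<k k<pendants) (joint-neighbours u<k))
        (cong₂ _+_ (cong 𝟙 (stays (joint↑ u<k) λ ())) (cong₂ (λ a b → 𝟙 a + (𝟙 b + 0)) (stays′ (arm₁↑ u<k) λ ()) (stays′ (arm₂↑ u<k) λ ())))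

      arm₁-degree : degreeOf (arm₁ , u) ≡ 2
      arm₁-degree = trans (degree-survivors (<-trans u<k k<pendants) (arm₁-neighbours u<k))
        (cong₂ (λ a b → 𝟙 a + (𝟙 b + 0)) (stays (arm₁↑ u<k) λ ()) (stays′ (hand₁↑ u<k) λ ()))

      arm₂-degree : degreeOf (arm₂ , u) ≡ 2
      arm₂-degree = trans (degree-survivors (<-trans u<k k<pendants) (arm₂-neighbours u<k))
        (cong₂ (λ a b → 𝟙 a + (𝟙 b + 0)) (stays (arm₂↑ u<k) λ ()) (stays′ (hand₂↑ u<k) λ ()))

      hand₁-degree : degreeOf (hand₁ , u) ≡ 1
      hand₁-degree = trans (degree-survivors (<-trans u<k k<pendants) (hand₁-neighbours u<k)) (cong (λ a → 𝟙 a + 0) (stays (hand₁↑ u<k) λ ()))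

      hand₂-degree : degreeOf (hand₂ , u) ≡ 1
      hand₂-degree = trans (degree-survivors (<-trans u<k k<pendants) (hand₂-neighbours u<k)) (cong (λ a → 𝟙 a + 0) (stays (hand₂↑ u<k) λ ()))

    -- Otherwise the guard of `v` for the value `kept σ v` carries its pendants, has exactly the
    -- degree of `v`, and is still adjacent to it.
    irregular⇒allowed : IsEdgeIrregulator graph S → ∀ v → v < h → allowed v (kept σ v) ≡ true
    irregular⇒allowed irregular v v<h with allowed v (kept σ v) in eq
    ... | true  = refl
    ... | false = contradiction (trans (guard-degree c c<) (trans (cong (λ b → suc (if b then k + quot c h else 0)) forbidden)
                    (trans (cong (λ y → suc (k + y)) (quot-unique h y v<h)) (sym (hub-degree v v<h)))))
                    (irregular (vertex (guard , c)) (vertex (hub , v)) (surviving-edge (inj₁ up) (elsewhere up λ ())))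
      where
      y = kept σ v
      c = h * y + v
      c< : c < guards
      c< = pair< (s≤s (kept≤k σ v)) v<h
      up : Up (guard , c) (hub , v)
      up = subst (λ r → Up (guard , c) (hub , r)) (rem-unique h y v<h) (guard↑ c<)
      forbidden : forbidding c ≡ true
      forbidden = trans (cong₂ (λ r q → not (allowed r q)) (rem-unique h y v<h) (quot-unique h y v<h)) (cong not eq)

    -- Only an edge between a hub and a guard with pendants can depend on `σ`. Elsewhere the degrees
    -- always differ: hubs have at least 3, a pendant has 1 against at least 3 at its guard, and the
    -- degrees along switch, joint, arm and hand are 2, 3, 2, 1.
    allowed⇒irregular : (∀ v → v < h → allowed v (kept σ v) ≡ true) → IsEdgeIrregulator graph S
    allowed⇒irregular ok = irregular
      where
      -- `2≤k` lifts the degree of a hub to at least 3, above its switches (2) and its guards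
      -- without pendants (1).
      2≢hub : ∀ {n v} → v < h → n ≤ 2 → n ≢ degreeOf (hub , v)
      2≢hub v<h n≤2 eq = <⇒≢ (≤-<-trans n≤2 (≤-trans (s≤s 2≤k) (m≤m+n (suc k) _))) (trans eq (hub-degree _ v<h))
      differ : ∀ {x y} → Up x y → degreeOf x ≢ degreeOf y
      differ {guard , c} (guard↑ c<) eq with forbidding c in forbidden
      ... | false = 2≢hub (rem< c 0<h) (s≤s z≤n) (trans (sym (trans (guard-degree c c<) (cong (λ b → suc (if b then k + quot c h else 0)) forbidden))) eq)
      ... | true  = true≢false (subst (λ y → allowed (rem c h) y ≡ true) (sym same) (ok (rem c h) (rem< c 0<h))) (not-true forbidden)
        where
        not-true : ∀ {b} → not b ≡ true → b ≡ false
        not-true {false} _ = refl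
        same : quot c h ≡ kept σ (rem c h)
        same = +-cancelˡ-≡ (suc k) _ _ (trans (sym (trans (guard-degree c c<) (cong (λ b → suc (if b then k + quot c h else 0)) forbidden)))
                 (trans eq (hub-degree (rem c h) (rem< c 0<h))))
      differ {pendant , m} (pendant↑ m< p) eq = <⇒≢ (≤-trans 2≤k (≤-trans (m≤m+n k _) (n≤1+n _)))
        (trans (sym (pendant-degree m m< p)) (trans eq (trans (guard-degree (rem m guards) (rem< m 0<guards))
          (cong (λ b → suc (if b then k + quot (rem m guards) h else 0)) (proj₂ (∧-true⁻ {quot m guards <ᵇ k + quot (rem m guards) h} p))))))
      differ (first↑ u<)  eq = 2≢hub (e₁<h _ u<) ≤-refl (trans (sym (switch-degree u<)) eq)
      differ (second↑ u<) eq = 2≢hub (e₂<h _ u<) ≤-refl (trans (sym (switch-degree u<)) eq)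
      differ (joint↑ u<)  eq = case trans (sym (joint-degree u<)) (trans eq (switch-degree u<)) of λ ()
      differ (arm₁↑ u<)   eq = case trans (sym (arm₁-degree u<)) (trans eq (joint-degree u<)) of λ ()
      differ (arm₂↑ u<)   eq = case trans (sym (arm₂-degree u<)) (trans eq (joint-degree u<)) of λ ()
      differ (hand₁↑ u<)  eq = case trans (sym (hand₁-degree u<)) (trans eq (arm₁-degree u<)) of λ ()
      differ (hand₂↑ u<)  eq = case trans (sym (hand₂-degree u<)) (trans eq (arm₂-degree u<)) of λ ()
      irregular : IsEdgeIrregulator graph S
      irregular a b adj eq with Adj⇒Joined (proj₁ (∧-true⁻ adj))
      ... | inj₁ up = differ up (subst₂ (λ a b → degree (deleteEdges graph S) a ≡ degree (deleteEdges graph S) b) (sym (vertex-decoded a)) (sym (vertex-decoded b)) eq)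
      ... | inj₂ up = differ up (subst₂ (λ a b → degree (deleteEdges graph S) a ≡ degree (deleteEdges graph S) b) (sym (vertex-decoded b)) (sym (vertex-decoded a)) (sym eq))

  -- `cardinality` counts an edge from its smaller end, whereas `Up` directs edges by rank.
  ordered : Vertex × Vertex → Fin order × Fin order
  ordered (x , y) = if toℕ (vertex x) <ᵇ toℕ (vertex y) then (vertex x , vertex y) else (vertex y , vertex x)

  ordered-injective : ∀ {x y x′ y′} → Up x y → Up x′ y′ → ordered (x , y) ≡ ordered (x′ , y′) → (x , y) ≡ (x′ , y′)
  ordered-injective {x} {y} {x′} {y′} up up′ eq
    with toℕ (vertex x) <ᵇ toℕ (vertex y) | toℕ (vertex x′) <ᵇ toℕ (vertex y′)
       | Up-InRange up | Up-InRange up′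
  ... | true  | true  | x< , y< | x<′ , y<′ = cong₂ _,_ (vertex-injective x< x<′ (cong proj₁ eq)) (vertex-injective y< y<′ (cong proj₂ eq))
  ... | false | false | x< , y< | x<′ , y<′ = cong₂ _,_ (vertex-injective x< x<′ (cong proj₂ eq)) (vertex-injective y< y<′ (cong proj₁ eq))
  ... | true  | false | x< , y< | x<′ , y<′ = contradiction (subst₂ Up (vertex-injective x< y<′ (cong proj₁ eq)) (vertex-injective y< x<′ (cong proj₂ eq)) up) (Up-asym up′)
  ... | false | true  | x< , y< | x<′ , y<′ = contradiction (subst₂ Up (vertex-injective x< y<′ (cong proj₂ eq)) (vertex-injective y< x<′ (cong proj₁ eq)) up) (Up-asym up′)

  cutting : (ℕ → Bool) → Vertex → Vertex → Bool
  cutting σ (switch , u) (hub , v) = (u <ᵇ k) ∧ (((e₁ u ≡ᵇ v) ∧ σ u) ∨ ((e₂ u ≡ᵇ v) ∧ not (σ u)))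
  cutting σ _            _         = false

  module Cut (σ : ℕ → Bool) where

    cut-end : ℕ → ℕ
    cut-end u = if σ u then e₁ u else e₂ u

    cutting-sound : ∀ x y → cutting σ x y ≡ true → ∃ λ u → u < k × x ≡ (switch , u) × y ≡ (hub , cut-end u)
    cutting-sound (switch , u) (hub , v) eq with ∧-true⁻ {u <ᵇ k} eq
    ... | u< , eq′ with σ u in eqσ | ∨-true⁻ {(e₁ u ≡ᵇ v) ∧ σ u} eq′
    ... | true  | inj₁ eq₁ = u , <ᵇ-true⁻ u k u< , refl , cong (hub ,_) (trans (sym (≡ᵇ-true⁻ (e₁ u) v (proj₁ (∧-true⁻ eq₁)))) (cong (λ b → if b then e₁ u else e₂ u) (sym eqσ)))
    ... | true  | inj₂ eq₂ = case ∧-true⁻ {e₂ u ≡ᵇ v} eq₂ of λ { (_ , ()) }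
    ... | false | inj₁ eq₁ = case ∧-true⁻ {e₁ u ≡ᵇ v} eq₁ of λ { (_ , ()) }
    ... | false | inj₂ eq₂ = u , <ᵇ-true⁻ u k u< , refl , cong (hub ,_) (trans (sym (≡ᵇ-true⁻ (e₂ u) v (proj₁ (∧-true⁻ eq₂)))) (cong (λ b → if b then e₁ u else e₂ u) (sym eqσ)))

    Up-cut-end : ∀ {u} → u < k → Up (switch , u) (hub , cut-end u)
    Up-cut-end {u} u<k with σ u
    ... | true  = first↑ u<k
    ... | false = second↑ u<k

    cutting⇒Up : ∀ x y → cutting σ x y ≡ true → Up x y
    cutting⇒Up x y eq with cutting-sound x y eq
    ... | u , u<k , refl , refl = Up-cut-end u<k

    cut : EdgeSet graph
    cut = record
      { mem           = λ a b → cutting σ (decoded a) (decoded b) ∨ cutting σ (decoded b) (decoded a)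
      ; mem-symmetric = λ a b → Bool.∨-comm (cutting σ (decoded a) (decoded b)) _
      ; mem⇒Adj       = λ a b eq → edge-complete (toℕ a) (toℕ b) ([ inj₁ ∘ cutting⇒Up _ _ , inj₂ ∘ cutting⇒Up _ _ ]′ (∨-true⁻ {cutting σ (decoded a) (decoded b)} eq))
      }

    cut-chosen : Chosen cut σ
    cut-chosen = record { at-first = at-first ; at-second = at-second ; elsewhere = elsewhere }
      where
      open Deletion cut
      unfolded : ∀ {x y} → Up x y → deleted x y ≡ cutting σ x y ∨ cutting σ y x
      unfolded up = cong₂ (λ x y → cutting σ x y ∨ cutting σ y x) (decode-vertex (proj₁ (Up-InRange up))) (decode-vertex (proj₂ (Up-InRange up)))
      at-first : ∀ u → u < k → deleted (switch , u) (hub , e₁ u) ≡ σ u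
      at-first u u<k rewrite unfolded (first↑ u<k) | <ᵇ-true u<k | ≡ᵇ-true {e₁ u} refl | ≡ᵇ-false (λ eq → e₁≢e₂ u u<k (sym eq)) =
        trans (Bool.∨-identityʳ _) (Bool.∨-identityʳ _)
      at-second : ∀ u → u < k → deleted (switch , u) (hub , e₂ u) ≡ not (σ u)
      at-second u u<k rewrite unfolded (second↑ u<k) | <ᵇ-true u<k | ≡ᵇ-true {e₂ u} refl | ≡ᵇ-false (e₁≢e₂ u u<k) = Bool.∨-identityʳ _
      elsewhere : ∀ {x y} → Up x y → proj₁ x ≢ switch → deleted x y ≡ false
      elsewhere {x} {y} up ≢switch with deleted x y in eq
      ... | false = refl
      ... | true with ∨-true⁻ {cutting σ x y} (trans (sym (unfolded up)) eq)
      ... | inj₁ c = case cutting-sound x y c of λ { (_ , _ , refl , _) → contradiction refl ≢switch }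
      ... | inj₂ c = contradiction (cutting⇒Up y x c) (Up-asym up)

    cut-cardinality : cardinality cut ≤ k
    cut-cardinality with supports (λ i j → does (i Fin.<? j) ∧ EdgeSet.mem cut i j)
    ... | Z , len , unique , members = begin
      cardinality cut            ≡⟨ sym len ⟩
      length Z                   ≤⟨ unique-⊆⇒length≤ unique listed ⟩
      length targets             ≡⟨ trans (List.length-map _ (List.downFrom k)) (List.length-downFrom k) ⟩
      k                          ∎
      where
      open ≤-Reasoning
      targets = List.map (λ u → ordered ((switch , u) , (hub , cut-end u))) (List.downFrom k)
      in-order : ∀ i j → i Fin.< j → ordered (decoded i , decoded j) ≡ (i , j)
      in-order i j i<j rewrite vertex-decoded i | vertex-decoded j | <ᵇ-true i<j = refl
      out-of-order : ∀ i j → i Fin.< j → ordered (decoded j , decoded i) ≡ (i , j)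
      out-of-order i j i<j rewrite vertex-decoded i | vertex-decoded j | <ᵇ-false (<⇒≤ i<j) = refl
      target : ∀ {x y p} → cutting σ x y ≡ true → ordered (x , y) ≡ p → p ∈ targets
      target {x} {y} c refl with cutting-sound x y c
      ... | u , u<k , refl , refl = ∈-map⁺ _ (∈-downFrom⁺ u<k)
      listed : ∀ {p} → p ∈ Z → p ∈ targets
      listed {i , j} p∈ with ∧-true⁻ {does (i Fin.<? j)} (Equivalence.to members p∈)
      ... | lt , c with ∨-true⁻ {cutting σ (decoded i) (decoded j)} c
      ... | inj₁ c₁ = target c₁ (in-order i j (<ᵇ-true⁻ (toℕ i) (toℕ j) lt))
      ... | inj₂ c₂ = target c₂ (out-of-order i j (<ᵇ-true⁻ (toℕ i) (toℕ j) lt))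

  -- Among any k deletions that repair the graph, every switch accounts for
  -- exactly one of the edges in its region.

  region : ℕ → List (Vertex × Vertex)
  region u = ((switch , u) , (hub , e₁ u)) ∷ ((switch , u) , (hub , e₂ u)) ∷ ((joint , u) , (switch , u)) ∷
             ((arm₁ , u) , (joint , u)) ∷ ((arm₂ , u) , (joint , u)) ∷ []

  region-Up : ∀ {u} → u < k → ∀ {x y} → (x , y) ∈ region u → Up x y
  region-Up u<k (here refl)                                 = first↑ u<k
  region-Up u<k (there (here refl))                         = second↑ u<k
  region-Up u<k (there (there (here refl)))                 = joint↑ u<k
  region-Up u<k (there (there (there (here refl))))         = arm₁↑ u<k
  region-Up u<k (there (there (there (there (here refl))))) = arm₂↑ u<k

  region-index : ∀ {u x y} → (x , y) ∈ region u → proj₂ x ≡ u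
  region-index (here refl)                                 = refl
  region-index (there (here refl))                         = refl
  region-index (there (there (here refl)))                 = refl
  region-index (there (there (there (here refl))))         = refl
  region-index (there (there (there (there (here refl))))) = refl

  choice : EdgeSet graph → ℕ → Bool
  choice S u = Deletion.deleted S (switch , u) (hub , e₁ u)

  module _ {S : EdgeSet graph} (irregular : IsEdgeIrregulator graph S) (small : cardinality S ≤ k) where
    open Deletion S

    private
      gone : Vertex × Vertex → Bool
      gone (x , y) = deleted x y

      search : ∀ xs → Σ (Vertex × Vertex) (λ e → e ∈ xs × gone e ≡ true) ⊎ (∀ {e} → e ∈ xs → gone e ≡ false)
      search [] = inj₂ λ ()
      search (e ∷ xs) with gone e in eq | search xs
      ... | true  | _                  = inj₁ (e , here refl , eq)
      ... | false | inj₁ (e′ , e∈ , g) = inj₁ (e′ , there e∈ , g)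
      ... | false | inj₂ none          = inj₂ λ { (here refl) → eq ; (there e∈) → none e∈ }

      -- If the whole region survived, the switch and its joint would be adjacent and both have
      -- degree 3.
      some-deleted : ∀ u → u < k → Σ (Vertex × Vertex) (λ e → e ∈ region u × gone e ≡ true)
      some-deleted u u<k with search (region u)
      ... | inj₁ found = found
      ... | inj₂ none = contradiction (trans joint-degree′ (sym switch-degree′))
                          (irregular (vertex (joint , u)) (vertex (switch , u)) (surviving-edge (inj₁ (joint↑ u<k)) (none (there (there (here refl))))))
        where
        joint-degree′ : degree (deleteEdges graph S) (vertex (joint , u)) ≡ 3
        joint-degree′ = trans (degree-survivors (<-trans u<k k<pendants) (joint-neighbours u<k))
          (cong₂ _+_ (cong (𝟙 ∘ not) (none (there (there (here refl)))))
            (cong₂ (λ a b → 𝟙 (not a) + (𝟙 (not b) + 0)) (trans (deleted-sym (joint , u) (arm₁ , u)) (none (there (there (there (here refl)))))) (trans (deleted-sym (joint , u) (arm₂ , u)) (none (there (there (there (there (here refl)))))))))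
        switch-degree′ : degree (deleteEdges graph S) (vertex (switch , u)) ≡ 3
        switch-degree′ = trans (degree-survivors (<-trans u<k k<pendants) (switch-neighbours u<k))
          (cong₂ _+_ (cong (𝟙 ∘ not) (none (here refl)))
            (cong₂ (λ a b → 𝟙 (not a) + (𝟙 (not b) + 0)) (none (there (here refl))) (trans (deleted-sym (switch , u) (joint , u)) (none (there (there (here refl)))))))

      picked : ℕ → Vertex × Vertex
      picked u with u <? k
      ... | yes u<k = proj₁ (some-deleted u u<k)
      ... | no  _   = (hub , 0) , (hub , 0)

      picked∈region : ∀ {u} → u < k → picked u ∈ region u
      picked∈region {u} u<k with u <? k
      ... | yes u<k′ = proj₁ (proj₂ (some-deleted u u<k′))
      ... | no  u≮k  = contradiction u<k u≮k

      picked-gone : ∀ {u} → u < k → gone (picked u) ≡ true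
      picked-gone {u} u<k with u <? k
      ... | yes u<k′ = proj₂ (proj₂ (some-deleted u u<k′))
      ... | no  u≮k  = contradiction u<k u≮k

      deleted-list : ∃[ Z ] length Z ≡ cardinality S × Unique Z × (∀ {i j} → (i , j) ∈ Z ⇔ does (i Fin.<? j) ∧ EdgeSet.mem S i j ≡ true)
      deleted-list = supports (λ i j → does (i Fin.<? j) ∧ EdgeSet.mem S i j)

      Z = proj₁ deleted-list

      ordered∈Z : ∀ {x y} → Up x y → deleted x y ≡ true → ordered (x , y) ∈ Z
      ordered∈Z {x} {y} up g with toℕ (vertex x) <ᵇ toℕ (vertex y) in lt
      ... | true  = Equivalence.from (proj₂ (proj₂ (proj₂ deleted-list))) (∧-true lt g)
      ... | false = Equivalence.from (proj₂ (proj₂ (proj₂ deleted-list))) (∧-true (<ᵇ-true y<x) (trans (deleted-sym y x) g))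
        where
        y<x : toℕ (vertex y) < toℕ (vertex x)
        y<x with <-cmp (toℕ (vertex y)) (toℕ (vertex x))
        ... | tri< y<x _ _ = y<x
        ... | tri≈ _ eq _  = contradiction (subst (λ z → Up z y) (vertex-injective x< y< (sym (Fin.toℕ-injective eq))) up) (λ up′ → Up-asym up′ up′)
          where
          x< = proj₁ (Up-InRange up)
          y< = proj₂ (Up-InRange up)
        ... | tri> _ _ x<y = true≢false (<ᵇ-true x<y) lt

      picks-list : List (Fin order × Fin order)
      picks-list = List.map (ordered ∘ picked) (List.downFrom k)

      picks-unique : Unique picks-list
      picks-unique = unique-map same (Unique.downFrom⁺ k)
        where
        same : ∀ {u u′} → u ∈ List.downFrom k → u′ ∈ List.downFrom k → ordered (picked u) ≡ ordered (picked u′) → u ≡ u′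
        same u∈ u′∈ eq = trans (sym (region-index r)) (trans (cong (proj₂ ∘ proj₁) (ordered-injective (region-Up (∈-downFrom⁻ u∈) r) (region-Up (∈-downFrom⁻ u′∈) r′) eq)) (region-index r′))
          where
          r  = picked∈region (∈-downFrom⁻ u∈)
          r′ = picked∈region (∈-downFrom⁻ u′∈)

      picks⊆Z : ∀ {p} → p ∈ picks-list → p ∈ Z
      picks⊆Z p∈ with ∈-map⁻ (ordered ∘ picked) p∈
      ... | u , u∈ , refl = ordered∈Z (region-Up (∈-downFrom⁻ u∈) (picked∈region (∈-downFrom⁻ u∈))) (picked-gone (∈-downFrom⁻ u∈))

      Z-short : length Z ≤ length picks-list
      Z-short = ≤-trans (≤-reflexive (proj₁ (proj₂ deleted-list))) (≤-trans small
        (≤-reflexive (sym (trans (List.length-map (ordered ∘ picked) (List.downFrom k)) (List.length-downFrom k)))))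

      -- Regions of different switches share no edge, so one deleted edge from each region already
      -- exhausts the budget `k`.
      only-picked : ∀ {x y} → Up x y → deleted x y ≡ true → ∃ λ u → u < k × (x , y) ≡ picked u
      only-picked up g with ∈-map⁻ (ordered ∘ picked) (unique-⊆-full (Product.≡-dec Fin._≟_ Fin._≟_) picks-unique picks⊆Z Z-short (ordered∈Z up g))
      ... | u , u∈ , eq = u , ∈-downFrom⁻ u∈ , ordered-injective up (region-Up (∈-downFrom⁻ u∈) (picked∈region (∈-downFrom⁻ u∈))) eq

      alone : ∀ {u} → u < k → ∀ {x y} → Up x y → proj₂ x ≡ u → (x , y) ≢ picked u → deleted x y ≡ false
      alone {u} u<k {x} {y} up at-u ≢picked with deleted x y in eq
      ... | false = refl
      ... | true  = ⊥-elim (excluded (only-picked up eq))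
        where
        excluded : (∃ λ u′ → u′ < k × (x , y) ≡ picked u′) → ⊥
        excluded (u′ , u′<k , eq′) = ≢picked (trans eq′ (cong picked (trans (sym index) at-u)))
          where
          index : proj₂ x ≡ u′
          index = region-index {u′} {x} {y} (subst (_∈ region u′) (sym eq′) (picked∈region u′<k))

      module _ {u} (u<k : u < k) where

        private
          present-edge : ∀ {e x y} → picked u ≡ e → Up x y → proj₂ x ≡ u → (x , y) ≢ e → deleted x y ≡ false
          present-edge refl up eq ≢e = alone u<k up eq ≢e

          arm-degree₁ : ∀ {e} → picked u ≡ e → ((arm₁ , u) , (joint , u)) ≢ e → ((hand₁ , u) , (arm₁ , u)) ≢ e →
                        degree (deleteEdges graph S) (vertex (arm₁ , u)) ≡ 2
          arm-degree₁ p ≢a ≢h = trans (degree-survivors (<-trans u<k k<pendants) (arm₁-neighbours u<k))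
            (cong₂ (λ a b → 𝟙 (not a) + (𝟙 (not b) + 0)) (present-edge p (arm₁↑ u<k) refl ≢a)
              (trans (deleted-sym (arm₁ , u) (hand₁ , u)) (present-edge p (hand₁↑ u<k) refl ≢h)))

          arm-degree₂ : ∀ {e} → picked u ≡ e → ((arm₂ , u) , (joint , u)) ≢ e → ((hand₂ , u) , (arm₂ , u)) ≢ e →
                        degree (deleteEdges graph S) (vertex (arm₂ , u)) ≡ 2
          arm-degree₂ p ≢a ≢h = trans (degree-survivors (<-trans u<k k<pendants) (arm₂-neighbours u<k))
            (cong₂ (λ a b → 𝟙 (not a) + (𝟙 (not b) + 0)) (present-edge p (arm₂↑ u<k) refl ≢a)
              (trans (deleted-sym (arm₂ , u) (hand₂ , u)) (present-edge p (hand₂↑ u<k) refl ≢h)))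

          joint-degree′ : ∀ a b c → deleted (joint , u) (switch , u) ≡ a → deleted (arm₁ , u) (joint , u) ≡ b → deleted (arm₂ , u) (joint , u) ≡ c →
                         degree (deleteEdges graph S) (vertex (joint , u)) ≡ 𝟙 (not a) + (𝟙 (not b) + (𝟙 (not c) + 0))
          joint-degree′ a b c refl refl refl = trans (degree-survivors (<-trans u<k k<pendants) (joint-neighbours u<k))
            (cong₂ (λ b c → 𝟙 (not a) + (𝟙 (not b) + (𝟙 (not c) + 0))) (deleted-sym (joint , u) (arm₁ , u)) (deleted-sym (joint , u) (arm₂ , u)))

          picked-is : ∀ {e} → picked u ≡ e → gone e ≡ true
          picked-is refl = picked-gone u<k

        -- By `alone` nothing else is deleted around `u`, in particular no edge to a hand. If the
        -- joint loses its one edge elsewhere, its degree drops to 2 and it stays adjacent to an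
        -- arm, which also has degree 2.
        at-hub : picked u ≡ ((switch , u) , (hub , e₁ u)) ⊎ picked u ≡ ((switch , u) , (hub , e₂ u))
        at-hub = cases refl (picked∈region u<k)
          where
          cases : ∀ {e} → picked u ≡ e → e ∈ region u → picked u ≡ ((switch , u) , (hub , e₁ u)) ⊎ picked u ≡ ((switch , u) , (hub , e₂ u))
          cases eq (here refl) = inj₁ eq
          cases eq (there (here refl)) = inj₂ eq
          cases eq (there (there (here refl))) = contradiction
            (trans (arm-degree₁ eq (λ ()) (λ ())) (sym (joint-degree′ true false false (picked-is eq) (present-edge eq (arm₁↑ u<k) refl λ ()) (present-edge eq (arm₂↑ u<k) refl λ ()))))
            (irregular (vertex (arm₁ , u)) (vertex (joint , u)) (surviving-edge (inj₁ (arm₁↑ u<k)) (present-edge eq (arm₁↑ u<k) refl λ ())))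
          cases eq (there (there (there (here refl)))) = contradiction
            (trans (arm-degree₂ eq (λ ()) (λ ())) (sym (joint-degree′ false true false (present-edge eq (joint↑ u<k) refl λ ()) (picked-is eq) (present-edge eq (arm₂↑ u<k) refl λ ()))))
            (irregular (vertex (arm₂ , u)) (vertex (joint , u)) (surviving-edge (inj₁ (arm₂↑ u<k)) (present-edge eq (arm₂↑ u<k) refl λ ())))
          cases eq (there (there (there (there (here refl))))) = contradiction
            (trans (arm-degree₁ eq (λ ()) (λ ())) (sym (joint-degree′ false false true (present-edge eq (joint↑ u<k) refl λ ()) (present-edge eq (arm₁↑ u<k) refl λ ()) (picked-is eq))))
            (irregular (vertex (arm₁ , u)) (vertex (joint , u)) (surviving-edge (inj₁ (arm₁↑ u<k)) (present-edge eq (arm₁↑ u<k) refl λ ())))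

    small-irregulator-chosen : Chosen S (choice S)
    small-irregulator-chosen = record { at-first = λ _ _ → refl ; at-second = at-second ; elsewhere = elsewhere }
      where
      at-second : ∀ u → u < k → deleted (switch , u) (hub , e₂ u) ≡ not (deleted (switch , u) (hub , e₁ u))
      at-second u u<k with at-hub u<k
      ... | inj₁ eq = trans (alone u<k (second↑ u<k) refl λ eq′ → e₁≢e₂ u u<k (sym (cong (proj₂ ∘ proj₂) (trans eq′ eq))))
                        (cong not (sym (trans (cong gone (sym eq)) (picked-gone u<k))))
      ... | inj₂ eq = trans (trans (cong gone (sym eq)) (picked-gone u<k))
                        (cong not (sym (alone u<k (first↑ u<k) refl λ eq′ → e₁≢e₂ u u<k (cong (proj₂ ∘ proj₂) (trans eq′ eq)))))
      elsewhere : ∀ {x y} → Up x y → proj₁ x ≢ switch → deleted x y ≡ false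
      elsewhere {x} {y} up ≢switch with deleted x y in eq
      ... | false = refl
      ... | true  = ⊥-elim (excluded (only-picked up eq))
        where
        excluded : (∃ λ u → u < k × (x , y) ≡ picked u) → ⊥
        excluded (u , u<k , eq′) = [ (λ eq″ → ≢switch (cong (proj₁ ∘ proj₁) (trans eq′ eq″))) , (λ eq″ → ≢switch (cong (proj₁ ∘ proj₁) (trans eq′ eq″))) ]′ (at-hub u<k)

  Allowed : (ℕ → Bool) → Set
  Allowed σ = ∀ v → v < h → allowed v (kept σ v) ≡ true

  small-irregulator⇒allowed : ∀ {S} → IsEdgeIrregulator graph S → cardinality S ≤ k → ∃ Allowed
  small-irregulator⇒allowed {S} irregular small =
    choice S , irregular⇒allowed {S} (small-irregulator-chosen {S} irregular small) irregular

  allowed⇒small-irregulator : ∃ Allowed → Σ (EdgeSet graph) λ S → IsEdgeIrregulator graph S × cardinality S ≤ k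
  allowed⇒small-irregulator (σ , ok) = Cut.cut σ , allowed⇒irregular {Cut.cut σ} (Cut.cut-chosen σ) ok , Cut.cut-cardinality σ

  small-irregulator⇔ : (∃[ m ] Iₑ graph m × m ≤ k) ⇔ ∃ Allowed
  small-irregulator⇔ = mk⇔
    (λ { (m , ((S , irregular , size) , _) , m≤k) → small-irregulator⇒allowed {S} irregular (subst (_≤ k) (sym size) m≤k) })
    (λ a → let (S , irregular , small) = allowed⇒small-irregulator a
               (m , min , m≤) = Iₑ-exists graph {S} irregular
           in m , min , ≤-trans m≤ small)

  -- Structural parameters, if the hubs N, …, h - 1 serve only as second ends

  module Structure (N : ℕ) (N<h : N < h) (e₁<N : ∀ u → u < k → e₁ u < N) (N≤e₂ : ∀ u → u < k → N ≤ e₂ u) where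

    data Central : Vertex → Set where
      central : ∀ {v} → N ≤ v → v < h → Central (hub , v)

    central? : ∀ x → Dec (Central x)
    central? (hub , v)     = map′ (uncurry central) (λ { (central a b) → a , b }) (N ≤? v ×-dec v <? h)
    central? (guard , m)   = no λ ()
    central? (pendant , m) = no λ ()
    central? (switch , m)  = no λ ()
    central? (joint , m)   = no λ ()
    central? (arm₁ , m)    = no λ ()
    central? (arm₂ , m)    = no λ ()
    central? (hand₁ , m)   = no λ ()
    central? (hand₂ , m)   = no λ ()

    -- Only a switch has two neighbours of lower rank, and the second one is central.
    Up-unique : ∀ {x y z} → Up x y → Up x z → ¬ Central y → ¬ Central z → y ≡ z
    Up-unique (guard↑ _)     (guard↑ _)     _  _  = refl
    Up-unique (pendant↑ _ _) (pendant↑ _ _) _  _  = refl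
    Up-unique (first↑ _)     (first↑ _)     _  _  = refl
    Up-unique (second↑ _)    (second↑ _)    _  _  = refl
    Up-unique (joint↑ _)     (joint↑ _)     _  _  = refl
    Up-unique (arm₁↑ _)      (arm₁↑ _)      _  _  = refl
    Up-unique (arm₂↑ _)      (arm₂↑ _)      _  _  = refl
    Up-unique (hand₁↑ _)     (hand₁↑ _)     _  _  = refl
    Up-unique (hand₂↑ _)     (hand₂↑ _)     _  _  = refl
    Up-unique (first↑ _)     (second↑ u<)   _  ¬c = contradiction (central (N≤e₂ _ u<) (e₂<h _ u<)) ¬c
    Up-unique (second↑ u<)   (first↑ _)     ¬c _  = contradiction (central (N≤e₂ _ u<) (e₂<h _ u<)) ¬c

    Up⇒¬Central : ∀ {x y} → Up x y → ¬ Central x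
    Up⇒¬Central up (central _ _) = case Up-rank up of λ ()

    centres : Subset order
    centres = tabulate (λ v → does (central? (decoded v)))

    centres-few : ∣ centres ∣ ≤ h ∸ N
    centres-few with support (λ v → does (central? (decoded v)))
    ... | xs , len , unique , members = begin
      ∣ centres ∣                                                 ≡⟨ sym len ⟩
      length xs                                                   ≤⟨ unique-⊆⇒length≤ unique listed ⟩
      length (List.map (λ j → vertex (hub , N + j)) (List.downFrom (h ∸ N))) ≡⟨ trans (List.length-map _ (List.downFrom (h ∸ N))) (List.length-downFrom (h ∸ N)) ⟩
      h ∸ N                                                       ∎
      where
      open ≤-Reasoning
      listed : ∀ {v} → v ∈ xs → v ∈ List.map (λ j → vertex (hub , N + j)) (List.downFrom (h ∸ N))
      listed {v} v∈ = go (holds (central? (decoded v)) (Equivalence.to members v∈)) refl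
        where
        holds : ∀ {P : Set} (d : Dec P) → does d ≡ true → P
        holds (yes p) _ = p
        go : ∀ {x} → Central x → decoded v ≡ x → v ∈ List.map (λ j → vertex (hub , N + j)) (List.downFrom (h ∸ N))
        go (central {w} N≤w w<h) eq = subst (_∈ _) (trans (cong (λ j → vertex (hub , j)) (m+[n∸m]≡n N≤w)) (trans (cong vertex (sym eq)) (vertex-decoded v)))
          (∈-map⁺ (λ j → vertex (hub , N + j)) (∈-downFrom⁺ {h ∸ N} {w ∸ N} (∸-monoˡ-< w<h N≤w)))

    forest : IsForest (deleteVertices graph centres)
    forest = forest-by-rank (deleteVertices graph centres) height-of (λ {x} {y} → ranked {x} {y}) (λ {x} {y} {z} → below-unique {x} {y} {z})
      where
      open SimpleGraph (deleteVertices graph centres) renaming (Adj to _—_)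
      Remaining = Σ (Fin order) λ v → T (not (lookup centres v))
      height-of : Remaining → ℕ
      height-of (v , _) = rank (proj₁ (decoded v))
      noncentral : ∀ (v : Remaining) → ¬ Central (decoded (proj₁ v))
      noncentral (v , t) c = subst (T ∘ not) (trans (Vec.lookup∘tabulate _ v) (dec-true (central? (decoded v)) c)) t
      ranked : ∀ {x y} → x — y → height-of x ≢ height-of y
      ranked {x , _} {y , _} a eq with Adj⇒Joined {x} {y} a
      ... | inj₁ up = m≢1+m+n _ (trans (trans (sym eq) (Up-rank up)) (cong suc (sym (+-identityʳ _))))
      ... | inj₂ up = m≢1+m+n _ (trans (trans eq (Up-rank up)) (cong suc (sym (+-identityʳ _))))
      below : ∀ {x y} → x — y → height-of y < height-of x → Up (decoded (proj₁ x)) (decoded (proj₁ y))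
      below {x , _} {y , _} a lt with Adj⇒Joined {x} {y} a
      ... | inj₁ up = up
      ... | inj₂ up = contradiction (subst (_< _) (Up-rank up) lt) (≤⇒≯ (n≤1+n _))
      below-unique : ∀ {x y z} → x — y → x — z → height-of y < height-of x → height-of z < height-of x → y ≡ z
      below-unique {x} {y} {z} xy xz y< z< = remaining-≡ {X = centres} (trans (sym (vertex-decoded (proj₁ y))) (trans
        (cong vertex (Up-unique (below {x} {y} xy y<) (below {x} {z} xz z<) (noncentral y) (noncentral z))) (vertex-decoded (proj₁ z))))

    feedback-vertex-set-number : ∃[ m ] FeedbackVertexSetNumber graph m × m ≤ h ∸ N
    feedback-vertex-set-number = let (m , min , m≤) = FeedbackVertexSetNumber-exists graph {centres} forest in m , min , ≤-trans m≤ centres-few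

    when : ∀ {P : Set} → Dec P → Vertex → Maybe Vertex
    when (yes _) y = just y
    when (no _)  y = nothing

    when-just : ∀ {P : Set} (d : Dec P) {y z} → when d y ≡ just z → P × y ≡ z
    when-just (yes p) refl = p , refl

    when-yes : ∀ {P : Set} (d : Dec P) {y} → P → when d y ≡ just y
    when-yes (yes _) p = refl
    when-yes (no ¬p) p = contradiction p ¬p

    -- The parent in the forest that remains after deleting the centres

    local : Vertex → Maybe Vertex
    local (hub     , v) = nothing
    local (guard   , m) = when ((m <? guards) ×-dec ¬? (central? (hub , rem m h))) (hub , rem m h)
    local (pendant , m) = when ((m <? pendants) ×-dec (present m Bool.≟ true)) (guard , rem m guards)
    local (switch  , u) = when (u <? k) (hub , e₁ u)
    local (joint   , u) = when (u <? k) (switch , u)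
    local (arm₁    , u) = when (u <? k) (joint , u)
    local (arm₂    , u) = when (u <? k) (joint , u)
    local (hand₁   , u) = when (u <? k) (arm₁ , u)
    local (hand₂   , u) = when (u <? k) (arm₂ , u)

    local-sound : ∀ x {y} → local x ≡ just y → Up x y × ¬ Central y
    local-sound (guard   , m) eq with when-just ((m <? guards) ×-dec ¬? (central? (hub , rem m h))) eq
    ... | (m< , ¬c) , refl = guard↑ m< , ¬c
    local-sound (pendant , m) eq with when-just ((m <? pendants) ×-dec (present m Bool.≟ true)) eq
    ... | (m< , p) , refl = pendant↑ m< p , λ ()
    local-sound (switch  , u) eq with when-just (u <? k) eq
    ... | u< , refl = first↑ u< , λ { (central N≤ _) → <⇒≱ (e₁<N u u<) N≤ }
    local-sound (joint   , u) eq with when-just (u <? k) eq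
    ... | u< , refl = joint↑ u< , λ ()
    local-sound (arm₁    , u) eq with when-just (u <? k) eq
    ... | u< , refl = arm₁↑ u< , λ ()
    local-sound (arm₂    , u) eq with when-just (u <? k) eq
    ... | u< , refl = arm₂↑ u< , λ ()
    local-sound (hand₁   , u) eq with when-just (u <? k) eq
    ... | u< , refl = hand₁↑ u< , λ ()
    local-sound (hand₂   , u) eq with when-just (u <? k) eq
    ... | u< , refl = hand₂↑ u< , λ ()

    local-complete : ∀ {x y} → Up x y → ¬ Central y → local x ≡ just y
    local-complete {guard , m} (guard↑ m<) ¬c = when-yes ((m <? guards) ×-dec ¬? (central? (hub , rem m h))) (m< , ¬c)
    local-complete {pendant , m} (pendant↑ m< p) ¬c = when-yes ((m <? pendants) ×-dec (present m Bool.≟ true)) (m< , p)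
    local-complete (first↑ u<)  ¬c = when-yes (_ <? k) u<
    local-complete (second↑ u<) ¬c = contradiction (central (N≤e₂ _ u<) (e₂<h _ u<)) ¬c
    local-complete (joint↑ u<)  ¬c = when-yes (_ <? k) u<
    local-complete (arm₁↑ u<)   ¬c = when-yes (_ <? k) u<
    local-complete (arm₂↑ u<)   ¬c = when-yes (_ <? k) u<
    local-complete (hand₁↑ u<)  ¬c = when-yes (_ <? k) u<
    local-complete (hand₂↑ u<)  ¬c = when-yes (_ <? k) u<

    -- The number is fuel. With the rank of the vertex it never runs out early, because `local`
    -- lowers the rank by one and hubs, of rank 0, are roots.
    depth : ℕ → Vertex → ℕ
    depth zero    x = 1
    depth (suc n) x with local x
    ... | nothing = 1
    ... | just y  = suc (depth n y)

    localLevel : Vertex → ℕ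
    localLevel x = depth (rank (proj₁ x)) x

    localLevel-root : ∀ x → local x ≡ nothing → localLevel x ≡ 1
    localLevel-root x eq = go (rank (proj₁ x))
      where
      go : ∀ n → depth n x ≡ 1
      go zero = refl
      go (suc n) rewrite eq = refl

    localLevel-child : ∀ x y → local x ≡ just y → localLevel x ≡ suc (localLevel y)
    localLevel-child x y eq rewrite Up-rank (proj₁ (local-sound x eq)) | eq = refl

    localLevel≤5 : ∀ x → localLevel x ≤ 5
    localLevel≤5 x = ≤-trans (go (rank (proj₁ x)) x) (s≤s (rank≤4 (proj₁ x)))
      where
      go : ∀ n x → depth n x ≤ suc n
      go zero    x = ≤-refl
      go (suc n) x with local x
      ... | nothing = s≤s z≤n
      ... | just y  = s≤s (go n y)
      rank≤4 : ∀ κ → rank κ ≤ 4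
      rank≤4 hub     = z≤n
      rank≤4 guard   = s≤s z≤n
      rank≤4 pendant = s≤s (s≤s z≤n)
      rank≤4 switch  = s≤s z≤n
      rank≤4 joint   = s≤s (s≤s z≤n)
      rank≤4 arm₁    = s≤s (s≤s (s≤s z≤n))
      rank≤4 arm₂    = s≤s (s≤s (s≤s z≤n))
      rank≤4 hand₁   = ≤-refl
      rank≤4 hand₂   = ≤-refl

    -- In the elimination forest, the centres form a path from the root
    -- (hub , N) to (hub , pred h), and all other trees hang off its end.

    orLast : Maybe Vertex → Vertex
    orLast (just y) = y
    orLast nothing  = hub , pred h

    above : Vertex → Maybe Vertex
    above x with central? x
    ... | yes (central {v} _ _) = when (N <? v) (hub , pred v)
    ... | no _                  = just (orLast (local x))

    levelOf : Vertex → ℕ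
    levelOf x with central? x
    ... | yes (central {v} _ _) = suc (v ∸ N)
    ... | no _                  = (h ∸ N) + localLevel x

    pred-h<h : pred h < h
    pred-h<h = ≤-reflexive (suc-pred h {{>-nonZero 0<h}})

    N≤pred-h : N ≤ pred h
    N≤pred-h = <⇒≤pred N<h

    suc-pred∸ : ∀ v → N < v → v ∸ N ≡ suc (pred v ∸ N)
    suc-pred∸ (suc v) (s≤s N≤v) = +-∸-assoc 1 N≤v

    levelOf-central : ∀ {v} → N ≤ v → v < h → levelOf (hub , v) ≡ suc (v ∸ N)
    levelOf-central {v} N≤v v<h with central? (hub , v)
    ... | yes (central _ _) = refl
    ... | no ¬c             = contradiction (central N≤v v<h) ¬c

    levelOf-local : ∀ {x} → ¬ Central x → levelOf x ≡ (h ∸ N) + localLevel x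
    levelOf-local {x} ¬c with central? x
    ... | yes c = contradiction c ¬c
    ... | no _  = refl

    above-central : ∀ {v} → N < v → v < h → above (hub , v) ≡ just (hub , pred v)
    above-central {v} N<v v<h with central? (hub , v)
    ... | yes (central _ _) = when-yes (N <? v) N<v
    ... | no ¬c             = contradiction (central (<⇒≤ N<v) v<h) ¬c

    above-local : ∀ {x} → ¬ Central x → above x ≡ just (orLast (local x))
    above-local {x} ¬c with central? x
    ... | yes c = contradiction c ¬c
    ... | no _  = refl

    above-root : ∀ x → above x ≡ nothing → levelOf x ≡ 1
    above-root x eq with central? x
    ... | yes (central {v} N≤v v<h) with N <? v
    ... | no N≮v = cong suc (m≤n⇒m∸n≡0 (≮⇒≥ N≮v))

    above-child : ∀ x y → above x ≡ just y → InRange y × levelOf x ≡ suc (levelOf y)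
    above-child x y eq with central? x
    above-child x y eq | yes (central {v} N≤v v<h) with when-just (N <? v) eq
    ... | N<v , refl = <-≤-trans (≤-<-trans pred[n]≤n v<h) (≤-trans h≤guards guards≤pendants) ,
      cong suc (trans (suc-pred∸ v N<v) (sym (levelOf-central (<⇒≤pred N<v) (≤-<-trans pred[n]≤n v<h))))
    above-child x y eq | no ¬c with local x in leq
    above-child x .(hub , pred h) refl | no ¬c | nothing =
      <-≤-trans pred-h<h (≤-trans h≤guards guards≤pendants) ,
      trans (cong ((h ∸ N) +_) (localLevel-root x leq)) (trans (+-comm (h ∸ N) 1) (cong suc (trans (suc-pred∸ h N<h) (sym (levelOf-central N≤pred-h pred-h<h)))))
    above-child x y refl | no ¬c | just .y = proj₂ (Up-InRange (proj₁ (local-sound x leq))) ,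
      trans (cong ((h ∸ N) +_) (localLevel-child x y leq)) (trans (+-suc (h ∸ N) (localLevel y)) (cong suc (sym (levelOf-local (proj₂ (local-sound x leq))))))

    elimination : RootedForest (Fin order)
    elimination = record
      { parent      = λ v → Maybe.map vertex (above (decoded v))
      ; level       = λ v → levelOf (decoded v)
      ; level-root  = λ v eq → above-root (decoded v) (unmap-nothing (above (decoded v)) eq)
      ; level-child = λ v u eq → child v u eq (unmap-just (above (decoded v)) eq)
      }
      where
      unmap-nothing : ∀ x → Maybe.map vertex x ≡ nothing → x ≡ nothing
      unmap-nothing nothing _ = refl
      unmap-just : ∀ x {u} → Maybe.map vertex x ≡ just u → ∃ λ y → x ≡ just y × vertex y ≡ u
      unmap-just (just y) refl = y , refl , refl
      child : ∀ v u → Maybe.map vertex (above (decoded v)) ≡ just u → (∃ λ y → above (decoded v) ≡ just y × vertex y ≡ u) →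
              levelOf (decoded v) ≡ suc (levelOf (decoded u))
      child v u _ (y , eq , refl) with above-child (decoded v) y eq
      ... | y< , lev = trans lev (cong (suc ∘ levelOf) (sym (decode-vertex y<)))

    parent-above : ∀ {x y} → InRange x → above x ≡ just y → RootedForest.parent elimination (vertex x) ≡ just (vertex y)
    parent-above x< eq = cong (Maybe.map vertex) (trans (cong above (decode-vertex x<)) eq)

    hub-InRange : ∀ {v} → v < h → InRange (hub , v)
    hub-InRange v<h = <-≤-trans v<h (≤-trans h≤guards guards≤pendants)

    central-path : ∀ v w → N ≤ v → v < w → w < h → Ancestor elimination (vertex (hub , v)) (vertex (hub , w))
    central-path v (suc w) N≤v v<w w<h with m≤n⇒m<n∨m≡n (s≤s⁻¹ v<w)
    ... | inj₂ refl = is-parent (parent-above (hub-InRange w<h) (above-central (s≤s N≤v) w<h))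
    ... | inj₁ v<w′ = further (parent-above (hub-InRange w<h) (above-central (s≤s (≤-trans N≤v (<⇒≤ v<w′))) w<h))
                        (central-path v w N≤v v<w′ (<-trans (n<1+n w) w<h))

    -- Climbing along `local` reaches a root of the forest without the centres. Its parent is the
    -- far end of the path of centres, so all of them are ancestors. The rank is fuel for the climb.
    below-centres : ∀ n x {v} → rank (proj₁ x) ≤ n → InRange x → ¬ Central x → N ≤ v → v < h → Ancestor elimination (vertex (hub , v)) (vertex x)
    below-centres n x {v} r≤ x< ¬c N≤v v<h = go n r≤ (local x) refl
      where
      go : ∀ n → rank (proj₁ x) ≤ n → ∀ l → local x ≡ l → Ancestor elimination (vertex (hub , v)) (vertex x)
      go n r≤ nothing eq with m≤n⇒m<n∨m≡n (<⇒≤pred v<h)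
      ... | inj₂ refl = is-parent (parent-above x< (trans (above-local ¬c) (cong (just ∘ orLast) eq)))
      ... | inj₁ v<   = further (parent-above x< (trans (above-local ¬c) (cong (just ∘ orLast) eq))) (central-path v (pred h) N≤v v< pred-h<h)
      go zero r≤ (just y) eq = contradiction (subst (_≤ 0) (Up-rank (proj₁ (local-sound x eq))) r≤) λ ()
      go (suc n) r≤ (just y) eq = further (parent-above x< (trans (above-local ¬c) (cong (just ∘ orLast) eq)))
        (below-centres n y (s≤s⁻¹ (subst (_≤ suc n) (Up-rank up) r≤)) (proj₂ (Up-InRange up)) (proj₂ (local-sound x eq)) N≤v v<h)
        where
        up = proj₁ (local-sound x eq)

    Up⇒Ancestor : ∀ {x y} → Up x y → Ancestor elimination (vertex y) (vertex x)
    Up⇒Ancestor {x} {y} up with central? y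
    ... | yes (central N≤v v<h) = below-centres (rank (proj₁ x)) x ≤-refl (proj₁ (Up-InRange up)) (Up⇒¬Central up) N≤v v<h
    ... | no ¬c = is-parent (parent-above (proj₁ (Up-InRange up)) (trans (above-local (Up⇒¬Central up)) (cong (just ∘ orLast) (local-complete up ¬c))))

    edges-covered : ∀ u v → SimpleGraph.Adj graph u v → Ancestor elimination u v ⊎ Ancestor elimination v u
    edges-covered u v a with Adj⇒Joined {u} {v} a
    ... | inj₁ up = inj₂ (subst₂ (Ancestor elimination) (vertex-decoded v) (vertex-decoded u) (Up⇒Ancestor up))
    ... | inj₂ up = inj₁ (subst₂ (Ancestor elimination) (vertex-decoded u) (vertex-decoded v) (Up⇒Ancestor up))

    levelOf≤ : ∀ x → levelOf x ≤ (h ∸ N) + 5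
    levelOf≤ x with central? x
    ... | yes (central {v} N≤v v<h) = ≤-trans (∸-monoˡ-< v<h N≤v) (m≤m+n (h ∸ N) 5)
    ... | no _                      = +-monoʳ-≤ (h ∸ N) (localLevel≤5 x)

    treedepth : ∃[ m ] Treedepth graph m × m ≤ (h ∸ N) + 5
    treedepth = let (m , min , m≤) = Treedepth-exists graph elimination edges-covered
                in m , min , ≤-trans m≤ (height≤ elimination ((h ∸ N) + 5) (λ v → levelOf≤ (decoded v)))

-- Systems of membership constraints on few linear forms, as hub graphs.
-- Item Z * i + m has one switch per slot, and as many of them go to the
-- hub of row j as the coefficient of variable i says (the remaining slots
-- go to the dummy hub items + R).  The value of variable i is the number of
-- items m < limit i that are switched on.

module SystemGraph (V Z R : ℕ) (coef : ℕ → ℕ → ℕ) (limit : ℕ → ℕ) (admits : ℕ → ℕ → Bool) where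

  width slots items switches hubs : ℕ
  -- Each row needs as many slots of an item as its largest coefficient. The sum of all coefficients
  -- is a crude bound that a term can compute; `suc` keeps `slots` positive.
  width    = suc (∑ R λ j → ∑ V λ i → coef j i)
  slots    = R * width
  items    = V * Z
  switches = items * slots
  hubs     = items + suc R

  contribution : ℕ → ℕ → ℕ
  contribution t j = if rem t Z <ᵇ limit (quot t Z) then coef j (quot t Z) else 0

  row : ℕ → ℕ → ℕ
  row t s = if rem s width <ᵇ contribution t (quot s width) then quot s width else R

  itemEnd rowEnd : ℕ → ℕ
  itemEnd u = quot u slots
  rowEnd u  = items + row (quot u slots) (rem u slots)

  allows : ℕ → ℕ → Bool
  -- All or nothing: the hub of an item keeps no slot if the item is on and every slot if it is off.
  allows v y = if v <ᵇ items then (y ≡ᵇ 0) ∨ (y ≡ᵇ slots)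
               else (if v <ᵇ items + R then admits (v ∸ items) y else true)

  Solution : (ℕ → ℕ) → Set
  Solution z = (∀ i → i < V → z i ≤ limit i) × (∀ j → j < R → admits j (∑ V λ i → coef j i * z i) ≡ true)

private
  ∑-𝟙-complement : ∀ n (p : ℕ → Bool) → ∑ n (λ i → 𝟙 (p i)) + ∑ n (λ i → 𝟙 (not (p i))) ≡ n
  ∑-𝟙-complement n p = trans (sym (∑-+ n (λ i → 𝟙 (p i)) (λ i → 𝟙 (not (p i)))))
    (trans (∑-cong n λ i _ → one (p i)) (trans (∑-const n 1) (*-identityʳ n)))
    where
    one : ∀ b → 𝟙 b + 𝟙 (not b) ≡ 1
    one true  = refl
    one false = refl

  𝟙≡0 : ∀ {b} → 𝟙 b ≡ 0 → b ≡ false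
  𝟙≡0 {false} _ = refl

  ∑-𝟙-none : ∀ n (p : ℕ → Bool) → ∑ n (λ i → 𝟙 (p i)) ≡ 0 → ∀ i → i < n → p i ≡ false
  ∑-𝟙-none n p eq i i<n = 𝟙≡0 (∑-zero⁻ n eq i i<n)

  ∑-𝟙-all : ∀ n (p : ℕ → Bool) → ∑ n (λ i → 𝟙 (p i)) ≡ n → ∀ i → i < n → p i ≡ true
  ∑-𝟙-all n p eq i i<n = not-false (∑-𝟙-none n (not ∘ p) rest i i<n)
    where
    rest : ∑ n (λ i → 𝟙 (not (p i))) ≡ 0
    rest = +-cancelˡ-≡ n _ _ (trans (cong (_+ ∑ n (λ i → 𝟙 (not (p i)))) (sym eq)) (trans (∑-𝟙-complement n p) (sym (+-identityʳ n))))
    not-false : ∀ {b} → not b ≡ false → b ≡ true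
    not-false {true} _ = refl

module SystemProperties (V Z R : ℕ) (coef : ℕ → ℕ → ℕ) (limit : ℕ → ℕ) (admits : ℕ → ℕ → Bool)
                        (0<V : 0 < V) (2≤Z : 2 ≤ Z) (0<R : 0 < R) (limit≤Z : ∀ i → i < V → limit i ≤ Z) where

  open SystemGraph V Z R coef limit admits public

  0<slots : 0 < slots
  0<slots = *-mono-≤ 0<R (s≤s {0} z≤n)

  2≤items : 2 ≤ items
  2≤items = *-mono-≤ 0<V 2≤Z

  2≤switches : 2 ≤ switches
  2≤switches = *-mono-≤ 2≤items 0<slots

  itemEnd<items : ∀ u → u < switches → itemEnd u < items
  itemEnd<items u u< = quot< items slots u<

  row≤R : ∀ t s → s < slots → row t s ≤ R
  row≤R t s s< with rem s width <ᵇ contribution t (quot s width)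
  ... | true  = <⇒≤ (quot< R width s<)
  ... | false = ≤-refl

  items≤rowEnd : ∀ u → u < switches → items ≤ rowEnd u
  items≤rowEnd u _ = m≤m+n items _

  itemEnd<hubs : ∀ u → u < switches → itemEnd u < hubs
  itemEnd<hubs u u< = <-≤-trans (itemEnd<items u u<) (m≤m+n items (suc R))

  rowEnd<hubs : ∀ u → u < switches → rowEnd u < hubs
  rowEnd<hubs u u< = +-monoʳ-< items (s≤s (row≤R (quot u slots) (rem u slots) (rem< u 0<slots)))

  ends-differ : ∀ u → u < switches → itemEnd u ≢ rowEnd u
  ends-differ u u< eq = <⇒≱ (itemEnd<items u u<) (≤-trans (items≤rowEnd u u<) (≤-reflexive (sym eq)))

  open HubEdges hubs switches itemEnd rowEnd allows using (kept)

  Uniform : (ℕ → Bool) → (ℕ → Bool) → Set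
  Uniform σ on = ∀ t s → t < items → s < slots → σ (slots * t + s) ≡ on t

  value : (ℕ → Bool) → ℕ → ℕ
  value on i = ∑ Z λ m → 𝟙 (on (Z * i + m)) * 𝟙 (m <ᵇ limit i)

  value≤limit : ∀ on i → i < V → value on i ≤ limit i
  value≤limit on i i<V = ≤-trans
    (∑-mono Z λ m _ → ≤-trans (*-monoˡ-≤ _ (𝟙≤1 (on (Z * i + m)))) (≤-reflexive (*-identityˡ _)))
    (≤-reflexive (∑-threshold Z (limit i) (limit≤Z i i<V)))

  kept-at-item : ∀ σ t → t < items → kept σ t ≡ ∑ slots λ s → 𝟙 (not (σ (slots * t + s)))
  kept-at-item σ t t< = begin
      kept σ t
    ≡⟨ ∑-cong switches (λ u u< → cong (λ b → 𝟙 (((itemEnd u ≡ᵇ t) ∧ not (σ u)) ∨ (b ∧ σ u))) (≡ᵇ-false (>⇒≢ (<-≤-trans t< (items≤rowEnd u u<))))) ⟩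
      ∑ switches (λ u → 𝟙 (((quot u slots ≡ᵇ t) ∧ not (σ u)) ∨ false))
    ≡⟨ ∑-blocks items slots _ ⟩
      ∑ items (λ t′ → ∑ slots λ s → 𝟙 (((quot (slots * t′ + s) slots ≡ᵇ t) ∧ not (σ (slots * t′ + s))) ∨ false))
    ≡⟨ ∑-cong items (λ t′ _ → trans (∑-cong slots λ s s< → entry t′ s s<) (∑-*ˡ slots (𝟙 (t′ ≡ᵇ t)) _)) ⟩
      ∑ items (λ t′ → 𝟙 (t′ ≡ᵇ t) * ∑ slots λ s → 𝟙 (not (σ (slots * t′ + s))))
    ≡⟨ ∑-single items _ t t< ⟩
      ∑ slots (λ s → 𝟙 (not (σ (slots * t + s))))
    ∎
    where
    open ≡-Reasoning
    entry : ∀ t′ s → s < slots → 𝟙 (((quot (slots * t′ + s) slots ≡ᵇ t) ∧ not (σ (slots * t′ + s))) ∨ false)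
                               ≡ 𝟙 (t′ ≡ᵇ t) * 𝟙 (not (σ (slots * t′ + s)))
    entry t′ s s< = trans (cong 𝟙 (Bool.∨-identityʳ _))
      (trans (cong (λ q → 𝟙 ((q ≡ᵇ t) ∧ not (σ (slots * t′ + s)))) (quot-unique slots t′ s<)) (𝟙-∧ (t′ ≡ᵇ t) _))

  contribution<width : ∀ t j → t < items → j < R → contribution t j ≤ width
  contribution<width t j t< j< with rem t Z <ᵇ limit (quot t Z)
  ... | false = z≤n
  ... | true  = m≤n⇒m≤1+n (≤-trans (term≤∑ V (coef j) (quot< V Z t<)) (term≤∑ R (λ j → ∑ V (coef j)) j<))

  slots-of-row : ∀ t j → t < items → j < R → ∑ slots (λ s → 𝟙 (row t s ≡ᵇ j)) ≡ contribution t j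
  slots-of-row t j t< j< = begin
      ∑ slots (λ s → 𝟙 (row t s ≡ᵇ j))
    ≡⟨ ∑-quot-rem R width (λ j′ l → 𝟙 ((if l <ᵇ contribution t j′ then j′ else R) ≡ᵇ j)) ⟩
      ∑ R (λ j′ → ∑ width λ l → 𝟙 ((if l <ᵇ contribution t j′ then j′ else R) ≡ᵇ j))
    ≡⟨ ∑-cong R (λ j′ j′< → trans (∑-cong width λ l _ → entry j′ l) (trans (∑-*ˡ width (𝟙 (j′ ≡ᵇ j)) _)
         (cong (𝟙 (j′ ≡ᵇ j) *_) (∑-threshold width (contribution t j′) (contribution<width t j′ t< j′<))))) ⟩
      ∑ R (λ j′ → 𝟙 (j′ ≡ᵇ j) * contribution t j′)
    ≡⟨ ∑-single R (contribution t) j j< ⟩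
      contribution t j
    ∎
    where
    open ≡-Reasoning
    entry : ∀ j′ l → 𝟙 ((if l <ᵇ contribution t j′ then j′ else R) ≡ᵇ j) ≡ 𝟙 (j′ ≡ᵇ j) * 𝟙 (l <ᵇ contribution t j′)
    entry j′ l with l <ᵇ contribution t j′
    ... | true  = sym (*-identityʳ _)
    ... | false = trans (cong 𝟙 (≡ᵇ-false (>⇒≢ j<))) (sym (*-zeroʳ (𝟙 (j′ ≡ᵇ j))))

  -- Every item that is on sends to row `j` as many edges as its contribution says. Grouping the
  -- items by variables leaves the coefficient times the number of items below the limit that are
  -- on.
  kept-at-row : ∀ {σ on} → Uniform σ on → ∀ j → j < R → kept σ (items + j) ≡ ∑ V λ i → coef j i * value on i
  kept-at-row {σ} {on} uniform j j< = begin
      kept σ (items + j)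
    ≡⟨ ∑-cong switches (λ u u< → cong (λ b → 𝟙 ((b ∧ not (σ u)) ∨ ((rowEnd u ≡ᵇ items + j) ∧ σ u))) (≡ᵇ-false (<⇒≢ (<-≤-trans (itemEnd<items u u<) (m≤m+n items j))))) ⟩
      ∑ switches (λ u → 𝟙 ((items + row (quot u slots) (rem u slots) ≡ᵇ items + j) ∧ σ u))
    ≡⟨ ∑-blocks items slots _ ⟩
      ∑ items (λ t → ∑ slots λ s → 𝟙 ((items + row (quot (slots * t + s) slots) (rem (slots * t + s) slots) ≡ᵇ items + j) ∧ σ (slots * t + s)))
    ≡⟨ ∑-cong items (λ t t< → trans (∑-cong slots λ s s< → entry t s t< s<) (trans (∑-*ˡ slots (𝟙 (on t)) _) (cong (𝟙 (on t) *_) (slots-of-row t j t< j<)))) ⟩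
      ∑ items (λ t → 𝟙 (on t) * contribution t j)
    ≡⟨ ∑-blocks V Z _ ⟩
      ∑ V (λ i → ∑ Z λ m → 𝟙 (on (Z * i + m)) * contribution (Z * i + m) j)
    ≡⟨ ∑-cong V (λ i _ → trans (∑-cong Z λ m m< → term i m m<) (∑-*ˡ Z (coef j i) _)) ⟩
      ∑ V (λ i → coef j i * value on i)
    ∎
    where
    open ≡-Reasoning
    shift : ∀ a b → (items + a ≡ᵇ items + b) ≡ (a ≡ᵇ b)
    shift a b with a ≟ b
    ... | yes refl = trans (≡ᵇ-true {items + a} refl) (sym (≡ᵇ-true {a} refl))
    ... | no  a≢b  = trans (≡ᵇ-false (a≢b ∘ +-cancelˡ-≡ items a b)) (sym (≡ᵇ-false a≢b))
    entry : ∀ t s → t < items → s < slots →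
            𝟙 ((items + row (quot (slots * t + s) slots) (rem (slots * t + s) slots) ≡ᵇ items + j) ∧ σ (slots * t + s)) ≡ 𝟙 (on t) * 𝟙 (row t s ≡ᵇ j)
    entry t s t< s< = trans (cong₂ (λ q r → 𝟙 ((items + row q r ≡ᵇ items + j) ∧ σ (slots * t + s))) (quot-unique slots t s<) (rem-unique slots t s<))
      (trans (cong₂ (λ a b → 𝟙 (a ∧ b)) (shift (row t s) j) (uniform t s t< s<)) (trans (𝟙-∧ (row t s ≡ᵇ j) (on t)) (*-comm (𝟙 (row t s ≡ᵇ j)) _)))
    term : ∀ i m → m < Z → 𝟙 (on (Z * i + m)) * contribution (Z * i + m) j ≡ coef j i * (𝟙 (on (Z * i + m)) * 𝟙 (m <ᵇ limit i))
    term i m m< = trans (cong₂ (λ q r → 𝟙 (on (Z * i + m)) * (if r <ᵇ limit q then coef j q else 0)) (quot-unique Z i m<) (rem-unique Z i m<))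
      (trans (cong (𝟙 (on (Z * i + m)) *_) (if-𝟙 (m <ᵇ limit i) (coef j i))) (arith (𝟙 (on (Z * i + m))) (𝟙 (m <ᵇ limit i)) (coef j i)))
      where
      if-𝟙 : ∀ b c → (if b then c else 0) ≡ 𝟙 b * c
      if-𝟙 true  c = sym (+-identityʳ c)
      if-𝟙 false c = refl
      arith : ∀ a b c → a * (b * c) ≡ c * (a * b)
      arith = solve-∀

  allows-row : ∀ j y → j < R → allows (items + j) y ≡ admits j y
  allows-row j y j< rewrite <ᵇ-false (m≤m+n items j) | <ᵇ-true (+-monoʳ-< items j<) | m+n∸m≡n items j = refl

  allows-item : ∀ t y → t < items → allows t y ≡ (y ≡ᵇ 0) ∨ (y ≡ᵇ slots)
  allows-item t y t< rewrite <ᵇ-true t< = refl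

  allows-dummy : ∀ y → allows (items + R) y ≡ true
  allows-dummy y rewrite <ᵇ-false (m≤m+n items R) | <ᵇ-false {items + R} ≤-refl = refl

  solution⇒allowed : ∃ Solution → ∃[ σ ] ∀ v → v < hubs → allows v (kept σ v) ≡ true
  solution⇒allowed (z , z≤ , ok) = (λ u → on (quot u slots)) , holds
    where
    on : ℕ → Bool
    -- Unary representation: the first `z i` of the `Z` items of variable `i` are on.
    on t = rem t Z <ᵇ z (quot t Z)
    σ : ℕ → Bool
    σ u = on (quot u slots)
    uniform : Uniform σ on
    uniform t s t< s< = cong on (quot-unique slots t s<)
    value-z : ∀ i → i < V → value on i ≡ z i
    value-z i i< = trans (∑-cong Z λ m m< → entry m m<) (∑-threshold Z (z i) (≤-trans (z≤ i i<) (limit≤Z i i<)))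
      where
      entry : ∀ m → m < Z → 𝟙 (on (Z * i + m)) * 𝟙 (m <ᵇ limit i) ≡ 𝟙 (m <ᵇ z i)
      entry m m< rewrite quot-unique Z i m< | rem-unique Z i m< with m <? z i
      ... | yes m<z rewrite <ᵇ-true m<z | <ᵇ-true (<-≤-trans m<z (z≤ i i<)) = refl
      ... | no  m≮z rewrite <ᵇ-false (≮⇒≥ m≮z) = refl
    at-item : ∀ t → t < items → allows t (kept σ t) ≡ true
    at-item t t< = trans (allows-item t (kept σ t) t<) (trans (cong (λ y → (y ≡ᵇ 0) ∨ (y ≡ᵇ slots)) size) (either (on t)))
      where
      size : kept σ t ≡ slots * 𝟙 (not (on t))
      size = trans (kept-at-item σ t t<) (trans (∑-cong slots λ s s< → cong (𝟙 ∘ not) (uniform t s t< s<)) (∑-const slots _))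
      either : ∀ b → (slots * 𝟙 (not b) ≡ᵇ 0) ∨ (slots * 𝟙 (not b) ≡ᵇ slots) ≡ true
      either true  = cong (_∨ (slots * 0 ≡ᵇ slots)) (≡ᵇ-true (*-zeroʳ slots))
      either false = ∨-trueʳ (slots * 1 ≡ᵇ 0) (≡ᵇ-true (*-identityʳ slots))
    at-row : ∀ j → j < R → allows (items + j) (kept σ (items + j)) ≡ true
    at-row j j< = trans (allows-row j (kept σ (items + j)) j<) (trans (cong (admits j) (trans (kept-at-row uniform j j<) (∑-cong V λ i i< → cong (coef j i *_) (value-z i i<)))) (ok j j<))
    holds : ∀ v → v < hubs → allows v (kept σ v) ≡ true
    holds v v< with v <? items
    ... | yes v<items = at-item v v<items
    ... | no  v≮items = subst (λ v → allows v (kept σ v) ≡ true) (m+[n∸m]≡n (≮⇒≥ v≮items)) (beyond (v ∸ items)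
          (+-cancelˡ-≤ items _ _ (≤-trans (≤-reflexive (m+[n∸m]≡n (≮⇒≥ v≮items))) (s≤s⁻¹ (≤-trans v< (≤-reflexive (+-suc items R)))))))
      where
      beyond : ∀ j → j ≤ R → allows (items + j) (kept σ (items + j)) ≡ true
      beyond j j≤ with m≤n⇒m<n∨m≡n j≤
      ... | inj₁ j<   = at-row j j<
      ... | inj₂ refl = allows-dummy (kept σ (items + R))

  -- The hubs of the items force the slots of each item to agree, so slot 0 tells whether the item
  -- is on. The rows then receive the values of the linear forms.
  allowed⇒solution : (∃[ σ ] ∀ v → v < hubs → allows v (kept σ v) ≡ true) → ∃ Solution
  allowed⇒solution (σ , ok) = value on , value≤limit on , λ j j< →
    trans (cong (admits j) (sym (kept-at-row uniform j j<)))
      (trans (sym (allows-row j (kept σ (items + j)) j<)) (ok (items + j) (+-monoʳ-< items (m<n⇒m<1+n j<))))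
    where
    on : ℕ → Bool
    on t = σ (slots * t + 0)
    uniform : Uniform σ on
    uniform t s t< s< with ∨-true⁻ {kept σ t ≡ᵇ 0} (trans (sym (allows-item t (kept σ t) t<)) (ok t (<-≤-trans t< (m≤m+n items (suc R)))))
    ... | inj₁ none = trans (same s s<) (sym (same 0 0<slots))
      where
      same : ∀ s → s < slots → σ (slots * t + s) ≡ true
      same s s< = not-false (∑-𝟙-none slots (λ s → not (σ (slots * t + s))) (trans (sym (kept-at-item σ t t<)) (≡ᵇ-true⁻ (kept σ t) 0 none)) s s<)
        where
        not-false : ∀ {b} → not b ≡ false → b ≡ true
        not-false {true} _ = refl
    ... | inj₂ all = trans (same s s<) (sym (same 0 0<slots))
      where
      same : ∀ s → s < slots → σ (slots * t + s) ≡ false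
      same s s< = not-true (∑-𝟙-all slots (λ s → not (σ (slots * t + s))) (trans (sym (kept-at-item σ t t<)) (≡ᵇ-true⁻ (kept σ t) slots all)) s s<)
        where
        not-true : ∀ {b} → not b ≡ true → b ≡ false
        not-true {false} _ = refl

module SystemIrregulators (V Z R : ℕ) (coef : ℕ → ℕ → ℕ) (limit : ℕ → ℕ) (admits : ℕ → ℕ → Bool)
                          (0<V : 0 < V) (2≤Z : 2 ≤ Z) (0<R : 0 < R) (limit≤Z : ∀ i → i < V → limit i ≤ Z) where

  private
    module P = SystemProperties V Z R coef limit admits 0<V 2≤Z 0<R limit≤Z
    module H = HubGraph P.hubs P.switches P.itemEnd P.rowEnd P.allows P.2≤switches P.itemEnd<hubs P.rowEnd<hubs P.ends-differ
    module S = H.Structure P.items (m<m+n P.items z<s) P.itemEnd<items P.items≤rowEnd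

  solution⇔irregulator : ∃ P.Solution ⇔ (∃[ m ] Iₑ H.graph m × m ≤ P.switches)
  solution⇔irregulator = mk⇔ (Equivalence.from H.small-irregulator⇔ ∘ P.solution⇒allowed) (P.allowed⇒solution ∘ Equivalence.to H.small-irregulator⇔)

  -- The centres are `R` hubs of rows and the dummy hub. For the treedepth, 5 levels of the forest
  -- below them are added; the sum serves for both parameters.
  Bounded : GraphParameter → Set
  Bounded π = ∃[ m ] π H.graph m × m ≤ 6 + R

  central-hubs : P.hubs ∸ P.items ≡ 1 + R
  central-hubs = m+n∸m≡n P.items (suc R)

  feedback-vertex-set-bounded : Bounded FeedbackVertexSetNumber
  feedback-vertex-set-bounded = let (m , is-m , m≤) = S.feedback-vertex-set-number
    in m , is-m , ≤-trans m≤ (≤-trans (≤-reflexive central-hubs) (+-monoˡ-≤ R (m≤m+n 1 5)))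

  treedepth-bounded : Bounded Treedepth
  treedepth-bounded = let (m , is-m , m≤) = S.treedepth
    in m , is-m , ≤-trans m≤ (≤-reflexive (trans (cong (_+ 5) central-hubs) (cong suc (+-comm R 5))))

-- Congruence modulo a number

infix 4 _≈[_]_

-- Multiples of `M` are added on both sides, which avoids subtraction and gives closure under the
-- operations by polynomial identities.
record _≈[_]_ (x M y : ℕ) : Set where
  constructor cong-mod
  field
    a b      : ℕ
    equation : x + M * a ≡ y + M * b

≈-reflexive : ∀ {M x y} → x ≡ y → x ≈[ M ] y
≈-reflexive refl = cong-mod 0 0 refl

≈-trans : ∀ {M x y z} → x ≈[ M ] y → y ≈[ M ] z → x ≈[ M ] z
≈-trans {M} {x} {y} {z} (cong-mod a b p) (cong-mod c d q) = cong-mod (a + c) (d + b) (begin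
  x + M * (a + c)       ≡⟨ lem₁ x M a c ⟩
  (x + M * a) + M * c   ≡⟨ cong (_+ M * c) p ⟩
  (y + M * b) + M * c   ≡⟨ lem₂ y M b c ⟩
  (y + M * c) + M * b   ≡⟨ cong (_+ M * b) q ⟩
  (z + M * d) + M * b   ≡⟨ sym (lem₁ z M d b) ⟩
  z + M * (d + b)       ∎)
  where
  open ≡-Reasoning
  lem₁ : ∀ x M a c → x + M * (a + c) ≡ (x + M * a) + M * c
  lem₁ = solve-∀
  lem₂ : ∀ y M b c → (y + M * b) + M * c ≡ (y + M * c) + M * b
  lem₂ = solve-∀

≈-+ : ∀ {M x y x′ y′} → x ≈[ M ] y → x′ ≈[ M ] y′ → x + x′ ≈[ M ] y + y′
≈-+ {M} {x} {y} {x′} {y′} (cong-mod a b p) (cong-mod c d q) = cong-mod (a + c) (b + d)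
  (trans (lem x x′ M a c) (trans (cong₂ _+_ p q) (sym (lem y y′ M b d))))
  where
  lem : ∀ x x′ M a c → (x + x′) + M * (a + c) ≡ (x + M * a) + (x′ + M * c)
  lem = solve-∀

≈-* : ∀ {M x y x′ y′} → x ≈[ M ] y → x′ ≈[ M ] y′ → x * x′ ≈[ M ] y * y′
≈-* {M} {x} {y} {x′} {y′} (cong-mod a b p) (cong-mod c d q) = cong-mod (a * x′ + c * x + M * (a * c)) (b * y′ + d * y + M * (b * d))
  (trans (lem x x′ M a c) (trans (cong₂ _*_ p q) (sym (lem y y′ M b d))))
  where
  lem : ∀ x x′ M a c → x * x′ + M * (a * x′ + c * x + M * (a * c)) ≡ (x + M * a) * (x′ + M * c)
  lem = solve-∀

≈-∑ : ∀ {M} n {f g} → (∀ i → i < n → f i ≈[ M ] g i) → ∑ n f ≈[ M ] ∑ n g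
≈-∑ zero    eq = ≈-reflexive refl
≈-∑ (suc n) eq = ≈-+ (eq n (n<1+n n)) (≈-∑ n λ i i<n → eq i (m<n⇒m<1+n i<n))

≈-rem : ∀ {M} x → 0 < M → rem x M ≈[ M ] x
≈-rem {M} x 0<M = cong-mod (quot x M) 0
  (trans (+-comm (rem x M) _) (trans (sym (quot-rem x 0<M)) (sym (trans (cong (x +_) (*-zeroʳ M)) (+-identityʳ x)))))

rem-≈ : ∀ {M x p} → p < M → x ≈[ M ] p → rem x M ≡ p
rem-≈ {M} {x} {p} p<M x≈p with ≈-trans (≈-rem x (≤-<-trans z≤n p<M)) x≈p
... | cong-mod a b eq = proj₂ (pair-injective M (rem< x (≤-<-trans z≤n p<M)) p<M (trans (+-comm (M * a) _) (trans eq (+-comm p _))))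

-- M ∸ 1 plays the role of - 1.

≈-not : ∀ {M} b → 0 < M → 1 + (M ∸ 1) * 𝟙 b ≈[ M ] 𝟙 (not b)
≈-not {suc M} true  _ = cong-mod 0 1 (lem M)
  where
  lem : ∀ M → (1 + M * 1) + suc M * 0 ≡ 0 + suc M * 1
  lem = solve-∀
≈-not {suc M} false _ = ≈-reflexive (cong suc (*-zeroʳ M))

≈-or : ∀ {M} a b → 0 < M → (𝟙 a + 𝟙 b) + (M ∸ 1) * (𝟙 a * 𝟙 b) ≈[ M ] 𝟙 (a ∨ b)
≈-or {suc M} true  true  _ = cong-mod 0 1 (lem M)
  where
  lem : ∀ M → 2 + M * 1 + suc M * 0 ≡ 1 + suc M * 1
  lem = solve-∀
≈-or {suc M} true  false _ = ≈-reflexive (cong suc (*-zeroʳ M))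
≈-or {suc M} false true  _ = ≈-reflexive (cong suc (*-zeroʳ M))
≈-or {suc M} false false _ = ≈-reflexive (*-zeroʳ M)

-- A node of a circuit is denoted by its age, the number of older nodes.
-- Level-e codes are tuples of 2 ^ e digits: codes below radix e of indices
-- of selectors (digit k stands for no selector), and codes below span e of
-- the inputs they select.  A node of depth at most e is a multilinear
-- polynomial of degree at most 2 ^ e in the inputs, and tensor e gives its
-- coefficients modulo M; the value of the node is obtained by summing over
-- all tuples of selectors.

module CircuitForms (n k size : ℕ) (negation conjunction : ℕ → Bool) (input : ℕ → ℕ → Bool) where

  radix span base : ℕ → ℕ
  radix zero    = suc k
  radix (suc e) = radix e * radix e
  span zero     = n
  span (suc e)  = span e * span e
  -- More than 1 and more than the number of inputs of any gate. The base is squared at each level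
  -- to make room for a pair of numbers.
  base zero     = 2 + size
  base (suc e)  = base e * base e

  -- The constant 1 as a form: only the tuple whose digits are all `k` contributes, so the total is
  -- 1. Multiplication by it pads a form to the next level.
  unit : ℕ → ℕ → ℕ
  unit zero    J = 𝟙 (J ≡ᵇ k)
  unit (suc e) J = unit e (rem J (radix e)) * unit e (quot J (radix e))

  among : ℕ → (ℕ → ℕ) → ℕ
  among v f = ∑ v λ c → 𝟙 (input v c) * f c

  -- For a gate with exactly two inputs a single term survives (`marks-two`). So the two inputs can
  -- be addressed without being searched for.
  pairs : ℕ → (ℕ → ℕ → ℕ) → ℕ
  pairs v f = ∑ v λ x → ∑ x λ y → (𝟙 (input v x) * 𝟙 (input v y)) * f x y

  fan : ℕ → ℕ
  fan v = ∑ v λ c → 𝟙 (input v c)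

  -- At level 0 the total counts the selectors that choose input `v`, which is the value of that
  -- input. A product of two forms places their tuples side by side, as the low and the high half of
  -- the digits, so the length of tuples doubles with each level. Negation is 1 - x and disjunction
  -- x + y - xy.
  tensor : ℕ → ℕ → ℕ → ℕ → ℕ → ℕ
  tensor M zero    v J b = 𝟙 (J <ᵇ k) * 𝟙 (b ≡ᵇ v)
  tensor M (suc e) v J b =
    if v <ᵇ n then tensor M e v (rem J (radix e)) (rem b (span e)) * unit e (quot J (radix e)) else
    (if negation v then (unit e (rem J (radix e)) + (M ∸ 1) * among v (λ c → tensor M e c (rem J (radix e)) (rem b (span e)))) * unit e (quot J (radix e)) else
    (if conjunction v then pairs v (λ x y → tensor M e x (rem J (radix e)) (rem b (span e)) * tensor M e y (quot J (radix e)) (quot b (span e))) else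
      pairs v (λ x y → (tensor M e x (rem J (radix e)) (rem b (span e)) * unit e (quot J (radix e)) + unit e (rem J (radix e)) * tensor M e y (quot J (radix e)) (quot b (span e)))
                       + (M ∸ 1) * (tensor M e x (rem J (radix e)) (rem b (span e)) * tensor M e y (quot J (radix e)) (quot b (span e))))))

  -- Nodes of weft 1: a large gate is represented by the number of its true
  -- inputs, a small gate by the pair of the representations of its inputs.

  packed packedStep : ℕ → ℕ → ℕ → ℕ → ℕ → ℕ
  packed M zero    v J b = tensor M zero v J b
  packed M (suc e) v J b = packedStep M e v (rem J (radix e)) (rem b (span e)) * unit e (quot J (radix e))
  packedStep M e v J b =
    if v <ᵇ n then packed M e v J b else
    (if negation v then among v (λ c → packed M e c J b) else
    -- In a circuit of weft 1 the inputs of a large gate have weft 0, so `tensor` gives their values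
    -- and the sum is the number of true inputs.
    (if 2 <ᵇ fan v then among v (λ c → tensor M e c J b) else
      -- Pairing in base `base e` is linear in both numbers and so commutes with the sum over
      -- tuples. The Boolean operation itself is postponed to `unpacked`.
      pairs v (λ x y → base e * packed M e y J b + packed M e x J b)))

  unpacked : ℕ → ℕ → ℕ → Bool
  unpacked zero    v p = 0 <ᵇ p
  unpacked (suc e) v p =
    if v <ᵇ n then 0 <ᵇ p else
    (if negation v then 0 <ᵇ among v (λ c → 𝟙 (not (unpacked e c p))) else
    (if 2 <ᵇ fan v then (if conjunction v then p ≡ᵇ fan v else 0 <ᵇ p) else
      0 <ᵇ pairs v (λ x y → 𝟙 (if conjunction v then unpacked e x (rem p (base e)) ∧ unpacked e y (quot p (base e))
                                                else unpacked e x (rem p (base e)) ∨ unpacked e y (quot p (base e))))))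

  selection : (ℕ → ℕ) → ℕ → ℕ → ℕ
  -- For the digit `k`, no selector, input 0 is a default; at level 0 `tensor` vanishes there, so
  -- the default contributes nothing.
  selection a zero    J = if J <ᵇ k then a J else 0
  selection a (suc e) J = span e * selection a e (quot J (radix e)) + selection a e (rem J (radix e))

module SelectionSums (n k size : ℕ) (negation conjunction : ℕ → Bool) (input : ℕ → ℕ → Bool)
                     (0<n : 0 < n) (a : ℕ → ℕ) (a<n : ∀ i → i < k → a i < n) where

  open CircuitForms n k size negation conjunction input public

  selection< : ∀ e J → selection a e J < span e
  selection< zero J with J <? k
  ... | yes J<k rewrite <ᵇ-true J<k = a<n J J<k
  ... | no  J≮k rewrite <ᵇ-false (≮⇒≥ J≮k) = 0<n
  selection< (suc e) J = pair< (selection< e _) (selection< e _)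

  total : ℕ → (ℕ → ℕ → ℕ) → ℕ
  total e f = ∑ (radix e) λ J → f J (selection a e J)

  -- A tuple of level `suc e` is a pair of tuples of level `e`, and its selection is the pair of
  -- their selections. Hence totals turn products of forms in separate halves into products of
  -- totals.
  total-product : ∀ e (f : ℕ → ℕ → ℕ → ℕ → ℕ) →
    total (suc e) (λ J b → f (rem J (radix e)) (rem b (span e)) (quot J (radix e)) (quot b (span e)))
    ≡ total e (λ J₂ b₂ → total e (λ J₁ b₁ → f J₁ b₁ J₂ b₂))
  total-product e f = trans
    (∑-cong (radix e * radix e) λ J _ → cong₂ (λ b₁ b₂ → f (rem J (radix e)) b₁ (quot J (radix e)) b₂)
      (rem-unique (span e) (selection a e (quot J (radix e))) (selection< e (rem J (radix e)))) (quot-unique (span e) (selection a e (quot J (radix e))) (selection< e (rem J (radix e)))))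
    (∑-quot-rem (radix e) (radix e) (λ J₂ J₁ → f J₁ (selection a e J₁) J₂ (selection a e J₂)))

  total-* : ∀ e (f g : ℕ → ℕ → ℕ) → total e (λ J₂ b₂ → total e (λ J₁ b₁ → f J₁ b₁ * g J₂ b₂)) ≡ total e f * total e g
  total-* e f g = trans (∑-cong (radix e) λ J₂ _ → ∑-*ʳ (radix e) (g J₂ (selection a e J₂)) (λ J₁ → f J₁ (selection a e J₁)))
    (∑-*ˡ (radix e) (total e f) (λ J₂ → g J₂ (selection a e J₂)))

  total-+ : ∀ e (f g : ℕ → ℕ → ℕ) → total e (λ J b → f J b + g J b) ≡ total e f + total e g
  total-+ e f g = ∑-+ (radix e) (λ J → f J (selection a e J)) (λ J → g J (selection a e J))

  total-*ˡ : ∀ e c (f : ℕ → ℕ → ℕ) → total e (λ J b → c * f J b) ≡ c * total e f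
  total-*ˡ e c f = ∑-*ˡ (radix e) c (λ J → f J (selection a e J))

  total-cong : ∀ e {f g : ℕ → ℕ → ℕ} → (∀ J b → f J b ≡ g J b) → total e f ≡ total e g
  total-cong e eq = ∑-cong (radix e) λ J _ → eq J (selection a e J)

  total-among : ∀ e v (f : ℕ → ℕ → ℕ → ℕ) → total e (λ J b → among v (λ c → f c J b)) ≡ among v (λ c → total e (f c))
  total-among e v f = trans (∑-swap (radix e) v _) (∑-cong v λ c _ → total-*ˡ e (𝟙 (input v c)) (f c))

  total-pairs : ∀ e v (f : ℕ → ℕ → ℕ → ℕ → ℕ) → total e (λ J b → pairs v (λ x y → f x y J b)) ≡ pairs v (λ x y → total e (f x y))
  total-pairs e v f = trans (∑-swap (radix e) v _) (∑-cong v λ x _ → trans (∑-swap (radix e) x _)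
    (∑-cong x λ y _ → total-*ˡ e (𝟙 (input v x) * 𝟙 (input v y)) (f x y)))

  total-unit : ∀ e → total e (λ J _ → unit e J) ≡ 1
  total-unit zero    = trans (∑-cong (suc k) λ J _ → sym (*-identityʳ _)) (∑-single (suc k) (λ _ → 1) k (n<1+n k))
  total-unit (suc e) = trans (total-product e λ J₁ _ J₂ _ → unit e J₁ * unit e J₂)
    (trans (total-* e (λ J _ → unit e J) (λ J _ → unit e J)) (cong₂ _*_ (total-unit e) (total-unit e)))

  total-raise : ∀ e (f : ℕ → ℕ → ℕ) →
    total (suc e) (λ J b → f (rem J (radix e)) (rem b (span e)) * unit e (quot J (radix e))) ≡ total e f
  total-raise e f = trans (total-product e λ J₁ b₁ J₂ _ → f J₁ b₁ * unit e J₂) (trans (total-* e f (λ J _ → unit e J))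
    (trans (cong (total e f *_) (total-unit e)) (*-identityʳ _)))

-- Gates as functions of the ages of nodes

-- `Fin` indices count from the newest node and shift with every new gate. Ages are stable and can
-- be used in arithmetic definitions that know no circuit.
age : ∀ {w} → Fin w → ℕ
age {suc w} zero    = w
age {suc w} (suc i) = age i

age< : ∀ {w} (i : Fin w) → age i < w
age< {suc w} zero    = n<1+n w
age< {suc w} (suc i) = m<n⇒m<1+n (age< i)

age-surjective : ∀ {w c} → c < w → ∃ λ (i : Fin w) → age i ≡ c
age-surjective {suc w} {c} c<w with m≤n⇒m<n∨m≡n (s≤s⁻¹ c<w)
... | inj₂ refl = zero , refl
... | inj₁ c<w′ = let (i , eq) = age-surjective c<w′ in suc i , eq

record Marks {w} (p : ℕ → Bool) (s : Vec Bool w) : Set where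
  constructor marks
  field
    mark : ∀ i → p (age i) ≡ lookup s i

open Marks

marks-tail : ∀ {w p b} {s : Vec Bool w} → Marks p (b ∷ s) → Marks p s
marks-tail m .mark i = m .mark (suc i)

marks-∑ : ∀ {w} {p} (s : Vec Bool w) → Marks p s → ∑ w (λ c → 𝟙 (p c)) ≡ ∣ s ∣
marks-∑ []          m = refl
marks-∑ (true ∷ s)  m = cong₂ _+_ (cong 𝟙 (m .mark zero)) (marks-∑ s (marks-tail m))
marks-∑ (false ∷ s) m = cong₂ _+_ (cong 𝟙 (m .mark zero)) (marks-∑ s (marks-tail m))

marks-none : ∀ {w} {p} (s : Vec Bool w) → ∣ s ∣ ≡ 0 → Marks p s → ∀ (f : ℕ → ℕ) → ∑ w (λ c → 𝟙 (p c) * f c) ≡ 0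
marks-none []          none m f = refl
marks-none {suc w} (false ∷ s) none m f = cong₂ (λ b x → 𝟙 b * f w + x) (m .mark zero) (marks-none s none (marks-tail m) f)

∣0∣-false : ∀ {w} (s : Vec Bool w) → ∣ s ∣ ≡ 0 → ∀ i → lookup s i ≡ false
∣0∣-false (false ∷ s) none zero    = refl
∣0∣-false (false ∷ s) none (suc i) = ∣0∣-false s none i

record One {w} (p : ℕ → Bool) (s : Vec Bool w) : Set where
  field
    only   : Fin w
    marked : lookup s only ≡ true
    unique : ∀ l → lookup s l ≡ true → l ≡ only
    sum    : ∀ (f : ℕ → ℕ) → ∑ w (λ c → 𝟙 (p c) * f c) ≡ f (age only)

marks-one : ∀ {w} {p} (s : Vec Bool w) → ∣ s ∣ ≡ 1 → Marks p s → One p s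
marks-one {suc w} {p} (true ∷ s) one m = record
  { only   = zero
  ; marked = refl
  ; unique = λ { zero _ → refl ; (suc l) eq → true≢false eq (∣0∣-false s (suc-injective one) l) }
  ; sum    = λ f → trans (cong₂ (λ b x → 𝟙 b * f w + x) (m .mark zero) (marks-none s (suc-injective one) (marks-tail m) f)) (trans (+-identityʳ _) (*-identityˡ (f w)))
  }
marks-one {suc w} {p} (false ∷ s) one m = record
  { only   = suc only
  ; marked = marked
  ; unique = λ { (suc l) eq → cong suc (unique l eq) }
  ; sum    = λ f → cong₂ (λ b x → 𝟙 b * f w + x) (m .mark zero) (sum f)
  }
  where open One (marks-one {p = p} s one (marks-tail m))

∑-pairs : ∀ w → (ℕ → Bool) → (ℕ → ℕ → ℕ) → ℕ
∑-pairs w p f = ∑ w λ x → ∑ x λ y → (𝟙 (p x) * 𝟙 (p y)) * f x y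

private
  top-pairs : ∀ w (p : ℕ → Bool) (f : ℕ → ℕ → ℕ) → p w ≡ true → ∑ w (λ y → (𝟙 (p w) * 𝟙 (p y)) * f w y) ≡ ∑ w (λ y → 𝟙 (p y) * f w y)
  top-pairs w p f eq = ∑-cong w λ y _ → cong (_* f w y) (trans (cong (λ b → 𝟙 b * 𝟙 (p y)) eq) (*-identityˡ (𝟙 (p y))))

  no-top-pairs : ∀ w (p : ℕ → Bool) (f : ℕ → ℕ → ℕ) → p w ≡ false → ∑ w (λ y → (𝟙 (p w) * 𝟙 (p y)) * f w y) ≡ 0
  no-top-pairs w p f eq = ∑-zero w λ y _ → cong (λ b → (𝟙 b * 𝟙 (p y)) * f w y) eq

marks-no-pair : ∀ {w} {p} (s : Vec Bool w) → ∣ s ∣ ≤ 1 → Marks p s → ∀ (f : ℕ → ℕ → ℕ) → ∑-pairs w p f ≡ 0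
marks-no-pair []          few m f = refl
marks-no-pair {suc w} {p} (true ∷ s) (s≤s few) m f = cong₂ _+_
  (trans (top-pairs w p f (m .mark zero)) (marks-none s (n≤0⇒n≡0 few) (marks-tail m) (f w)))
  (marks-no-pair s (m≤n⇒m≤1+n few) (marks-tail m) f)
marks-no-pair {suc w} {p} (false ∷ s) few m f = cong₂ _+_ (no-top-pairs w p f (m .mark zero)) (marks-no-pair s few (marks-tail m) f)

record Two {w} (p : ℕ → Bool) (s : Vec Bool w) : Set where
  field
    one other    : Fin w
    marked₁      : lookup s one ≡ true
    marked₂      : lookup s other ≡ true
    no-more      : ∀ l → lookup s l ≡ true → l ≡ one ⊎ l ≡ other
    sum          : ∀ (f : ℕ → ℕ → ℕ) → ∑-pairs w p f ≡ f (age one) (age other)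

marks-two : ∀ {w} {p} (s : Vec Bool w) → ∣ s ∣ ≡ 2 → Marks p s → Two p s
marks-two {suc w} {p} (true ∷ s) two m = record
  { one     = zero
  ; other   = suc only
  ; marked₁ = refl
  ; marked₂ = marked
  ; no-more = λ { zero _ → inj₁ refl ; (suc l) eq → inj₂ (cong suc (unique l eq)) }
  ; sum     = λ f → trans (cong₂ _+_ (trans (top-pairs w p f (m .mark zero)) (sum (f w)))
                                     (marks-no-pair s (≤-reflexive (suc-injective two)) (marks-tail m) f)) (+-identityʳ _)
  }
  where open One (marks-one {p = p} s (suc-injective two) (marks-tail m))
marks-two {suc w} {p} (false ∷ s) two m = record
  { one     = suc one
  ; other   = suc other
  ; marked₁ = marked₁
  ; marked₂ = marked₂
  ; no-more = λ { (suc l) eq → [ inj₁ ∘ cong suc , inj₂ ∘ cong suc ]′ (no-more l eq) }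
  ; sum     = λ f → cong₂ _+_ (no-top-pairs w p f (m .mark zero)) (sum f)
  }
  where open Two (marks-two {p = p} s two (marks-tail m))

does-≡ : ∀ {P : Set} (d : Dec P) b → (P → b ≡ true) → (b ≡ true → P) → does d ≡ b
does-≡ (yes p) b     to from = sym (to p)
does-≡ (no ¬p) true  to from = contradiction (from refl) ¬p
does-≡ (no ¬p) false to from = refl

∈⁺ : ∀ {w} {s : Subset w} {i} → lookup s i ≡ true → i Subset.∈ s
∈⁺ {s = s} {i} eq = Vec.lookup⇒[]= i s eq

∈⁻ : ∀ {w} {s : Subset w} {i} → i Subset.∈ s → lookup s i ≡ true
∈⁻ = Vec.[]=⇒lookup

∑-equal : ∀ n {f g : ℕ → ℕ} → (∀ i → i < n → f i ≤ g i) → ∑ n f ≡ ∑ n g → ∀ i → i < n → f i ≡ g i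
∑-equal (suc n) {f} {g} le eq i i<n = [ (λ i<n′ → ∑-equal n le′ rest i i<n′) , (λ { refl → top }) ]′ (m≤n⇒m<n∨m≡n (s≤s⁻¹ i<n))
  where
  le′ : ∀ i → i < n → f i ≤ g i
  le′ i i<n = le i (m<n⇒m<1+n i<n)
  top : f n ≡ g n
  top = ≤-antisym (le n (n<1+n n)) (+-cancelʳ-≤ (∑ n f) _ _ (≤-trans (+-monoʳ-≤ (g n) (∑-mono n le′)) (≤-reflexive (sym eq))))
  rest : ∑ n f ≡ ∑ n g
  rest = +-cancelˡ-≡ (f n) _ _ (trans eq (cong (_+ ∑ n g) (sym top)))

∑-positive : ∀ n (f : ℕ → ℕ) → 0 < ∑ n f → ∃ λ i → i < n × 0 < f i
∑-positive (suc n) f pos with f n in eq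
... | suc _ = n , n<1+n n , subst (0 <_) (sym eq) z<s
... | zero  = let (i , i<n , pos′) = ∑-positive n f pos in i , m<n⇒m<1+n i<n , pos′

module _ {w} {p q : ℕ → Bool} {s v : Vec Bool w} (marks-s : Marks p s) (marks-v : Marks q v) where

  private
    both : ℕ → ℕ
    both c = 𝟙 (p c) * 𝟙 (q c)

    both≤ : ∀ c → both c ≤ 𝟙 (p c)
    both≤ c = ≤-trans (*-monoʳ-≤ (𝟙 (p c)) (𝟙≤1 (q c))) (≤-reflexive (*-identityʳ _))

  -- No summand on the left exceeds the one on the right, so the sums agree only if all summands do.
  -- This is why the number of true inputs determines a large conjunction.
  marks-all : does (s ⊆? v) ≡ (∑ w both ≡ᵇ ∑ w (λ c → 𝟙 (p c)))
  marks-all = does-≡ (s ⊆? v) _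
    (λ s⊆v → ≡ᵇ-true (∑-cong w λ c c<w → entry s⊆v (age-surjective c<w)))
    (λ eq {i} i∈s → ∈⁺ (trans (sym (marks-v .mark i)) (included (∑-equal w (λ c _ → both≤ c) (≡ᵇ-true⁻ _ _ eq) (age i) (age< i)) (trans (marks-s .mark i) (∈⁻ i∈s)))))
    where
    entry : s ⊆ v → ∀ {c} → (∃ λ (i : Fin w) → age i ≡ c) → both c ≡ 𝟙 (p c)
    entry s⊆v (i , refl) with lookup s i in eq
    ... | true  rewrite marks-s .mark i | marks-v .mark i | eq | ∈⁻ {s = v} (s⊆v (∈⁺ eq)) = refl
    ... | false rewrite marks-s .mark i | eq = refl
    included : ∀ {a b} → 𝟙 a * 𝟙 b ≡ 𝟙 a → a ≡ true → b ≡ true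
    included {true} {true} _ _ = refl

  marks-any : does (nonempty? (s ∩ v)) ≡ (0 <ᵇ ∑ w both)
  marks-any = does-≡ (nonempty? (s ∩ v)) _
    (λ { (i , i∈) → let (i∈s , i∈v) = Subset.x∈p∩q⁻ s v i∈
                    in <ᵇ-true (≤-trans (≤-reflexive (sym (cong₂ (λ a b → 𝟙 a * 𝟙 b) (trans (marks-s .mark i) (∈⁻ i∈s)) (trans (marks-v .mark i) (∈⁻ i∈v)))))
                                        (term≤∑ w both (age< i))) })
    (λ pos → found (∑-positive w both (<ᵇ-true⁻ 0 _ pos)))
    where
    positive : ∀ {a b} → 0 < 𝟙 a * 𝟙 b → a ≡ true × b ≡ true
    positive {true} {true} _ = refl , refl
    found : (∃ λ c → c < w × 0 < both c) → Nonempty (s ∩ v)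
    found (c , c<w , pos) with age-surjective c<w
    ... | i , refl = let (pi , qi) = positive pos
                     in i , Subset.x∈p∩q⁺ (∈⁺ (trans (sym (marks-s .mark i)) pi) , ∈⁺ (trans (sym (marks-v .mark i)) qi))

module _ {w} {p : ℕ → Bool} {s : Vec Bool w} (two : Two p s) (v : Vec Bool w) where
  open Two two

  two-all : does (s ⊆? v) ≡ lookup v one ∧ lookup v other
  two-all = does-≡ (s ⊆? v) _
    (λ s⊆v → ∧-true (∈⁻ (s⊆v (∈⁺ marked₁))) (∈⁻ (s⊆v (∈⁺ marked₂))))
    (λ eq {i} i∈s → let (v₁ , v₂) = ∧-true⁻ {lookup v one} eq in ∈⁺ ([ (λ { refl → v₁ }) , (λ { refl → v₂ }) ]′ (no-more i (∈⁻ i∈s))))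

  two-any : does (nonempty? (s ∩ v)) ≡ lookup v one ∨ lookup v other
  two-any = does-≡ (nonempty? (s ∩ v)) _
    (λ { (i , i∈) → let (i∈s , i∈v) = Subset.x∈p∩q⁻ s v i∈
                    in [ (λ { refl → cong (_∨ lookup v other) (∈⁻ i∈v) }) , (λ { refl → ∨-trueʳ (lookup v one) (∈⁻ i∈v) }) ]′ (no-more i (∈⁻ i∈s)) })
    (λ eq → [ (λ v₁ → one , Subset.x∈p∩q⁺ (∈⁺ marked₁ , ∈⁺ v₁)) , (λ v₂ → other , Subset.x∈p∩q⁺ (∈⁺ marked₂ , ∈⁺ v₂)) ]′ (∨-true⁻ {lookup v one} eq))

isNegation isConjunction : ∀ {w} → Gate w → Bool
isNegation (NOT _)      = true
isNegation (AND _ _)    = false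
isNegation (OR _ _)     = false
-- Follows the encoding, in which `NOT` and `AND` share the second bit of the kind.
isConjunction (NOT _)   = true
isConjunction (AND _ _) = true
isConjunction (OR _ _)  = false

-- Links a circuit to functions that are read off a word. Input nodes carry no condition because the
-- forms test `v <ᵇ n` before consulting these functions.
Describes : (negation conjunction : ℕ → Bool) (input : ℕ → ℕ → Bool) → ∀ {n w} → Circuit n w → Set
Describes negation conjunction input inputs = ⊤
Describes negation conjunction input (_▷_ {w} C g) = Describes negation conjunction input C ×
  negation w ≡ isNegation g × conjunction w ≡ isConjunction g × Marks (input w) (gateInputs g)

inputs≤nodes : ∀ {n w} → Circuit n w → n ≤ w
inputs≤nodes inputs  = ≤-refl
inputs≤nodes (C ▷ g) = m≤n⇒m≤1+n (inputs≤nodes C)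

gate-has-input : ∀ {w} → Gate w → 0 < w
gate-has-input {suc w} g = z<s
gate-has-input {zero} (AND [] ())
gate-has-input {zero} (OR [] ())

-- Every gate has an earlier node to read from, so going back through the gates ends at an input.
inputs-nonempty : ∀ {n w} → Circuit n w → 0 < w → 0 < n
inputs-nonempty inputs  0<w = 0<w
inputs-nonempty (C ▷ g) 0<w = inputs-nonempty C (gate-has-input g)

≤maximumOver : ∀ {w} (s : Subset w) (v : Vec ℕ w) i → lookup s i ≡ true → lookup v i ≤ maximumOver s v
≤maximumOver (true ∷ s) (x ∷ v) zero    eq = m≤m⊔n x _
≤maximumOver (b ∷ s)    (x ∷ v) (suc i) eq = ≤-trans (≤maximumOver s v i eq) (m≤n⊔m (if b then x else 0) _)

not-large : ∀ {m} → (if does (3 ≤? m) then 1 else 0) ≡ 0 → m ≤ 2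
not-large {m} eq = s≤s⁻¹ (≰⇒> λ 3≤m → case trans (sym (if-true (dec-true (3 ≤? m) 3≤m))) eq of λ ())

-- Values of the nodes from totals of their forms

module CircuitValues (n k size : ℕ) (negation conjunction : ℕ → Bool) (input : ℕ → ℕ → Bool)
                     (0<n : 0 < n) (a : ℕ → ℕ) (a<n : ∀ i → i < k → a i < n)
                     (assignment : Vec Bool n) (selects : ∀ i → ∑ k (λ l → 𝟙 (a l ≡ᵇ age i)) ≡ 𝟙 (lookup assignment i))
                     (M : ℕ) (0<M : 0 < M) where

  open SelectionSums n k size negation conjunction input 0<n a a<n public

  record DescribedAt (w : ℕ) (g : Gate w) : Set where
    field
      not-input    : (w <ᵇ n) ≡ false
      is-negation  : negation w ≡ isNegation g
      is-conjunction : conjunction w ≡ isConjunction g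
      inputs-marked  : Marks (input w) (gateInputs g)

  private
    and-rule : ∀ x y → 𝟙 x * 𝟙 y ≡ 𝟙 (x ∧ y)
    and-rule x y = sym (𝟙-∧ x y)

    total-tensor-* : ∀ e x y → total (suc e) (λ J b → tensor M e x (rem J (radix e)) (rem b (span e)) * tensor M e y (quot J (radix e)) (quot b (span e)))
                               ≡ total e (tensor M e x) * total e (tensor M e y)
    total-tensor-* e x y = trans (total-product e λ J₁ b₁ J₂ b₂ → tensor M e x J₁ b₁ * tensor M e y J₂ b₂) (total-* e (tensor M e x) (tensor M e y))

    total-raiseˡ : ∀ e (f : ℕ → ℕ → ℕ) → total (suc e) (λ J b → unit e (rem J (radix e)) * f (quot J (radix e)) (quot b (span e))) ≡ total e f
    total-raiseˡ e f = trans (total-product e λ J₁ _ J₂ b₂ → unit e J₁ * f J₂ b₂) (trans (total-* e (λ J _ → unit e J) f)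
      (trans (cong (_* total e f) (total-unit e)) (*-identityˡ _)))

  tensor-input : ∀ e v → v < n → total e (tensor M e v) ≡ ∑ k (λ l → 𝟙 (a l ≡ᵇ v))
  tensor-input zero v v<n = cong₂ _+_ (cong (λ b → 𝟙 b * 𝟙 (selection a 0 k ≡ᵇ v)) (<ᵇ-false {k} ≤-refl))
    (∑-cong k λ l l<k → entry l l<k)
    where
    entry : ∀ l → l < k → 𝟙 (l <ᵇ k) * 𝟙 ((if l <ᵇ k then a l else 0) ≡ᵇ v) ≡ 𝟙 (a l ≡ᵇ v)
    entry l l<k rewrite <ᵇ-true l<k = *-identityˡ _
  tensor-input (suc e) v v<n = trans (total-cong (suc e) {tensor M (suc e) v} {λ J b → tensor M e v (rem J (radix e)) (rem b (span e)) * unit e (quot J (radix e))} (λ J b → if-true (<ᵇ-true v<n)))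
    (trans (total-raise e (tensor M e v)) (tensor-input e v v<n))

  module _ {w} (g : Gate w) (at-w : DescribedAt w g) (values : Vec Bool w) (e : ℕ) where
    open DescribedAt at-w

    private
      low high : ℕ → ℕ → ℕ → ℕ
      low  x J b = tensor M e x (rem J (radix e)) (rem b (span e))
      high y J b = tensor M e y (quot J (radix e)) (quot b (span e))

      unit-low unit-high : ℕ → ℕ
      unit-low  J = unit e (rem J (radix e))
      unit-high J = unit e (quot J (radix e))

      or-form : ℕ → ℕ → ℕ → ℕ → ℕ
      or-form x y J b = (low x J b * unit-high J + unit-low J * high y J b) + (M ∸ 1) * (low x J b * high y J b)

    tensor-gate : largeness g ≡ 0 →
                  (∀ i → lookup (gateInputs g) i ≡ true → total e (tensor M e (age i)) ≈[ M ] 𝟙 (lookup values i)) →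
                  total (suc e) (tensor M (suc e) w) ≈[ M ] 𝟙 (evalGate g values)
    tensor-gate small children = go g not-input is-negation is-conjunction inputs-marked small children
      where
      go : ∀ g → (w <ᵇ n) ≡ false → negation w ≡ isNegation g → conjunction w ≡ isConjunction g → Marks (input w) (gateInputs g) → largeness g ≡ 0 →
           (∀ i → lookup (gateInputs g) i ≡ true → total e (tensor M e (age i)) ≈[ M ] 𝟙 (lookup values i)) →
           total (suc e) (tensor M (suc e) w) ≈[ M ] 𝟙 (evalGate g values)
      go (NOT i) w≮n neg con m small children = ≈-trans (≈-reflexive computed)
        (≈-trans (≈-+ (≈-reflexive refl) (≈-* (≈-reflexive {x = M ∸ 1} refl) (children only marked)))
        (≈-trans (≈-not (lookup values only) 0<M) (≈-reflexive (cong (λ i → 𝟙 (not (lookup values i))) (Subset.x∈⁅y⁆⇒x≡y i (∈⁺ marked))))))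
        where
        open One (marks-one ⁅ i ⁆ (Subset.∣⁅x⁆∣≡1 i) m)
        computed : total (suc e) (tensor M (suc e) w) ≡ 1 + (M ∸ 1) * total e (tensor M e (age only))
        computed = begin
            total (suc e) (tensor M (suc e) w)
          ≡⟨ total-cong (suc e) {tensor M (suc e) w} {λ J b → (unit-low J + (M ∸ 1) * among w (λ c → low c J b)) * unit-high J} (λ J b → trans (if-false w≮n) (if-true neg)) ⟩
            total (suc e) (λ J b → (unit-low J + (M ∸ 1) * among w (λ c → low c J b)) * unit-high J)
          ≡⟨ total-raise e (λ J b → unit e J + (M ∸ 1) * among w (λ c → tensor M e c J b)) ⟩
            total e (λ J b → unit e J + (M ∸ 1) * among w (λ c → tensor M e c J b))
          ≡⟨ total-+ e (λ J b → unit e J) (λ J b → (M ∸ 1) * among w (λ c → tensor M e c J b)) ⟩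
            total e (λ J b → unit e J) + total e (λ J b → (M ∸ 1) * among w (λ c → tensor M e c J b))
          ≡⟨ cong₂ _+_ (total-unit e) (trans (total-*ˡ e (M ∸ 1) (λ J b → among w (λ c → tensor M e c J b))) (cong ((M ∸ 1) *_) (trans (total-among e w (tensor M e)) (sum (λ c → total e (tensor M e c)))))) ⟩
            1 + (M ∸ 1) * total e (tensor M e (age only))
          ∎
          where open ≡-Reasoning
      go (AND s 2≤s) w≮n neg con m small children = ≈-trans (≈-reflexive computed)
        (≈-trans (≈-* (children one marked₁) (children other marked₂))
          (≈-reflexive (trans (and-rule (lookup values one) (lookup values other)) (cong 𝟙 (sym (two-all two values))))))
        where
        two = marks-two s (≤-antisym (not-large small) 2≤s) m
        open Two two
        computed : total (suc e) (tensor M (suc e) w) ≡ total e (tensor M e (age one)) * total e (tensor M e (age other))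
        computed = begin
            total (suc e) (tensor M (suc e) w)
          ≡⟨ total-cong (suc e) {tensor M (suc e) w} {λ J b → pairs w (λ x y → low x J b * high y J b)} (λ J b → trans (trans (if-false w≮n) (if-false neg)) (if-true con)) ⟩
            total (suc e) (λ J b → pairs w (λ x y → low x J b * high y J b))
          ≡⟨ total-pairs (suc e) w (λ x y J b → low x J b * high y J b) ⟩
            pairs w (λ x y → total (suc e) (λ J b → low x J b * high y J b))
          ≡⟨ sum (λ x y → total (suc e) (λ J b → low x J b * high y J b)) ⟩
            total (suc e) (λ J b → low (age one) J b * high (age other) J b)
          ≡⟨ total-tensor-* e (age one) (age other) ⟩
            total e (tensor M e (age one)) * total e (tensor M e (age other))
          ∎
          where open ≡-Reasoning
      go (OR s 2≤s) w≮n neg con m small children = ≈-trans (≈-reflexive computed)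
        (≈-trans (≈-+ (≈-+ v₁ v₂) (≈-* (≈-reflexive {x = M ∸ 1} refl) (≈-* v₁ v₂)))
        (≈-trans (≈-or (lookup values one) (lookup values other) 0<M) (≈-reflexive (cong 𝟙 (sym (two-any two values))))))
        where
        two = marks-two s (≤-antisym (not-large small) 2≤s) m
        open Two two
        v₁ = children one marked₁
        v₂ = children other marked₂
        x = age one
        y = age other
        computed : total (suc e) (tensor M (suc e) w) ≡
                   (total e (tensor M e x) + total e (tensor M e y)) + (M ∸ 1) * (total e (tensor M e x) * total e (tensor M e y))
        computed = begin
            total (suc e) (tensor M (suc e) w)
          ≡⟨ total-cong (suc e) {tensor M (suc e) w} {λ J b → pairs w (λ x y → or-form x y J b)} (λ J b → trans (trans (if-false w≮n) (if-false neg)) (if-false con)) ⟩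
            total (suc e) (λ J b → pairs w (λ x y → or-form x y J b))
          ≡⟨ trans (total-pairs (suc e) w or-form) (sum (λ x y → total (suc e) (or-form x y))) ⟩
            total (suc e) (or-form x y)
          ≡⟨ trans (total-+ (suc e) (λ J b → low x J b * unit-high J + unit-low J * high y J b) (λ J b → (M ∸ 1) * (low x J b * high y J b)))
               (cong₂ _+_ (total-+ (suc e) (λ J b → low x J b * unit-high J) (λ J b → unit-low J * high y J b)) (total-*ˡ (suc e) (M ∸ 1) (λ J b → low x J b * high y J b))) ⟩
            (total (suc e) (λ J b → low x J b * unit-high J) + total (suc e) (λ J b → unit-low J * high y J b))
            + (M ∸ 1) * total (suc e) (λ J b → low x J b * high y J b)
          ≡⟨ cong₂ _+_ (cong₂ _+_ (total-raise e (tensor M e x)) (total-raiseˡ e (tensor M e y))) (cong ((M ∸ 1) *_) (total-tensor-* e x y)) ⟩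
            (total e (tensor M e x) + total e (tensor M e y)) + (M ∸ 1) * (total e (tensor M e x) * total e (tensor M e y))
          ∎
          where open ≡-Reasoning

  0<base : ∀ e → 0 < base e
  0<base zero    = z<s
  0<base (suc e) = *-mono-≤ (0<base e) (0<base e)

  base-mono : ∀ e → base e ≤ base (suc e)
  base-mono e = m≤n*m (base e) (base e) {{>-nonZero (0<base e)}}

  size<base : ∀ e → suc size < base e
  size<base zero    = ≤-refl
  size<base (suc e) = <-≤-trans (size<base e) (base-mono e)

  -- The total of the form is known only modulo `M`, but `number` lies below `base e`, so it can be
  -- recovered as a remainder once `M` is that base.
  record Packed (e v : ℕ) (b : Bool) : Set where
    field
      number  : ℕ
      bounded : number < base e
      counts  : total e (packed M e v) ≈[ M ] number
      decodes : unpacked e v number ≡ b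

  packed-input : ∀ e i → Packed e (age i) (lookup assignment i)
  packed-input e i = record
    { number  = 𝟙 (lookup assignment i)
    ; bounded = ≤-<-trans (𝟙≤1 (lookup assignment i)) (≤-<-trans (s≤s z≤n) (size<base e))
    ; counts  = ≈-reflexive (trans (same e) (trans (tensor-input e (age i) (age< i)) (selects i)))
    ; decodes = trans (decoded e) (positive-𝟙 (lookup assignment i))
    }
    where
    same : ∀ e → total e (packed M e (age i)) ≡ total e (tensor M e (age i))
    same zero = refl
    same (suc e) = trans (trans (total-raise e (packedStep M e (age i))) (total-cong e {packedStep M e (age i)} {packed M e (age i)} (λ J b → if-true (<ᵇ-true (age< i)))))
      (trans (same e) (trans (tensor-input e (age i) (age< i)) (sym (tensor-input (suc e) (age i) (age< i)))))
    decoded : ∀ e → unpacked e (age i) (𝟙 (lookup assignment i)) ≡ (0 <ᵇ 𝟙 (lookup assignment i))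
    decoded zero = refl
    decoded (suc e) rewrite <ᵇ-true (age< i) = refl

  module _ {w} (w≤size : w ≤ size) (vs : Vec Bool w) (e : ℕ) (w≮n : (w <ᵇ n) ≡ false) where

    private
      Children Leaves : Subset w → Set
      Children s = ∀ i → lookup s i ≡ true → Packed e (age i) (lookup vs i)
      Leaves s   = ∀ i → lookup s i ≡ true → total e (tensor M e (age i)) ≈[ M ] 𝟙 (lookup vs i)

      valueAt : ∀ {w} → Vec Bool w → ℕ → Bool
      valueAt {zero}  []       c = false
      valueAt {suc w} (x ∷ xs) c = if c ≡ᵇ w then x else valueAt xs c

      marks-values : ∀ {w} (xs : Vec Bool w) → Marks (valueAt xs) xs
      marks-values {suc w} (x ∷ xs) .mark zero rewrite ≡ᵇ-true {w} refl = refl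
      marks-values {suc w} (x ∷ xs) .mark (suc i) rewrite ≡ᵇ-false (<⇒≢ (age< i)) = marks-values xs .mark i

      fan-size : ∀ {s : Subset w} → Marks (input w) s → fan w ≡ ∣ s ∣
      fan-size {s} m = marks-∑ {p = input w} s m

      packed-not : ∀ i → negation w ≡ true → Marks (input w) ⁅ i ⁆ → Children ⁅ i ⁆ → Packed (suc e) w (not (lookup vs i))
      packed-not i neg m children = record
        { number  = number
        ; bounded = <-≤-trans bounded (base-mono e)
        ; counts  = ≈-trans (≈-reflexive computed) counts
        ; decodes = trans (trans (if-false w≮n) (if-true neg))
                      (trans (cong (0 <ᵇ_) (sum (λ c → 𝟙 (not (unpacked e c number)))))
                      (trans (positive-𝟙 _) (cong not (trans decodes (cong (lookup vs) (Subset.x∈⁅y⁆⇒x≡y i (∈⁺ marked)))))))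
        }
        where
        open One (marks-one ⁅ i ⁆ (Subset.∣⁅x⁆∣≡1 i) m)
        open Packed (children only marked)
        computed : total (suc e) (packed M (suc e) w) ≡ total e (packed M e (age only))
        computed = begin
            total (suc e) (packed M (suc e) w)
          ≡⟨ total-raise e (packedStep M e w) ⟩
            total e (packedStep M e w)
          ≡⟨ total-cong e {packedStep M e w} {λ J b → among w (λ c → packed M e c J b)} (λ J b → trans (if-false w≮n) (if-true neg)) ⟩
            total e (λ J b → among w (λ c → packed M e c J b))
          ≡⟨ total-among e w (packed M e) ⟩
            among w (λ c → total e (packed M e c))
          ≡⟨ sum _ ⟩
            total e (packed M e (age only))
          ∎
          where open ≡-Reasoning

      module Large {s} (neg : negation w ≡ false) (m : Marks (input w) s) (large : 3 ≤ ∣ s ∣) (leaves : Leaves s) where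

        number : ℕ
        number = among w (λ c → 𝟙 (valueAt vs c))

        is-large : (2 <ᵇ fan w) ≡ true
        is-large = <ᵇ-true (≤-trans large (≤-reflexive (sym (fan-size m))))

        bounded : number < base (suc e)
        bounded = ≤-<-trans (≤-trans (∑≤n*c w 1 λ c _ → ≤-trans (*-mono-≤ (𝟙≤1 (input w c)) (𝟙≤1 (valueAt vs c))) ≤-refl)
                  (≤-trans (≤-reflexive (*-identityʳ w)) (m≤n⇒m≤1+n w≤size))) (size<base (suc e))

        counts : total (suc e) (packed M (suc e) w) ≈[ M ] number
        counts = ≈-trans (≈-reflexive computed) (≈-∑ w λ c c<w → entry (age-surjective c<w))
          where
          computed : total (suc e) (packed M (suc e) w) ≡ among w (λ c → total e (tensor M e c))
          computed = trans (total-raise e (packedStep M e w))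
            (trans (total-cong e {packedStep M e w} {λ J b → among w (λ c → tensor M e c J b)} (λ J b → trans (trans (if-false w≮n) (if-false neg)) (if-true is-large))) (total-among e w (tensor M e)))
          entry : ∀ {c} → (∃ λ (i : Fin w) → age i ≡ c) → 𝟙 (input w c) * total e (tensor M e c) ≈[ M ] 𝟙 (input w c) * 𝟙 (valueAt vs c)
          entry (i , refl) with lookup s i in eq
          ... | false rewrite m .mark i | eq = ≈-reflexive refl
          ... | true = ≈-* (≈-reflexive {x = 𝟙 (input w (age i))} refl) (≈-trans (leaves i eq) (≈-reflexive (cong 𝟙 (sym (marks-values vs .mark i)))))

        unpacked-large : unpacked (suc e) w number ≡ (if conjunction w then number ≡ᵇ fan w else 0 <ᵇ number)
        unpacked-large = trans (trans (if-false w≮n) (if-false neg)) (if-true is-large)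

      module Small {s} (neg : negation w ≡ false) (m : Marks (input w) s) (size-2 : ∣ s ∣ ≡ 2) (children : Children s) where

        two = marks-two s size-2 m
        open Two two public
        module X = Packed (children one marked₁)
        module Y = Packed (children other marked₂)

        is-small : (2 <ᵇ fan w) ≡ false
        is-small = <ᵇ-false (≤-reflexive (trans (fan-size m) size-2))

        number : ℕ
        number = base e * Y.number + X.number

        bounded : number < base (suc e)
        bounded = pair< Y.bounded X.bounded

        counts : total (suc e) (packed M (suc e) w) ≈[ M ] number
        counts = ≈-trans (≈-reflexive computed) (≈-+ (≈-* (≈-reflexive {x = base e} refl) Y.counts) X.counts)
          where
          computed : total (suc e) (packed M (suc e) w) ≡ base e * total e (packed M e (age other)) + total e (packed M e (age one))
          computed = begin
              total (suc e) (packed M (suc e) w)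
            ≡⟨ total-raise e (packedStep M e w) ⟩
              total e (packedStep M e w)
            ≡⟨ total-cong e {packedStep M e w} {λ J b → pairs w (λ x y → base e * packed M e y J b + packed M e x J b)} (λ J b → trans (trans (if-false w≮n) (if-false neg)) (if-false is-small)) ⟩
              total e (λ J b → pairs w (λ x y → base e * packed M e y J b + packed M e x J b))
            ≡⟨ trans (total-pairs e w (λ x y J b → base e * packed M e y J b + packed M e x J b)) (sum _) ⟩
              total e (λ J b → base e * packed M e (age other) J b + packed M e (age one) J b)
            ≡⟨ trans (total-+ e (λ J b → base e * packed M e (age other) J b) (packed M e (age one))) (cong (_+ total e (packed M e (age one))) (total-*ˡ e (base e) (packed M e (age other)))) ⟩
              base e * total e (packed M e (age other)) + total e (packed M e (age one))
            ∎
            where open ≡-Reasoning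

        unpacked-small : unpacked (suc e) w number ≡ (if conjunction w then lookup vs one ∧ lookup vs other else (lookup vs one ∨ lookup vs other))
        unpacked-small = begin
            unpacked (suc e) w number
          ≡⟨ trans (trans (if-false w≮n) (if-false neg)) (if-false is-small) ⟩
            0 <ᵇ pairs w (λ x y → 𝟙 (if conjunction w then unpacked e x (rem number (base e)) ∧ unpacked e y (quot number (base e))
                                      else (unpacked e x (rem number (base e)) ∨ unpacked e y (quot number (base e)))))
          ≡⟨ trans (cong (0 <ᵇ_) (sum _)) (positive-𝟙 _) ⟩
            (if conjunction w then unpacked e (age one) (rem number (base e)) ∧ unpacked e (age other) (quot number (base e))
             else (unpacked e (age one) (rem number (base e)) ∨ unpacked e (age other) (quot number (base e))))
          ≡⟨ cong₂ (λ x y → if conjunction w then x ∧ y else (x ∨ y))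
               (trans (cong (unpacked e (age one)) (rem-unique (base e) Y.number X.bounded)) X.decodes)
               (trans (cong (unpacked e (age other)) (quot-unique (base e) Y.number X.bounded)) Y.decodes) ⟩
            (if conjunction w then lookup vs one ∧ lookup vs other else (lookup vs one ∨ lookup vs other))
          ∎
          where open ≡-Reasoning

      2or3 : ∀ {m} → 2 ≤ m → m ≡ 2 ⊎ 3 ≤ m
      2or3 2≤m = [ inj₂ , inj₁ ∘ sym ]′ (m≤n⇒m<n∨m≡n 2≤m)

    packed-gate : ∀ g → negation w ≡ isNegation g → conjunction w ≡ isConjunction g → Marks (input w) (gateInputs g) →
                  Children (gateInputs g) → (3 ≤ ∣ gateInputs g ∣ → Leaves (gateInputs g)) → Packed (suc e) w (evalGate g vs)
    packed-gate (NOT i) neg con m children leaves = packed-not i neg m children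
    packed-gate (AND s 2≤s) neg con m children leaves with 2or3 2≤s
    ... | inj₁ size-2 = record { number = number ; bounded = bounded ; counts = counts
      ; decodes = trans unpacked-small (trans (if-true con) (sym (two-all two vs))) }
      where open Small neg m size-2 children
    ... | inj₂ large = record { number = number ; bounded = bounded ; counts = counts
      ; decodes = trans unpacked-large (trans (if-true con) (sym (marks-all m (marks-values vs)))) }
      where open Large neg m large (leaves large)
    packed-gate (OR s 2≤s) neg con m children leaves with 2or3 2≤s
    ... | inj₁ size-2 = record { number = number ; bounded = bounded ; counts = counts
      ; decodes = trans unpacked-small (trans (if-false con) (sym (two-any two vs))) }
      where open Small neg m size-2 children
    ... | inj₂ large = record { number = number ; bounded = bounded ; counts = counts
      ; decodes = trans unpacked-large (trans (if-false con) (sym (marks-any m (marks-values vs)))) }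
      where open Large neg m large (leaves large)

  private
    not-an-input : ∀ {w} → Circuit n w → (w <ᵇ n) ≡ false
    not-an-input C = <ᵇ-false (inputs≤nodes C)

  -- Weft 0 makes the gate small and leaves weft 0 to its inputs; each gate consumes one level, of
  -- which the depth guarantees enough.
  tensor-value : ∀ {w} (C : Circuit n w) → Describes negation conjunction input C → ∀ i e →
                 lookup (depths C) i ≤ e → lookup (wefts C) i ≡ 0 → total e (tensor M e (age i)) ≈[ M ] 𝟙 (lookup (values C assignment) i)
  tensor-value inputs _ i e _ _ = ≈-reflexive (trans (tensor-input e (age i) (age< i)) (selects i))
  tensor-value (C ▷ g) (d , _) (suc i) e deep light = tensor-value C d i e deep light
  tensor-value (C ▷ g) (d , neg , con , m) zero (suc e) (s≤s deep) light =
    tensor-gate g (record { not-input = not-an-input C ; is-negation = neg ; is-conjunction = con ; inputs-marked = m })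
      (values C assignment) e (m+n≡0⇒m≡0 (largeness g) light)
      λ i marked → tensor-value C d i e (≤-trans (≤maximumOver (gateInputs g) (depths C) i marked) deep)
        (n≤0⇒n≡0 (≤-trans (≤maximumOver (gateInputs g) (wefts C) i marked) (≤-reflexive (m+n≡0⇒n≡0 (largeness g) light))))

  -- A large gate uses up the weft 1, so its inputs have weft 0 and fall under `tensor-value`. A
  -- small gate passes weft at most 1 on to its inputs.
  packed-value : ∀ {w} (C : Circuit n w) → Describes negation conjunction input C → w ≤ size → ∀ i e →
                 lookup (depths C) i ≤ e → lookup (wefts C) i ≤ 1 → Packed e (age i) (lookup (values C assignment) i)
  packed-value inputs _ _ i e _ _ = packed-input e i
  packed-value (C ▷ g) (d , _) w≤ (suc i) e deep light = packed-value C d (<⇒≤ w≤) i e deep light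
  packed-value {suc w} (C ▷ g) (d , neg , con , m) w≤ zero (suc e) (s≤s deep) light =
    packed-gate (<⇒≤ w≤) (values C assignment) e (not-an-input C) g neg con m
      (λ i marked → packed-value C d (<⇒≤ w≤) i e (≤-trans (≤maximumOver (gateInputs g) (depths C) i marked) deep)
        (≤-trans (≤maximumOver (gateInputs g) (wefts C) i marked) (m+n≤o⇒n≤o (largeness g) light)))
      (λ large i marked → tensor-value C d i e (≤-trans (≤maximumOver (gateInputs g) (depths C) i marked) deep)
        (n≤0⇒n≡0 (≤-trans (≤maximumOver (gateInputs g) (wefts C) i marked)
          (s≤s⁻¹ (subst (λ b → (if b then 1 else 0) + maximumOver (gateInputs g) (wefts C) ≤ 1) (dec-true (3 ≤? ∣ gateInputs g ∣) large) light)))))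

-- Subsets of size k and injective selections

∑-empty : ∀ n (p : ℕ → Bool) → (∀ i → i < n → p i ≡ false) → ∑ n (λ i → 𝟙 (p i)) ≡ 0
∑-empty n p none = ∑-zero n λ i i<n → cong 𝟙 (none i i<n)

record Selection {n} (k : ℕ) (a : ℕ → ℕ) (assignment : Vec Bool n) : Set where
  field
    in-range  : ∀ l → l < k → a l < n
    injective : ∀ l l′ → l < k → l′ < k → a l ≡ a l′ → l ≡ l′
    selects   : ∀ i → ∑ k (λ l → 𝟙 (a l ≡ᵇ age i)) ≡ 𝟙 (lookup assignment i)

select-subset : ∀ {n} (A : Subset n) → ∃ λ a → Selection ∣ A ∣ a A
select-subset [] = (λ _ → 0) , record { in-range = λ _ () ; injective = λ _ _ () ; selects = λ () }
select-subset (false ∷ A) with select-subset A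
... | a , sel = a , record
  { in-range  = λ l l< → m<n⇒m<1+n (in-range l l<)
  ; injective = injective
  ; selects   = λ { zero → ∑-empty ∣ A ∣ _ (λ l l< → ≡ᵇ-false (<⇒≢ (in-range l l<))) ; (suc i) → selects i }
  }
  where open Selection sel
select-subset {suc n} (true ∷ A) with select-subset A
... | a , sel = a′ , record { in-range = in-range′ ; injective = injective′ ; selects = selects′ }
  where
  open Selection sel
  m = ∣ A ∣
  a′ : ℕ → ℕ
  a′ l = if l ≡ᵇ m then n else a l
  new : a′ m ≡ n
  new = if-true (≡ᵇ-true {m} refl)
  old : ∀ l → l < m → a′ l ≡ a l
  old l l< = if-false (≡ᵇ-false (<⇒≢ l<))
  in-range′ : ∀ l → l < suc m → a′ l < suc n
  in-range′ l l< with m≤n⇒m<n∨m≡n (s≤s⁻¹ l<)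
  ... | inj₁ l<m  = subst (_< suc n) (sym (old l l<m)) (m<n⇒m<1+n (in-range l l<m))
  ... | inj₂ refl = subst (_< suc n) (sym new) (n<1+n n)
  injective′ : ∀ l l′ → l < suc m → l′ < suc m → a′ l ≡ a′ l′ → l ≡ l′
  injective′ l l′ l< l′< eq with m≤n⇒m<n∨m≡n (s≤s⁻¹ l<) | m≤n⇒m<n∨m≡n (s≤s⁻¹ l′<)
  ... | inj₁ l<m  | inj₁ l′<m = injective l l′ l<m l′<m (trans (sym (old l l<m)) (trans eq (old l′ l′<m)))
  ... | inj₁ l<m  | inj₂ refl = contradiction (trans (sym (old l l<m)) (trans eq new)) (<⇒≢ (in-range l l<m))
  ... | inj₂ refl | inj₁ l′<m = contradiction (trans (sym (old l′ l′<m)) (trans (sym eq) new)) (<⇒≢ (in-range l′ l′<m))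
  ... | inj₂ refl | inj₂ refl = refl
  selects′ : ∀ i → ∑ (suc m) (λ l → 𝟙 (a′ l ≡ᵇ age i)) ≡ 𝟙 (lookup (true ∷ A) i)
  selects′ zero = cong₂ _+_ (cong 𝟙 (≡ᵇ-true new))
    (∑-empty m _ (λ l l< → ≡ᵇ-false (λ eq → <⇒≢ (in-range l l<) (trans (sym (old l l<)) eq))))
  selects′ (suc i) = cong₂ _+_ (cong 𝟙 (≡ᵇ-false (λ eq → <⇒≢ (age< i) (trans (sym eq) new))))
    (trans (∑-cong m λ l l< → cong (λ x → 𝟙 (x ≡ᵇ age i)) (old l l<)) (selects i))

∑-injective≤1 : ∀ k (a : ℕ → ℕ) c → (∀ l l′ → l < k → l′ < k → a l ≡ a l′ → l ≡ l′) → ∑ k (λ l → 𝟙 (a l ≡ᵇ c)) ≤ 1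
∑-injective≤1 zero    a c inj = z≤n
∑-injective≤1 (suc k) a c inj with a k ≟ c
... | no  ≢c   = ≤-trans (≤-reflexive (cong (λ b → 𝟙 b + ∑ k (λ l → 𝟙 (a l ≡ᵇ c))) (≡ᵇ-false ≢c)))
                   (∑-injective≤1 k a c λ l l′ l< l′< → inj l l′ (m<n⇒m<1+n l<) (m<n⇒m<1+n l′<))
... | yes refl = ≤-reflexive (cong₂ _+_ (cong 𝟙 (≡ᵇ-true {a k} refl)) (∑-empty k _ λ l l< → ≡ᵇ-false λ eq → <⇒≢ l< (inj l k (m<n⇒m<1+n l<) (n<1+n k) eq)))

positive-≤1 : ∀ {x} → x ≤ 1 → x ≡ 𝟙 (0 <ᵇ x)
positive-≤1 {zero}  _ = refl
positive-≤1 {suc zero} _ = refl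
positive-≤1 {suc (suc x)} (s≤s ())

marks-tabulate : ∀ n (p : ℕ → Bool) → Marks {n} p (tabulate (p ∘ age))
marks-tabulate n p .mark i = sym (Vec.lookup∘tabulate (p ∘ age) i)

-- The size follows by double counting the pairs of a selector and its input. Injectivity bounds
-- each `hits c` by 1, which makes it an indicator.
subset-of-selection : ∀ n k (a : ℕ → ℕ) → (∀ l → l < k → a l < n) → (∀ l l′ → l < k → l′ < k → a l ≡ a l′ → l ≡ l′) →
                      ∃ λ (A : Subset n) → ∣ A ∣ ≡ k × Selection k a A
subset-of-selection n k a in-range injective = A , size , record { in-range = in-range ; injective = injective ; selects = selects }
  where
  hits : ℕ → ℕ
  hits c = ∑ k λ l → 𝟙 (a l ≡ᵇ c)
  p : ℕ → Bool
  p c = 0 <ᵇ hits c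
  A : Subset n
  A = tabulate (p ∘ age)
  hits-𝟙 : ∀ c → hits c ≡ 𝟙 (p c)
  hits-𝟙 c = positive-≤1 (∑-injective≤1 k a c injective)
  selects : ∀ i → hits (age i) ≡ 𝟙 (lookup A i)
  selects i = trans (hits-𝟙 (age i)) (cong 𝟙 (sym (Vec.lookup∘tabulate (p ∘ age) i)))
  size : ∣ A ∣ ≡ k
  size = begin
      ∣ A ∣                                       ≡⟨ sym (marks-∑ {p = p} A (marks-tabulate n p)) ⟩
      ∑ n (λ c → 𝟙 (p c))                         ≡⟨ ∑-cong n (λ c _ → sym (hits-𝟙 c)) ⟩
      ∑ n (λ c → ∑ k λ l → 𝟙 (a l ≡ᵇ c))          ≡⟨ ∑-swap n k _ ⟩
      ∑ k (λ l → ∑ n λ c → 𝟙 (a l ≡ᵇ c))          ≡⟨ ∑-cong k (λ l l< → trans (∑-cong n λ c _ → trans (cong 𝟙 (flip-≡ᵇ (a l) c)) (sym (*-identityʳ _))) (∑-single n (λ _ → 1) (a l) (in-range l l<))) ⟩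
      ∑ k (λ _ → 1)                               ≡⟨ trans (∑-const k 1) (*-identityʳ k) ⟩
      k                                           ∎
    where
    open ≡-Reasoning
    flip-≡ᵇ : ∀ x y → (x ≡ᵇ y) ≡ (y ≡ᵇ x)
    flip-≡ᵇ x y = does-≡ (x ≟ y) (y ≡ᵇ x) (≡ᵇ-true ∘ sym) (sym ∘ ≡ᵇ-true⁻ y x)

-- Weighted circuit satisfiability as a system.  The variables are the
-- selectors i < k and one variable k + J for the share of each tuple J of
-- selectors in the total; row J determines the share, and the last row
-- decodes the total.

module CircuitSystem (top n k size : ℕ) (negation conjunction : ℕ → Bool) (input : ℕ → ℕ → Bool) where

  open CircuitForms n k size negation conjunction input public

  output modulus tuples variables copies rows : ℕ
  output    = pred size
  -- One level more than the depth bound demands. Tuples then consist of two halves of level `top`,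
  -- so that some tuple contains any given pair of selectors, as `distinct` requires.
  modulus   = base (suc top)
  tuples    = radix (suc top)
  variables = k + tuples
  -- At least both limits, and at least 2, so that the hub graph has enough switches.
  copies    = 2 + (n + modulus)
  rows      = suc tuples

  -- The remainder keeps the share within the limit of its variable. Nothing is lost, as the total
  -- is decoded modulo `modulus` only.
  share : ℕ → ℕ → ℕ
  share J b = rem (packed modulus (suc top) output J b) modulus

  -- The coefficient of selector `i` in the code of the inputs selected by `J`: a number in base `n`
  -- is linear in its digits (`selection-digits`).
  digit : ℕ → ℕ → ℕ → ℕ
  digit zero    J i = 𝟙 (i ≡ᵇ J)
  digit (suc e) J i = span e * digit e (quot J (radix e)) i + digit e (rem J (radix e)) i

  coefficient : ℕ → ℕ → ℕ
  coefficient j i =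
    -- The form of row `j` has the code of the selected inputs as remainder and the variable of the
    -- share as quotient modulo `span (suc top)`. So `admits` can impose any relation between the
    -- two.
    if j <ᵇ tuples then (if i <ᵇ k then digit (suc top) j i else 𝟙 (i ≡ᵇ k + j) * span (suc top))
    else (if i <ᵇ k then 0 else 1)

  limit : ℕ → ℕ
  limit i = if i <ᵇ k then n ∸ 1 else modulus

  -- Tuples of the form (i , …) with i < k select pairwise different inputs.

  distinct : ℕ → ℕ → Bool
  distinct J b = not (((rem J (radix top) <ᵇ k) ∧ (quot J (radix top) <ᵇ k)) ∧ not (rem J (radix top) ≡ᵇ quot J (radix top)))
                 ∨ not (rem b (span top) ≡ᵇ quot b (span top))

  admits : ℕ → ℕ → Bool
  admits j y =
    if j <ᵇ tuples then (share j (rem y (span (suc top))) ≡ᵇ quot y (span (suc top))) ∧ distinct j (rem y (span (suc top)))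
    else unpacked (suc top) output (rem y modulus)

  open SystemGraph variables copies rows coefficient limit admits public

module CircuitCorrectness (top n k others : ℕ) (negation conjunction : ℕ → Bool) (input : ℕ → ℕ → Bool)
  (C : Circuit n (suc others)) (described : Describes negation conjunction input C)
  (deep : Vec.head (depths C) ≤ top) (light : Vec.head (wefts C) ≤ 1) where

  open CircuitSystem top n k (suc others) negation conjunction input

  private
    E = suc top

  0<n : 0 < n
  0<n = inputs-nonempty C z<s

  0<modulus : 0 < modulus
  0<modulus = go E
    where
    go : ∀ e → 0 < base e
    go zero    = z<s
    go (suc e) = *-mono-≤ (go e) (go e)

  k<radix : ∀ e → k < radix e
  k<radix zero    = n<1+n k
  k<radix (suc e) = <-≤-trans (k<radix e) (m≤n*m (radix e) (radix e) {{>-nonZero (≤-<-trans z≤n (k<radix e))}})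

  selection-cong : ∀ {a a′} → (∀ i → i < k → a i ≡ a′ i) → ∀ e J → selection a e J ≡ selection a′ e J
  selection-cong eq zero J with J <? k
  ... | yes J<k rewrite <ᵇ-true J<k = eq J J<k
  ... | no  J≮k rewrite <ᵇ-false (≮⇒≥ J≮k) = refl
  selection-cong eq (suc e) J = cong₂ (λ x y → span e * x + y) (selection-cong eq e _) (selection-cong eq e _)

  selection-digits : ∀ (z : ℕ → ℕ) e J → ∑ k (λ i → digit e J i * z i) ≡ selection z e J
  selection-digits z zero J with J <? k
  ... | yes J<k rewrite <ᵇ-true J<k = ∑-single k z J J<k
  ... | no  J≮k rewrite <ᵇ-false (≮⇒≥ J≮k) = ∑-zero k λ i i<k → cong (λ b → 𝟙 b * z i) (≡ᵇ-false (<⇒≢ (<-≤-trans i<k (≮⇒≥ J≮k))))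
  selection-digits z (suc e) J = begin
      ∑ k (λ i → (span e * digit e J₂ i + digit e J₁ i) * z i)
    ≡⟨ ∑-cong k (λ i _ → arith (span e) (digit e J₂ i) (digit e J₁ i) (z i)) ⟩
      ∑ k (λ i → span e * (digit e J₂ i * z i) + digit e J₁ i * z i)
    ≡⟨ trans (∑-+ k (λ i → span e * (digit e J₂ i * z i)) (λ i → digit e J₁ i * z i)) (cong (_+ ∑ k (λ i → digit e J₁ i * z i)) (∑-*ˡ k (span e) (λ i → digit e J₂ i * z i))) ⟩
      span e * ∑ k (λ i → digit e J₂ i * z i) + ∑ k (λ i → digit e J₁ i * z i)
    ≡⟨ cong₂ (λ x y → span e * x + y) (selection-digits z e J₂) (selection-digits z e J₁) ⟩
      selection z (suc e) J
    ∎
    where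
    open ≡-Reasoning
    J₁ = rem J (radix e)
    J₂ = quot J (radix e)
    arith : ∀ N a b c → (N * a + b) * c ≡ N * (a * c) + b * c
    arith = solve-∀

  tuple-row : ∀ (z : ℕ → ℕ) j → j < tuples → ∑ variables (λ i → coefficient j i * z i) ≡ span E * z (k + j) + selection z E j
  tuple-row z j j< = begin
      ∑ variables (λ i → coefficient j i * z i)
    ≡⟨ ∑-append k tuples _ ⟩
      ∑ k (λ i → coefficient j i * z i) + ∑ tuples (λ J → coefficient j (k + J) * z (k + J))
    ≡⟨ cong₂ _+_ (trans (∑-cong k λ i i<k → cong (_* z i) (trans (if-true (<ᵇ-true j<)) (if-true (<ᵇ-true i<k)))) (selection-digits z E j))
         (trans (∑-cong tuples λ J J< → trans (cong (_* z (k + J)) (trans (if-true (<ᵇ-true j<)) (trans (if-false (<ᵇ-false (m≤m+n k J))) (cong (λ b → 𝟙 b * span E) (shift J))))) (*-assoc (𝟙 (J ≡ᵇ j)) _ _))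
           (∑-single tuples (λ J → span E * z (k + J)) j j<)) ⟩
      selection z E j + span E * z (k + j)
    ≡⟨ +-comm (selection z E j) _ ⟩
      span E * z (k + j) + selection z E j
    ∎
    where
    open ≡-Reasoning
    shift : ∀ J → (k + J ≡ᵇ k + j) ≡ (J ≡ᵇ j)
    shift J = does-≡ (k + J ≟ k + j) (J ≡ᵇ j) (λ eq → ≡ᵇ-true (+-cancelˡ-≡ k J j eq)) (λ eq → cong (k +_) (≡ᵇ-true⁻ J j eq))

  last-row : ∀ (z : ℕ → ℕ) → ∑ variables (λ i → coefficient tuples i * z i) ≡ ∑ tuples (λ J → z (k + J))
  last-row z = trans (∑-append k tuples _) (cong₂ _+_
    (∑-zero k λ i i<k → cong (_* z i) (trans (if-false (<ᵇ-false {tuples} ≤-refl)) (if-true (<ᵇ-true i<k))))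
    (∑-cong tuples λ J _ → trans (cong (_* z (k + J)) (trans (if-false (<ᵇ-false {tuples} ≤-refl)) (if-false (<ᵇ-false (m≤m+n k J))))) (*-identityˡ _)))

  -- At level `e` the code `i < k` is the tuple (i, 0, ..., 0), so all digits of the selection
  -- except the lowest are the same for every `i`. Two such selections coincide exactly if the
  -- selectors have equal values.
  selection-offset : ∀ (z : ℕ → ℕ) e → ∃ λ r → ∀ i → i < k → selection z e i ≡ z i + r
  selection-offset z zero = 0 , λ i i<k → trans (if-true (<ᵇ-true i<k)) (sym (+-identityʳ (z i)))
  selection-offset z (suc e) with selection-offset z e
  ... | r , eq = r + span e * selection z e 0 , λ i i<k →
    trans (cong₂ (λ J₂ J₁ → span e * selection z e J₂ + selection z e J₁) (quot-small i i<k) (rem-small i i<k))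
      (trans (cong (span e * selection z e 0 +_) (eq i i<k)) (arith (span e * selection z e 0) (z i) r))
    where
    arith : ∀ s z r → s + (z + r) ≡ z + (r + s)
    arith = solve-∀
    small : ∀ i → i ≡ radix e * 0 + i
    small i = cong (_+ i) (sym (*-zeroʳ (radix e)))
    quot-small : ∀ i → i < k → quot i (radix e) ≡ 0
    quot-small i i<k = trans (cong (λ x → quot x (radix e)) (small i)) (quot-unique (radix e) 0 (<-trans i<k (k<radix e)))
    rem-small : ∀ i → i < k → rem i (radix e) ≡ i
    rem-small i i<k = trans (cong (λ x → rem x (radix e)) (small i)) (rem-unique (radix e) 0 (<-trans i<k (k<radix e)))

  module Shares {A : Subset n} {z : ℕ → ℕ} (sel : Selection k z A) (shares : ∀ J → J < tuples → share J (selection z E J) ≡ z (k + J)) where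
    open Selection sel
    open CircuitValues n k (suc others) negation conjunction input 0<n z in-range A selects modulus 0<modulus using (packed-value; Packed)

    -- Modulo `modulus`, shares agree with values of `packed`, so their sum agrees with the number
    -- of the output node. That number is below `modulus` and is therefore the remainder.
    decoded-output : admits tuples (∑ variables λ i → coefficient tuples i * z i) ≡ Vec.head (values C A)
    decoded-output = begin
        admits tuples (∑ variables λ i → coefficient tuples i * z i)
      ≡⟨ if-false (<ᵇ-false {tuples} ≤-refl) ⟩
        unpacked E output (rem (∑ variables λ i → coefficient tuples i * z i) modulus)
      ≡⟨ cong (unpacked E output) (rem-≈ bounded (≈-trans (≈-reflexive (last-row z)) (≈-trans (≈-∑ tuples entry) counts))) ⟩
        unpacked E output number
      ≡⟨ decodes ⟩
        lookup (values C A) zero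
      ≡⟨ first (values C A) ⟩
        Vec.head (values C A)
      ∎
      where
      open ≡-Reasoning
      first : ∀ {A : Set} {m} (v : Vec A (suc m)) → lookup v zero ≡ Vec.head v
      first (x ∷ v) = refl
      open Packed (packed-value C described ≤-refl zero E (≤-trans (≤-reflexive (first (depths C))) (m≤n⇒m≤1+n deep)) (≤-trans (≤-reflexive (first (wefts C))) light))
      entry : ∀ J → J < tuples → z (k + J) ≈[ modulus ] packed modulus E output J (selection z E J)
      entry J J< = ≈-trans (≈-reflexive (sym (shares J J<))) (≈-rem _ 0<modulus)

  selection<span : ∀ {z} → (∀ i → i < k → z i < n) → ∀ e J → selection z e J < span e
  selection<span {z} z<n = SelectionSums.selection< n k (suc others) negation conjunction input 0<n z z<n

  satisfying⇒solution : (∃[ A ] ∣ A ∣ ≡ k × Vec.head (values C A) ≡ true) → ∃ Solution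
  satisfying⇒solution (A , size , sat) with select-subset A
  ... | a , sel₀ = z , limits , holds
    where
    sel : Selection k a A
    sel = subst (λ k → Selection k a A) size sel₀
    open Selection sel
    z : ℕ → ℕ
    z i = if i <ᵇ k then a i else share (i ∸ k) (selection a E (i ∸ k))
    z-first : ∀ i → i < k → z i ≡ a i
    z-first i i<k = if-true (<ᵇ-true i<k)
    z-share : ∀ J → z (k + J) ≡ share J (selection a E J)
    z-share J = trans (if-false (<ᵇ-false (m≤m+n k J))) (cong (λ J → share J (selection a E J)) (m+n∸m≡n k J))
    same : ∀ e J → selection z e J ≡ selection a e J
    same = selection-cong z-first
    z<n : ∀ i → i < k → z i < n
    z<n i i<k = subst (_< n) (sym (z-first i i<k)) (in-range i i<k)
    limits : ∀ i → i < variables → z i ≤ limit i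
    limits i _ with i <? k
    ... | yes i<k rewrite <ᵇ-true i<k = <⇒≤pred (in-range i i<k)
    ... | no  i≮k rewrite <ᵇ-false (≮⇒≥ i≮k) = <⇒≤ (rem< _ 0<modulus)
    sel-z : Selection k z A
    sel-z = record
      { in-range  = z<n
      ; injective = λ l l′ l< l′< eq → injective l l′ l< l′< (trans (sym (z-first l l<)) (trans eq (z-first l′ l′<)))
      ; selects   = λ i → trans (∑-cong k λ l l< → cong (λ x → 𝟙 (x ≡ᵇ age i)) (z-first l l<)) (selects i)
      }
    all-distinct : ∀ J → distinct J (selection z E J) ≡ true
    all-distinct J with rem J (radix top) <ᵇ k in lt₁ | quot J (radix top) <ᵇ k in lt₂ | rem J (radix top) ≡ᵇ quot J (radix top) in eq
    ... | false | _     | _    = refl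
    ... | true  | false | _    = refl
    ... | true  | true  | true = refl
    ... | true  | true  | false = cong not (≡ᵇ-false λ same-digits → true≢false
      (≡ᵇ-true (injective _ _ (<ᵇ-true⁻ _ k lt₁) (<ᵇ-true⁻ _ k lt₂) (trans (sym (z-first _ (<ᵇ-true⁻ _ k lt₁))) (trans (+-cancelʳ-≡ r _ _
        (trans (sym (offset _ (<ᵇ-true⁻ _ k lt₁))) (trans (sym (rem-unique (span top) _ (selection<span z<n top _)))
          (trans same-digits (trans (quot-unique (span top) _ (selection<span z<n top _)) (offset _ (<ᵇ-true⁻ _ k lt₂))))))) (z-first _ (<ᵇ-true⁻ _ k lt₂)))))) eq)
      where
      r = proj₁ (selection-offset z top)
      offset = proj₂ (selection-offset z top)
    tuple-admits : ∀ j → j < tuples → admits j (∑ variables λ i → coefficient j i * z i) ≡ true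
    tuple-admits j j< = trans (cong (admits j) (tuple-row z j j<)) (trans (if-true (<ᵇ-true j<))
      (trans (cong₂ (λ r q → (share j r ≡ᵇ q) ∧ distinct j r) (rem-unique (span E) (z (k + j)) (selection<span z<n E j)) (quot-unique (span E) (z (k + j)) (selection<span z<n E j)))
        (∧-true (≡ᵇ-true (trans (cong (share j) (same E j)) (sym (z-share j)))) (all-distinct j))))
    holds : ∀ j → j < rows → admits j (∑ variables λ i → coefficient j i * z i) ≡ true
    holds j j< with m≤n⇒m<n∨m≡n (s≤s⁻¹ j<)
    ... | inj₁ j<tuples = tuple-admits j j<tuples
    ... | inj₂ refl     = trans (Shares.decoded-output sel-z (λ J _ → trans (cong (share J) (same E J)) (sym (z-share J)))) sat

  solution⇒satisfying : ∃ Solution → ∃[ A ] ∣ A ∣ ≡ k × Vec.head (values C A) ≡ true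
  solution⇒satisfying (z , limits , holds) = A , size , trans (sym (Shares.decoded-output sel shares)) (holds tuples (n<1+n tuples))
    where
    z<n : ∀ i → i < k → z i < n
    z<n i i<k = ≤-<-trans (≤-trans (limits i (<-≤-trans i<k (m≤m+n k tuples))) (≤-reflexive (if-true (<ᵇ-true i<k)))) (∸-monoʳ-< z<s 0<n)
    row-holds : ∀ j → j < tuples → (share j (selection z E j) ≡ᵇ z (k + j)) ∧ distinct j (selection z E j) ≡ true
    row-holds j j< = trans
      (sym (trans (cong (admits j) (tuple-row z j j<)) (trans (if-true (<ᵇ-true j<))
        (cong₂ (λ r q → (share j r ≡ᵇ q) ∧ distinct j r) (rem-unique (span E) (z (k + j)) (selection<span z<n E j)) (quot-unique (span E) (z (k + j)) (selection<span z<n E j))))))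
      (holds j (m<n⇒m<1+n j<))
    shares : ∀ J → J < tuples → share J (selection z E J) ≡ z (k + J)
    shares J J< = ≡ᵇ-true⁻ _ _ (proj₁ (∧-true⁻ (row-holds J J<)))
    r = proj₁ (selection-offset z top)
    offset = proj₂ (selection-offset z top)
    injective : ∀ l l′ → l < k → l′ < k → z l ≡ z l′ → l ≡ l′
    injective l l′ l< l′< eq with l ≟ l′
    ... | yes l≡l′ = l≡l′
    ... | no  l≢l′ = true≢false (proj₂ (∧-true⁻ {share J (selection z E J) ≡ᵇ z (k + J)} (row-holds J (pair< (<-trans l′< (k<radix top)) (<-trans l< (k<radix top)))))) clash
      where
      -- The tuple whose halves are the codes `l` and `l′`. Its row rejects equal values of these
      -- two selectors.
      J = radix top * l′ + l
      clash : distinct J (selection z E J) ≡ false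
      clash rewrite rem-unique (radix top) l′ (<-trans l< (k<radix top)) | quot-unique (radix top) l′ (<-trans l< (k<radix top))
                  | <ᵇ-true l< | <ᵇ-true l′< | ≡ᵇ-false l≢l′
                  | rem-unique (span top) (selection z top l′) (selection<span z<n top l) | quot-unique (span top) (selection z top l′) (selection<span z<n top l)
        = cong not (≡ᵇ-true (trans (offset l l<) (trans (cong (_+ r) eq) (sym (offset l′ l′<)))))
    subset = subset-of-selection n k z z<n injective
    A = proj₁ subset
    size = proj₁ (proj₂ subset)
    sel = proj₂ (proj₂ subset)

-- Functions on words and numbers that are computed by terms

-- Indexing by the computed function makes the construction of a term a transcription of the
-- definition, with the proof of correctness built along the way.
record Exp {r} (g : Word → Vec ℕ r → ℕ) : Set where
  constructor exp
  field
    term  : Term r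
    sound : ∀ w ρ → eval w term ρ ≡ g w ρ

open Exp

BExp : ∀ {r} → (Word → Vec ℕ r → Bool) → Set
BExp g = Exp (λ w ρ → 𝟙 (g w ρ))

-- Wrapped in records so that `f` can be inferred from a value of type `Fun₀ f`; the same goes for
-- the other arities.
record Fun₀ (f : Word → ℕ) : Set where
  constructor fun₀
  field
    body : Exp {0} (λ w ρ → f w)

record Fun₁ (f : Word → ℕ → ℕ) : Set where
  constructor fun₁
  field
    body : Exp {1} (λ w ρ → f w (lookup ρ zero))

record Fun₂ (f : Word → ℕ → ℕ → ℕ) : Set where
  constructor fun₂
  field
    body : Exp {2} (λ w ρ → f w (lookup ρ zero) (lookup ρ (suc zero)))

record Fun₃ (f : Word → ℕ → ℕ → ℕ → ℕ) : Set where
  constructor fun₃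
  field
    body : Exp {3} (λ w ρ → f w (lookup ρ zero) (lookup ρ (suc zero)) (lookup ρ (suc (suc zero))))

Pred₁ : (Word → ℕ → Bool) → Set
Pred₁ p = Fun₁ (λ w x → 𝟙 (p w x))

Pred₂ : (Word → ℕ → ℕ → Bool) → Set
Pred₂ p = Fun₂ (λ w x y → 𝟙 (p w x y))

v₀ : ∀ {r} → Exp {suc r} (λ w ρ → lookup ρ zero)
v₀ = exp (var zero) λ _ _ → refl

v₁ : ∀ {r} → Exp {2 + r} (λ w ρ → lookup ρ (suc zero))
v₁ = exp (var (suc zero)) λ _ _ → refl

v₂ : ∀ {r} → Exp {3 + r} (λ w ρ → lookup ρ (suc (suc zero)))
v₂ = exp (var (suc (suc zero))) λ _ _ → refl

v₃ : ∀ {r} → Exp {4 + r} (λ w ρ → lookup ρ (suc (suc (suc zero))))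
v₃ = exp (var (suc (suc (suc zero)))) λ _ _ → refl

v₄ : ∀ {r} → Exp {5 + r} (λ w ρ → lookup ρ (suc (suc (suc (suc zero)))))
v₄ = exp (var (suc (suc (suc (suc zero))))) λ _ _ → refl

#_ : ∀ {r} n → Exp {r} (λ w ρ → n)
# n = exp (lit n) λ _ _ → refl

lengthE : ∀ {r} → Exp {r} (λ w ρ → length w)
lengthE = exp inputLen λ _ _ → refl

cast : ∀ {r} {g h : Word → Vec ℕ r → ℕ} → (∀ w ρ → g w ρ ≡ h w ρ) → Exp g → Exp h
cast eq (exp t s) = exp t λ w ρ → trans (s w ρ) (eq w ρ)

module _ {r} {g h : Word → Vec ℕ r → ℕ} where

  infixl 6 _+E_ _∸E_
  infixl 7 _*E_

  _+E_ : Exp g → Exp h → Exp (λ w ρ → g w ρ + h w ρ)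
  exp t s +E exp u s′ = exp (t ⊕ u) λ w ρ → cong₂ _+_ (s w ρ) (s′ w ρ)

  _∸E_ : Exp g → Exp h → Exp (λ w ρ → g w ρ ∸ h w ρ)
  exp t s ∸E exp u s′ = exp (t ⊖ u) λ w ρ → cong₂ _∸_ (s w ρ) (s′ w ρ)

  _*E_ : Exp g → Exp h → Exp (λ w ρ → g w ρ * h w ρ)
  exp t s *E exp u s′ = exp (t ⊗ u) λ w ρ → trans (eval-⊗ w t u ρ) (cong₂ _*_ (s w ρ) (s′ w ρ))

∑E : ∀ {r} {g : Word → Vec ℕ r → ℕ} {h : Word → Vec ℕ (suc r) → ℕ} → Exp g → Exp h → Exp (λ w ρ → ∑ (g w ρ) (λ i → h w (i ∷ ρ)))
∑E {g = g} {h} (exp t s) (exp u s′) = exp (sumOf t u) λ w ρ →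
  trans (cong (λ n → ∑ n λ i → eval w u (i ∷ ρ)) (s w ρ)) (∑-cong (g w ρ) λ i _ → s′ w (i ∷ ρ))

0<ᵇ-𝟙 : ∀ n → 1 ∸ (1 ∸ n) ≡ 𝟙 (0 <ᵇ n)
0<ᵇ-𝟙 zero    = refl
0<ᵇ-𝟙 (suc n) = cong (1 ∸_) (0∸n≡0 n)

𝟙-not : ∀ b → 1 ∸ 𝟙 b ≡ 𝟙 (not b)
𝟙-not true  = refl
𝟙-not false = refl

𝟙-∨ : ∀ a b → 1 ∸ (1 ∸ (𝟙 a + 𝟙 b)) ≡ 𝟙 (a ∨ b)
𝟙-∨ true  true  = refl
𝟙-∨ true  false = refl
𝟙-∨ false true  = refl
𝟙-∨ false false = refl

∸+∸-≡ᵇ : ∀ m n → 1 ∸ ((m ∸ n) + (n ∸ m)) ≡ 𝟙 (m ≡ᵇ n)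
∸+∸-≡ᵇ zero    zero    = refl
∸+∸-≡ᵇ zero    (suc n) = 0∸n≡0 n
∸+∸-≡ᵇ (suc m) zero    = 0∸n≡0 (m + 0)
∸+∸-≡ᵇ (suc m) (suc n) = ∸+∸-≡ᵇ m n

if-sum : ∀ b x y → 𝟙 b * x + (1 ∸ 𝟙 b) * y ≡ (if b then x else y)
if-sum true  x y = trans (+-identityʳ _) (*-identityˡ x)
if-sum false x y = *-identityˡ y

module _ {r} {g h : Word → Vec ℕ r → ℕ} where

  infix 4 _≡E_ _<E_

  _≡E_ : Exp g → Exp h → BExp (λ w ρ → g w ρ ≡ᵇ h w ρ)
  a ≡E b = cast (λ w ρ → ∸+∸-≡ᵇ (g w ρ) (h w ρ)) (# 1 ∸E ((a ∸E b) +E (b ∸E a)))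

  _<E_ : Exp g → Exp h → BExp (λ w ρ → g w ρ <ᵇ h w ρ)
  a <E b = cast (λ w ρ → trans (0<ᵇ-𝟙 (h w ρ ∸ g w ρ)) (cong 𝟙 (0<ᵇ∸ (h w ρ) (g w ρ)))) (# 1 ∸E (# 1 ∸E (b ∸E a)))

  ifE : ∀ {c : Word → Vec ℕ r → Bool} → BExp c → Exp g → Exp h → Exp (λ w ρ → if c w ρ then g w ρ else h w ρ)
  ifE {c} p a b = cast (λ w ρ → if-sum (c w ρ) (g w ρ) (h w ρ)) (p *E a +E (# 1 ∸E p) *E b)

notE : ∀ {r} {c : Word → Vec ℕ r → Bool} → BExp c → BExp (λ w ρ → not (c w ρ))
notE {c = c} p = cast (λ w ρ → 𝟙-not (c w ρ)) (# 1 ∸E p)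

module _ {r} {c d : Word → Vec ℕ r → Bool} where

  infixl 3 _∧E_ _∨E_

  _∧E_ : BExp c → BExp d → BExp (λ w ρ → c w ρ ∧ d w ρ)
  p ∧E q = cast (λ w ρ → sym (𝟙-∧ (c w ρ) (d w ρ))) (p *E q)

  _∨E_ : BExp c → BExp d → BExp (λ w ρ → c w ρ ∨ d w ρ)
  p ∨E q = cast (λ w ρ → 𝟙-∨ (c w ρ) (d w ρ)) (# 1 ∸E (# 1 ∸E (p +E q)))

  ifB : ∀ {b : Word → Vec ℕ r → Bool} → BExp b → BExp c → BExp d → BExp (λ w ρ → if b w ρ then c w ρ else d w ρ)
  ifB {b} i p q = cast (λ w ρ → if-𝟙 (b w ρ) (c w ρ) (d w ρ)) (ifE i p q)
    where
    if-𝟙 : ∀ b c d → (if b then 𝟙 c else 𝟙 d) ≡ 𝟙 (if b then c else d)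
    if-𝟙 true  c d = refl
    if-𝟙 false c d = refl

bitE : ∀ {r} {g : Word → Vec ℕ r → ℕ} → Exp g → BExp (λ w ρ → bitAt w (g w ρ))
bitE (exp t s) = exp (bitOf t) λ w ρ → cong (λ i → 𝟙 (bitAt w i)) (s w ρ)

call₀ : ∀ {r f} → Fun₀ f → Exp {r} (λ w ρ → f w)
call₀ (fun₀ (exp t s)) = exp (call t []) λ w ρ → s w []

call₁ : ∀ {r f} {g : Word → Vec ℕ r → ℕ} → Fun₁ f → Exp g → Exp (λ w ρ → f w (g w ρ))
call₁ {f = f} (fun₁ (exp t s)) (exp a p) = exp (call t (a ∷ [])) λ w ρ → trans (s w _) (cong (f w) (p w ρ))

call₂ : ∀ {r f} {g h : Word → Vec ℕ r → ℕ} → Fun₂ f → Exp g → Exp h → Exp (λ w ρ → f w (g w ρ) (h w ρ))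
call₂ {f = f} (fun₂ (exp t s)) (exp a p) (exp b q) = exp (call t (a ∷ b ∷ [])) λ w ρ → trans (s w _) (cong₂ (f w) (p w ρ) (q w ρ))

call₃ : ∀ {r f} {g h i : Word → Vec ℕ r → ℕ} → Fun₃ f → Exp g → Exp h → Exp i → Exp (λ w ρ → f w (g w ρ) (h w ρ) (i w ρ))
call₃ {f = f} (fun₃ (exp t s)) (exp a p) (exp b q) (exp c r) = exp (call t (a ∷ b ∷ c ∷ [])) λ w ρ →
  trans (s w _) (trans (cong (λ x → f w x _ _) (p w ρ)) (cong₂ (f w _) (q w ρ) (r w ρ)))

quotF : Fun₂ (λ w m n → quot m n)
quotF = fun₂ (cast (λ w ρ → sym (quot-def (lookup ρ zero) (lookup ρ (suc zero)))) (∑E v₀ ((# 1 +E v₀) *E v₂ <E # 1 +E v₁)))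

remF : Fun₂ (λ w m n → rem m n)
remF = fun₂ (cast (λ w ρ → sym (rem-def (lookup ρ zero) (lookup ρ (suc zero)))) (v₀ ∸E v₁ *E call₂ quotF v₀ v₁))

module _ {r} {g h : Word → Vec ℕ r → ℕ} where

  quotE : Exp g → Exp h → Exp (λ w ρ → quot (g w ρ) (h w ρ))
  quotE = call₂ quotF

  remE : Exp g → Exp h → Exp (λ w ρ → rem (g w ρ) (h w ρ))
  remE = call₂ remF

-- The length of the longest initial segment of the numbers below l that
-- satisfies p

lead : (ℕ → Bool) → ℕ → ℕ
lead p l = ∑ l λ i → 𝟙 ((∑ (suc i) λ j → 𝟙 (not (p j))) ≡ᵇ 0)

lead-unique : ∀ (p : ℕ → Bool) l r → r ≤ l → (∀ j → j < r → p j ≡ true) → p r ≡ false → lead p l ≡ r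
lead-unique p l r r≤l holds fails = trans (∑-cong l λ i _ → cong 𝟙 (entry i)) (∑-threshold l r r≤l)
  where
  entry : ∀ i → ((∑ (suc i) λ j → 𝟙 (not (p j))) ≡ᵇ 0) ≡ (i <ᵇ r)
  entry i with i <? r
  ... | yes i<r = trans (≡ᵇ-true (∑-zero (suc i) {λ j → 𝟙 (not (p j))} λ j j≤i → cong (𝟙 ∘ not) (holds j (≤-trans j≤i i<r)))) (sym (<ᵇ-true i<r))
  ... | no  i≮r = trans (≡ᵇ-false λ eq → case trans (cong (𝟙 ∘ not) (sym fails)) (∑-zero⁻ (suc i) {λ j → 𝟙 (not (p j))} eq r (s≤s (≮⇒≥ i≮r))) of λ ())
                    (sym (<ᵇ-false (≮⇒≥ i≮r)))

-- Reading a circuit off its encoding: the gate of age v is encoded from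
-- position offset n v on.

offset : ℕ → ℕ → ℕ
offset n v = suc n + ∑ v λ i → if i <ᵇ n then 0 else 3 + i

-- All three counts are lengths of runs of true: in the header, over the flags in front of the
-- gates, and in the weight. The offset of the next gate is `3 + i` further because a gate of age
-- `i` takes a flag, two bits for its kind and `i` bits for its inputs.
inputCount gateCount nodeCount weightCount : Word → ℕ
inputCount w  = lead (bitAt w) (length w)
gateCount w   = lead (λ g → bitAt w (offset (inputCount w) (inputCount w + g))) (length w)
nodeCount w   = inputCount w + gateCount w
weightCount w = lead (λ j → bitAt w (suc (offset (inputCount w) (nodeCount w)) + j)) (length w)

negationAt conjunctionAt : Word → ℕ → Bool
negationAt w v    = not (bitAt w (offset (inputCount w) v + 1))
conjunctionAt w v = not (bitAt w (offset (inputCount w) v + 2))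

inputAt : Word → ℕ → ℕ → Bool
-- Input bits are stored newest node first, so the node of age `c` has index `v ∸ suc c`.
inputAt w v c = bitAt w (offset (inputCount w) v + (3 + (v ∸ suc c)))

bitAt-++ʳ : ∀ xs ys i → bitAt (xs ++ ys) (length xs + i) ≡ bitAt ys i
bitAt-++ʳ []       ys i = refl
bitAt-++ʳ (x ∷ xs) ys i = bitAt-++ʳ xs ys i

bitAt-replicate : ∀ n ys j → j < n → bitAt (replicate n true ++ ys) j ≡ true
bitAt-replicate (suc n) ys zero    _       = refl
bitAt-replicate (suc n) ys (suc j) (s≤s j<) = bitAt-replicate n ys j j<

bitAt-toList : ∀ {w} (s : Vec Bool w) ys i → bitAt (toList s ++ ys) (toℕ i) ≡ lookup s i
bitAt-toList (b ∷ s) ys zero    = refl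
bitAt-toList (b ∷ s) ys (suc i) = bitAt-toList s ys i

toℕ+age : ∀ {w} (i : Fin w) → w ∸ suc (age i) ≡ toℕ i
toℕ+age i = trans (cong (_∸ suc (age i)) (sym (total i))) (m+n∸n≡m (toℕ i) (suc (age i)))
  where
  total : ∀ {w} (i : Fin w) → toℕ i + suc (age i) ≡ w
  total {suc w} zero    = refl
  total {suc w} (suc i) = cong suc (total i)

length-encodeGate : ∀ {w} (g : Gate w) → length (encodeGate g) ≡ 2 + w
length-encodeGate (NOT i)   = cong (2 +_) (Vec.length-toList ⁅ i ⁆)
length-encodeGate (AND s _) = cong (2 +_) (Vec.length-toList s)
length-encodeGate (OR s _)  = cong (2 +_) (Vec.length-toList s)

module _ (word : Word) (n : ℕ) where
  private
    negation conjunction : ℕ → Bool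
    negation v    = not (bitAt word (offset n v + 1))
    conjunction v = not (bitAt word (offset n v + 2))
    input : ℕ → ℕ → Bool
    input v c = bitAt word (offset n v + (3 + (v ∸ suc c)))

  record Reads {w} (C : Circuit n w) (start : ℕ) : Set where
    field
      position  : offset n w ≡ start + length (encodeGates C)
      described : Describes negation conjunction input C
      flagged   : ∀ v → n ≤ v → v < w → bitAt word (offset n v) ≡ true

  -- Gates are encoded oldest first but peeled off newest first. So the induction keeps `word` and
  -- `pre` fixed and moves the peeled gate into `post`.
  reads : ∀ {w} (C : Circuit n w) pre post → length pre ≡ suc n → word ≡ pre ++ (encodeGates C ++ post) → Reads C (length pre)
  reads inputs pre post len eq = record
    { position  = trans (cong (suc n +_) (∑-zero n λ i i<n → if-true (<ᵇ-true i<n))) (cong (_+ 0) (sym len))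
    ; described = tt
    ; flagged   = λ v n≤v v<n → contradiction v<n (≤⇒≯ n≤v)
    }
  reads {suc w} (C ▷ g) pre post len eq = record
    { position  = next
    ; described = described , kind-negation g refl , kind-conjunction g refl , marks (λ i → trans (cong (λ j → bitAt word (offset n w + (3 + j))) (toℕ+age i)) (kind-inputs g i refl))
    ; flagged   = λ v n≤v v<sw → [ flagged v n≤v , (λ { refl → trans (cong (bitAt word) (sym (+-identityʳ _))) (here-bit 0) }) ]′ (m≤n⇒m<n∨m≡n (s≤s⁻¹ v<sw))
    }
    where
    rest = true ∷ (encodeGate g ++ post)
    eq′ : word ≡ pre ++ (encodeGates C ++ rest)
    eq′ = trans eq (cong (pre ++_) (List.++-assoc (encodeGates C) (true ∷ encodeGate g) post))
    open Reads (reads C pre rest len eq′)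
    here-bit : ∀ j → bitAt word (offset n w + j) ≡ bitAt rest j
    here-bit j = trans (cong₂ bitAt (trans eq′ (sym (List.++-assoc pre (encodeGates C) rest)))
                         (cong (_+ j) (trans position (sym (List.length-++ pre)))))
                   (bitAt-++ʳ (pre ++ encodeGates C) rest j)
    next : offset n (suc w) ≡ length pre + length (encodeGates C ++ true ∷ encodeGate g)
    next = begin
        suc n + ((if w <ᵇ n then 0 else 3 + w) + ∑ w (λ i → if i <ᵇ n then 0 else 3 + i))
      ≡⟨ cong (λ x → suc n + (x + ∑ w (λ i → if i <ᵇ n then 0 else 3 + i))) (if-false (<ᵇ-false (inputs≤nodes C))) ⟩
        suc n + ((3 + w) + ∑ w (λ i → if i <ᵇ n then 0 else 3 + i))
      ≡⟨ arith (suc n) (3 + w) _ ⟩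
        offset n w + (3 + w)
      ≡⟨ cong (_+ (3 + w)) position ⟩
        (length pre + length (encodeGates C)) + (3 + w)
      ≡⟨ +-assoc (length pre) (length (encodeGates C)) (3 + w) ⟩
        length pre + (length (encodeGates C) + (3 + w))
      ≡⟨ cong (length pre +_) (sym (trans (List.length-++ (encodeGates C)) (cong (λ l → length (encodeGates C) + suc l) (length-encodeGate g)))) ⟩
        length pre + length (encodeGates C ++ true ∷ encodeGate g)
      ∎
      where
      open ≡-Reasoning
      arith : ∀ a b c → a + (b + c) ≡ (a + c) + b
      arith = solve-∀
    kind-negation : ∀ g′ → g′ ≡ g → negation w ≡ isNegation g′
    kind-negation (NOT _)   refl = cong not (here-bit 1)
    kind-negation (AND _ _) refl = cong not (here-bit 1)
    kind-negation (OR _ _)  refl = cong not (here-bit 1)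
    kind-conjunction : ∀ g′ → g′ ≡ g → conjunction w ≡ isConjunction g′
    kind-conjunction (NOT _)   refl = cong not (here-bit 2)
    kind-conjunction (AND _ _) refl = cong not (here-bit 2)
    kind-conjunction (OR _ _)  refl = cong not (here-bit 2)
    kind-inputs : ∀ g′ i → g′ ≡ g → bitAt word (offset n w + (3 + toℕ i)) ≡ lookup (gateInputs g′) i
    kind-inputs (NOT j)   i refl = trans (here-bit (3 + toℕ i)) (bitAt-toList ⁅ j ⁆ post i)
    kind-inputs (AND s _) i refl = trans (here-bit (3 + toℕ i)) (bitAt-toList s post i)
    kind-inputs (OR s _)  i refl = trans (here-bit (3 + toℕ i)) (bitAt-toList s post i)

-- Shows that the length of the word is a sufficient search bound in `gateCount`.
nodes≤length : ∀ {n w} (C : Circuit n w) → w ≤ n + length (encodeGates C)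
nodes≤length {n} inputs = m≤m+n n 0
nodes≤length {n} {suc w} (C ▷ g) = begin
  suc w                                                        ≡⟨ +-comm 1 w ⟩
  w + 1                                                        ≤⟨ +-mono-≤ (nodes≤length C) (s≤s z≤n) ⟩
  (n + length (encodeGates C)) + suc (length (encodeGate g))   ≡⟨ +-assoc n _ _ ⟩
  n + (length (encodeGates C) + suc (length (encodeGate g)))   ≡⟨ cong (n +_) (sym (List.length-++ (encodeGates C))) ⟩
  n + length (encodeGates (C ▷ g))                             ∎
  where open ≤-Reasoning

module Decoding {n w} (C : Circuit n w) (k : ℕ) where

  word : Word
  word = encodeCircuit C ++ unary k

  private
    gates = encodeGates C

    split : word ≡ unary n ++ (gates ++ (false ∷ unary k))
    split = trans (List.++-assoc (unary n) (gates ∷ʳ false) (unary k)) (cong (unary n ++_) (List.∷ʳ-++ gates false (unary k)))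

    split′ : word ≡ replicate n true ++ (false ∷ (gates ++ (false ∷ unary k)))
    split′ = trans split (List.∷ʳ-++ (replicate n true) false _)

    open Reads (reads word n C (unary n) (false ∷ unary k) (trans (length-unary n) (+-comm n 1)) split)

    length-word : length word ≡ suc n + (length gates + (2 + k))
    length-word = trans (cong length split) (trans (List.length-++ (unary n)) (cong₂ _+_ (trans (length-unary n) (+-comm n 1))
      (trans (List.length-++ gates) (cong (λ l → length gates + suc l) (trans (length-unary k) (+-comm k 1))))))

    after-gates : ∀ j → bitAt word (offset n w + j) ≡ bitAt (false ∷ unary k) j
    after-gates j = trans (cong₂ bitAt (trans split (sym (List.++-assoc (unary n) gates _))) (cong (_+ j) (trans position (sym (List.length-++ (unary n))))))
      (bitAt-++ʳ (unary n ++ gates) (false ∷ unary k) j)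

    bitAt-end : ∀ n ys → bitAt (replicate n true ++ false ∷ ys) n ≡ false
    bitAt-end zero    ys = refl
    bitAt-end (suc n) ys = bitAt-end n ys

  inputCount-word : inputCount word ≡ n
  inputCount-word = lead-unique (bitAt word) (length word) n
    (≤-trans (m≤n⇒m≤1+n (m≤m+n n _)) (≤-reflexive (sym length-word)))
    (λ j j<n → trans (cong (λ x → bitAt x j) split′) (bitAt-replicate n _ j j<n))
    (trans (cong (λ x → bitAt x n) split′) (bitAt-end n _))

  private
    n≤w = inputs≤nodes C

    gateCount-word : lead (λ g → bitAt word (offset n (n + g))) (length word) ≡ w ∸ n
    gateCount-word = lead-unique _ (length word) (w ∸ n)
      (≤-trans (≤-trans (m≤n+o⇒m∸n≤o w n (nodes≤length C)) (≤-trans (m≤m+n (length gates) (2 + k)) (m≤n+m _ (suc n)))) (≤-reflexive (sym length-word)))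
      (λ g g< → flagged (n + g) (m≤m+n n g) (≤-trans (+-monoʳ-< n g<) (≤-reflexive (m+[n∸m]≡n n≤w))))
      (trans (cong (λ v → bitAt word (offset n v)) (m+[n∸m]≡n n≤w)) (trans (cong (bitAt word) (sym (+-identityʳ _))) (after-gates 0)))

  nodeCount-word : nodeCount word ≡ w
  nodeCount-word = trans (cong (λ m → m + lead (λ g → bitAt word (offset m (m + g))) (length word)) inputCount-word)
    (trans (cong (n +_) gateCount-word) (m+[n∸m]≡n n≤w))

  weightCount-word : weightCount word ≡ k
  weightCount-word = trans (cong₂ (λ m v → lead (λ j → bitAt word (suc (offset m v) + j)) (length word)) inputCount-word nodeCount-word)
    (lead-unique (λ j → bitAt word (suc (offset n w) + j)) (length word) k
      (≤-trans (≤-trans (m≤n+m k 2) (≤-trans (m≤n+m (2 + k) (length gates)) (m≤n+m _ (suc n)))) (≤-reflexive (sym length-word)))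
      (λ j j<k → trans (final j) (trans (cong (λ x → bitAt x j) (unary-++′ k)) (bitAt-replicate k _ j j<k)))
      (trans (final k) (bitAt-end k [])))
    where
    unary-++′ : ∀ k → unary k ≡ replicate k true ++ false ∷ []
    unary-++′ k = refl
    final : ∀ j → bitAt word (suc (offset n w) + j) ≡ bitAt (unary k) j
    final j = trans (cong (bitAt word) (sym (+-suc (offset n w) j))) (after-gates (suc j))

  describes-word : Describes (negationAt word) (conjunctionAt word) (inputAt word) C
  describes-word = subst (λ m → Describes (λ v → not (bitAt word (offset m v + 1))) (λ v → not (bitAt word (offset m v + 2)))
                                          (λ v c → bitAt word (offset m v + (3 + (v ∸ suc c)))) C) (sym inputCount-word) described

-- The output word, symbol by symbol

applyUpTo-++ : ∀ m n (p : ℕ → Bool) → List.applyUpTo p (m + n) ≡ List.applyUpTo p m ++ List.applyUpTo (λ i → p (m + i)) n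
applyUpTo-++ zero    n p = refl
applyUpTo-++ (suc m) n p = cong (p 0 ∷_) (applyUpTo-++ m n (p ∘ suc))

applyUpTo-cong : ∀ n {p q : ℕ → Bool} → (∀ i → i < n → p i ≡ q i) → List.applyUpTo p n ≡ List.applyUpTo q n
applyUpTo-cong zero    eq = refl
applyUpTo-cong (suc n) eq = cong₂ _∷_ (eq 0 z<s) (applyUpTo-cong n λ i i<n → eq (suc i) (s≤s i<n))

toList-tabulate : ∀ n (p : ℕ → Bool) → toList (tabulate {n = n} (p ∘ toℕ)) ≡ List.applyUpTo p n
toList-tabulate zero    p = refl
toList-tabulate (suc n) p = cong (p 0 ∷_) (toList-tabulate n (p ∘ suc))

toList-matrix : ∀ m n (p : ℕ → ℕ → Bool) →
                toList (Vec.concat (tabulate {n = m} λ u → tabulate {n = n} λ v → p (toℕ u) (toℕ v))) ≡ List.applyUpTo (λ i → p (quot i n) (rem i n)) (m * n)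
toList-matrix zero    n p = refl
toList-matrix (suc m) n p = trans (Vec.toList-++ (tabulate {n = n} (p 0 ∘ toℕ)) _)
  (trans (cong₂ _++_ (trans (toList-tabulate n (p 0)) (applyUpTo-cong n first)) (trans (toList-matrix m n (p ∘ suc)) (applyUpTo-cong (m * n) rest)))
    (sym (applyUpTo-++ n (m * n) _)))
  where
  first : ∀ i → i < n → p 0 i ≡ p (quot i n) (rem i n)
  first i i<n = cong₂ p (sym (trans (cong (λ x → quot x n) at-0) (quot-unique n 0 i<n))) (sym (trans (cong (λ x → rem x n) at-0) (rem-unique n 0 i<n)))
    where
    at-0 : i ≡ n * 0 + i
    at-0 = cong (_+ i) (sym (*-zeroʳ n))
  rest : ∀ i → i < m * n → p (suc (quot i n)) (rem i n) ≡ p (quot (n + i) n) (rem (n + i) n)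
  rest i i< = cong₂ p (sym (trans (cong (λ x → quot x n) shifted) (quot-unique n (suc (quot i n)) (rem< i 0<n))))
                      (sym (trans (cong (λ x → rem x n) shifted) (rem-unique n (suc (quot i n)) (rem< i 0<n))))
    where
    0<n : 0 < n
    0<n = n≢0⇒n>0 λ { refl → contradiction (subst (i <_) (*-zeroʳ m) i<) λ () }
    shifted : n + i ≡ n * suc (quot i n) + rem i n
    shifted = trans (cong (n +_) (quot-rem i 0<n)) (trans (sym (+-assoc n _ _)) (cong (_+ rem i n) (sym (*-suc n (quot i n)))))

outputSize : ℕ → ℕ → ℕ
outputSize n k = (n + 1) + (n * n + (k + 1))

outputSymbol : ℕ → (ℕ → ℕ → Bool) → ℕ → ℕ → Bool
outputSymbol n edge k i =
  if i <ᵇ n + 1 then i <ᵇ n else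
  (if i <ᵇ (n + 1) + n * n then edge (quot (i ∸ (n + 1)) n) (rem (i ∸ (n + 1)) n) else i ∸ ((n + 1) + n * n) <ᵇ k)

output-word : ∀ n (edge : ℕ → ℕ → Bool) k (G : FinGraph n) → (∀ u v → SimpleGraph.adj G u v ≡ edge (toℕ u) (toℕ v)) →
              List.applyUpTo (outputSymbol n edge k) (outputSize n k) ≡ encodeGraph G ++ unary k
output-word n edge k G adjacent = begin
    List.applyUpTo symbol ((n + 1) + (n * n + (k + 1)))
  ≡⟨ trans (applyUpTo-++ (n + 1) (n * n + (k + 1)) symbol)
       (cong (List.applyUpTo symbol (n + 1) ++_) (applyUpTo-++ (n * n) (k + 1) (λ i → symbol ((n + 1) + i)))) ⟩
    List.applyUpTo symbol (n + 1) ++ (List.applyUpTo (λ i → symbol ((n + 1) + i)) (n * n) ++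
      List.applyUpTo (λ i → symbol ((n + 1) + (n * n + i))) (k + 1))
  ≡⟨ cong₂ _++_ (trans (applyUpTo-cong (n + 1) header) (applyUpTo-unary n (_<ᵇ n) (λ _ → refl)))
       (cong₂ _++_ (trans (applyUpTo-cong (n * n) matrix) (sym (toList-matrix n n edge))) (applyUpTo-unary k _ bound)) ⟩
    unary n ++ (toList (Vec.concat (tabulate {n = n} λ u → tabulate {n = n} λ v → edge (toℕ u) (toℕ v))) ++ unary k)
  ≡⟨ sym (List.++-assoc (unary n) _ (unary k)) ⟩
    (unary n ++ toList (Vec.concat (tabulate {n = n} λ u → tabulate {n = n} λ v → edge (toℕ u) (toℕ v)))) ++ unary k
  ≡⟨ cong (λ rows → (unary n ++ toList (Vec.concat rows)) ++ unary k) (Vec.tabulate-cong λ u → Vec.tabulate-cong λ v → sym (adjacent u v)) ⟩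
    encodeGraph G ++ unary k
  ∎
  where
  open ≡-Reasoning
  symbol = outputSymbol n edge k
  header : ∀ i → i < n + 1 → symbol i ≡ (i <ᵇ n)
  header i i< = if-true (<ᵇ-true i<)
  matrix : ∀ i → i < n * n → symbol ((n + 1) + i) ≡ edge (quot i n) (rem i n)
  matrix i i< = trans (if-false (<ᵇ-false (m≤m+n (n + 1) i))) (trans (if-true (<ᵇ-true (+-monoʳ-< (n + 1) i<)))
    (cong (λ j → edge (quot j n) (rem j n)) (m+n∸m≡n (n + 1) i)))
  bound : ∀ i → symbol ((n + 1) + (n * n + i)) ≡ (i <ᵇ k)
  bound i = trans (if-false (<ᵇ-false (m≤m+n (n + 1) _))) (trans (if-false (<ᵇ-false (+-monoʳ-≤ (n + 1) (m≤m+n (n * n) i))))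
    (cong (_<ᵇ k) (trans (cong (_∸ ((n + 1) + n * n)) (sym (+-assoc (n + 1) (n * n) i))) (m+n∸m≡n ((n + 1) + n * n) i))))

transduced-by : ∀ {f : Word → ℕ} {p : Word → ℕ → Bool} (F : Fun₀ f) (P : Pred₁ p) w →
                transduced (Exp.term (Fun₀.body F)) (Exp.term (Fun₁.body P)) w ≡ List.applyUpTo (p w) (f w)
transduced-by {f} {p} (fun₀ (exp l l-sound)) (fun₁ (exp b b-sound)) w =
  trans (cong (List.applyUpTo (λ i → 0 <ᵇ eval w b (i ∷ []))) (l-sound w []))
    (applyUpTo-cong (f w) λ i _ → trans (cong (0 <ᵇ_) (b-sound w (i ∷ []))) (positive-𝟙 (p w i)))

-- The reduction is computed by terms

inputCountF : Fun₀ inputCount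
inputCountF = fun₀ (∑E lengthE (∑E (# 1 +E v₀) (notE (bitE v₀)) ≡E # 0))

offsetF : Fun₂ (λ w n v → offset n v)
offsetF = fun₂ (# 1 +E v₀ +E ∑E v₁ (ifE (v₀ <E v₁) (# 0) (# 3 +E v₀)))

gateCountF : Fun₀ gateCount
gateCountF = fun₀ (∑E lengthE (∑E (# 1 +E v₀) (notE (bitE (call₂ offsetF (call₀ inputCountF) (call₀ inputCountF +E v₀)))) ≡E # 0))

nodeCountF : Fun₀ nodeCount
nodeCountF = fun₀ (call₀ inputCountF +E call₀ gateCountF)

weightCountF : Fun₀ weightCount
weightCountF = fun₀ (∑E lengthE (∑E (# 1 +E v₀) (notE (bitE (# 1 +E call₂ offsetF (call₀ inputCountF) (call₀ nodeCountF) +E v₀))) ≡E # 0))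

negationF : Pred₁ negationAt
negationF = fun₁ (notE (bitE (call₂ offsetF (call₀ inputCountF) v₀ +E # 1)))

conjunctionF : Pred₁ conjunctionAt
conjunctionF = fun₁ (notE (bitE (call₂ offsetF (call₀ inputCountF) v₀ +E # 2)))

inputF : Pred₂ inputAt
inputF = fun₂ (bitE (call₂ offsetF (call₀ inputCountF) v₀ +E (# 3 +E (v₀ ∸E (# 1 +E v₁)))))

-- Defined for every word, through functions that only read bits of it. Thus the terms compute this
-- very graph, and its structural bounds hold for all words; that the word encodes a circuit matters
-- only for correctness.
module ReductionGraph (top : ℕ) (w : Word) where

  open CircuitSystem top (inputCount w) (weightCount w) (nodeCount w) (negationAt w) (conjunctionAt w) (inputAt w) public
  open HubEdges hubs switches itemEnd rowEnd allows public using (guards; pendants; order; forbidding; present; link; edge; graph)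

module ReductionTerms (top : ℕ) where

  private
    module G = ReductionGraph top

    nE : ∀ {r} → Exp {r} (λ w _ → inputCount w)
    nE = call₀ inputCountF

    kE : ∀ {r} → Exp {r} (λ w _ → weightCount w)
    kE = call₀ weightCountF

  -- The level is no argument of the term: recursion over levels takes place while the term is
  -- built. Hence the exponent of the running time depends on the depth bound, which is fixed.
  radixF : ∀ e → Fun₀ (λ w → G.radix w e)
  radixF zero    = fun₀ (# 1 +E kE)
  radixF (suc e) = fun₀ (call₀ (radixF e) *E call₀ (radixF e))

  spanF : ∀ e → Fun₀ (λ w → G.span w e)
  spanF zero    = fun₀ nE
  spanF (suc e) = fun₀ (call₀ (spanF e) *E call₀ (spanF e))

  baseF : ∀ e → Fun₀ (λ w → G.base w e)
  baseF zero    = fun₀ (# 2 +E call₀ nodeCountF)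
  baseF (suc e) = fun₀ (call₀ (baseF e) *E call₀ (baseF e))

  modulusF : Fun₀ G.modulus
  modulusF = fun₀ (call₀ (baseF (suc top)))

  lowJ highJ : ∀ e {r} {g : Word → Vec ℕ r → ℕ} → Exp g → Exp _
  lowJ  e J = remE J (call₀ (radixF e))
  highJ e J = quotE J (call₀ (radixF e))

  lowB highB : ∀ e {r} {g : Word → Vec ℕ r → ℕ} → Exp g → Exp _
  lowB  e b = remE b (call₀ (spanF e))
  highB e b = quotE b (call₀ (spanF e))

  unitF : ∀ e → Fun₁ (λ w J → G.unit w e J)
  unitF zero    = fun₁ (v₀ ≡E kE)
  unitF (suc e) = fun₁ (call₁ (unitF e) (lowJ e v₀) *E call₁ (unitF e) (highJ e v₀))

  fanF : Fun₁ (λ w v → G.fan w v)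
  fanF = fun₁ (∑E v₀ (call₂ inputF v₁ v₀))

  tensorF : ∀ e → Fun₃ (λ w v J b → G.tensor w (G.modulus w) e v J b)
  tensorF zero    = fun₃ ((v₁ <E kE) *E (v₂ ≡E v₀))
  tensorF (suc e) = fun₃ (ifE (v₀ <E nE)
    (call₃ (tensorF e) v₀ (lowJ e v₁) (lowB e v₂) *E call₁ (unitF e) (highJ e v₁))
    (ifE (call₁ negationF v₀)
      ((call₁ (unitF e) (lowJ e v₁) +E (call₀ modulusF ∸E # 1) *E ∑E v₀ (call₂ inputF v₁ v₀ *E call₃ (tensorF e) v₀ (lowJ e v₂) (lowB e v₃)))
        *E call₁ (unitF e) (highJ e v₁))
      (ifE (call₁ conjunctionF v₀)
        (∑E v₀ (∑E v₀ ((call₂ inputF v₂ v₁ *E call₂ inputF v₂ v₀) *E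
          (call₃ (tensorF e) v₁ (lowJ e v₃) (lowB e v₄) *E call₃ (tensorF e) v₀ (highJ e v₃) (highB e v₄)))))
        (∑E v₀ (∑E v₀ ((call₂ inputF v₂ v₁ *E call₂ inputF v₂ v₀) *E
          ((call₃ (tensorF e) v₁ (lowJ e v₃) (lowB e v₄) *E call₁ (unitF e) (highJ e v₃)
            +E call₁ (unitF e) (lowJ e v₃) *E call₃ (tensorF e) v₀ (highJ e v₃) (highB e v₄))
           +E (call₀ modulusF ∸E # 1) *E (call₃ (tensorF e) v₁ (lowJ e v₃) (lowB e v₄) *E call₃ (tensorF e) v₀ (highJ e v₃) (highB e v₄)))))))))

  packedF : ∀ e → Fun₃ (λ w v J b → G.packed w (G.modulus w) e v J b)
  packedStepF : ∀ e → Fun₃ (λ w v J b → G.packedStep w (G.modulus w) e v J b)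
  packedF zero    = fun₃ (call₃ (tensorF zero) v₀ v₁ v₂)
  packedF (suc e) = fun₃ (call₃ (packedStepF e) v₀ (lowJ e v₁) (lowB e v₂) *E call₁ (unitF e) (highJ e v₁))
  packedStepF e = fun₃ (ifE (v₀ <E nE) (call₃ (packedF e) v₀ v₁ v₂)
    (ifE (call₁ negationF v₀) (∑E v₀ (call₂ inputF v₁ v₀ *E call₃ (packedF e) v₀ v₂ v₃))
    (ifE (# 2 <E call₁ fanF v₀) (∑E v₀ (call₂ inputF v₁ v₀ *E call₃ (tensorF e) v₀ v₂ v₃))
      (∑E v₀ (∑E v₀ ((call₂ inputF v₂ v₁ *E call₂ inputF v₂ v₀) *E
        (call₀ (baseF e) *E call₃ (packedF e) v₀ v₃ v₄ +E call₃ (packedF e) v₁ v₃ v₄)))))))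

  unpackedF : ∀ e → Pred₂ (λ w v p → G.unpacked w e v p)
  unpackedF zero    = fun₂ (# 0 <E v₁)
  unpackedF (suc e) = fun₂ (ifB (v₀ <E nE) (# 0 <E v₁)
    (ifB (call₁ negationF v₀) (# 0 <E ∑E v₀ (call₂ inputF v₁ v₀ *E notE (call₂ (unpackedF e) v₀ v₂)))
    (ifB (# 2 <E call₁ fanF v₀) (ifB (call₁ conjunctionF v₀) (v₁ ≡E call₁ fanF v₀) (# 0 <E v₁))
      (# 0 <E ∑E v₀ (∑E v₀ ((call₂ inputF v₂ v₁ *E call₂ inputF v₂ v₀) *E
        ifB (call₁ conjunctionF v₂)
          (call₂ (unpackedF e) v₁ (remE v₃ (call₀ (baseF e))) ∧E call₂ (unpackedF e) v₀ (quotE v₃ (call₀ (baseF e))))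
          (call₂ (unpackedF e) v₁ (remE v₃ (call₀ (baseF e))) ∨E call₂ (unpackedF e) v₀ (quotE v₃ (call₀ (baseF e))))))))))

  tuplesF : Fun₀ G.tuples
  tuplesF = fun₀ (call₀ (radixF (suc top)))

  variablesF : Fun₀ G.variables
  variablesF = fun₀ (kE +E call₀ tuplesF)

  copiesF : Fun₀ G.copies
  copiesF = fun₀ (# 2 +E (nE +E call₀ modulusF))

  rowsF : Fun₀ G.rows
  rowsF = fun₀ (# 1 +E call₀ tuplesF)

  outputF : Fun₀ G.output
  outputF = fun₀ (cast (λ w _ → sym (pred≡∸1 (nodeCount w))) (call₀ nodeCountF ∸E # 1))
    where
    pred≡∸1 : ∀ n → pred n ≡ n ∸ 1
    pred≡∸1 zero    = refl
    pred≡∸1 (suc n) = refl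

  shareF : Fun₂ G.share
  shareF = fun₂ (remE (call₃ (packedF (suc top)) (call₀ outputF) v₀ v₁) (call₀ modulusF))

  digitF : ∀ e → Fun₂ (λ w J i → G.digit w e J i)
  digitF zero    = fun₂ (v₁ ≡E v₀)
  digitF (suc e) = fun₂ (call₀ (spanF e) *E call₂ (digitF e) (highJ e v₀) v₁ +E call₂ (digitF e) (lowJ e v₀) v₁)

  coefficientF : Fun₂ G.coefficient
  coefficientF = fun₂ (ifE (v₀ <E call₀ tuplesF)
    (ifE (v₁ <E kE) (call₂ (digitF (suc top)) v₀ v₁) ((v₁ ≡E kE +E v₀) *E call₀ (spanF (suc top))))
    (ifE (v₁ <E kE) (# 0) (# 1)))

  limitF : Fun₁ G.limit
  limitF = fun₁ (ifE (v₀ <E kE) (nE ∸E # 1) (call₀ modulusF))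

  distinctF : Pred₂ G.distinct
  distinctF = fun₂ (notE (((lowJ top v₀ <E kE) ∧E (highJ top v₀ <E kE)) ∧E notE (lowJ top v₀ ≡E highJ top v₀))
                    ∨E notE (lowB top v₁ ≡E highB top v₁))

  admitsF : Pred₂ G.admits
  admitsF = fun₂ (ifB (v₀ <E call₀ tuplesF)
    ((call₂ shareF v₀ (remE v₁ (call₀ (spanF (suc top)))) ≡E quotE v₁ (call₀ (spanF (suc top))))
      ∧E call₂ distinctF v₀ (remE v₁ (call₀ (spanF (suc top)))))
    (call₂ (unpackedF (suc top)) (call₀ outputF) (remE v₁ (call₀ modulusF))))

  widthF : Fun₀ G.width
  widthF = fun₀ (# 1 +E ∑E (call₀ rowsF) (∑E (call₀ variablesF) (call₂ coefficientF v₁ v₀)))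

  slotsF : Fun₀ G.slots
  slotsF = fun₀ (call₀ rowsF *E call₀ widthF)

  itemsF : Fun₀ G.items
  itemsF = fun₀ (call₀ variablesF *E call₀ copiesF)

  switchesF : Fun₀ G.switches
  switchesF = fun₀ (call₀ itemsF *E call₀ slotsF)

  hubsF : Fun₀ G.hubs
  hubsF = fun₀ (call₀ itemsF +E (# 1 +E call₀ rowsF))

  contributionF : Fun₂ G.contribution
  contributionF = fun₂ (ifE (remE v₀ (call₀ copiesF) <E call₁ limitF (quotE v₀ (call₀ copiesF)))
    (call₂ coefficientF v₁ (quotE v₀ (call₀ copiesF))) (# 0))

  rowF : Fun₂ G.row
  rowF = fun₂ (ifE (remE v₁ (call₀ widthF) <E call₂ contributionF v₀ (quotE v₁ (call₀ widthF))) (quotE v₁ (call₀ widthF)) (call₀ rowsF))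

  itemEndF : Fun₁ G.itemEnd
  itemEndF = fun₁ (quotE v₀ (call₀ slotsF))

  rowEndF : Fun₁ G.rowEnd
  rowEndF = fun₁ (call₀ itemsF +E call₂ rowF (quotE v₀ (call₀ slotsF)) (remE v₀ (call₀ slotsF)))

  allowsF : Pred₂ G.allows
  allowsF = fun₂ (ifB (v₀ <E call₀ itemsF) ((v₁ ≡E # 0) ∨E (v₁ ≡E call₀ slotsF))
    (ifB (v₀ <E call₀ itemsF +E call₀ rowsF) (call₂ admitsF (v₀ ∸E call₀ itemsF) v₁) (# 1)))

  guardsF : Fun₀ G.guards
  guardsF = fun₀ ((# 1 +E call₀ switchesF) *E call₀ hubsF)

  pendantsF : Fun₀ G.pendants
  pendantsF = fun₀ ((# 1 +E (call₀ switchesF +E call₀ switchesF)) *E call₀ guardsF)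

  orderF : Fun₀ G.order
  orderF = fun₀ (call₀ pendantsF *E # 9)

  forbiddingF : Pred₁ G.forbidding
  forbiddingF = fun₁ (notE (call₂ allowsF (remE v₀ (call₀ hubsF)) (quotE v₀ (call₀ hubsF))))

  presentF : Pred₁ G.present
  presentF = fun₁ ((quotE v₀ (call₀ guardsF) <E call₀ switchesF +E quotE (remE v₀ (call₀ guardsF)) (call₀ hubsF))
    ∧E call₁ forbiddingF (remE v₀ (call₀ guardsF)))

  codeE : ∀ {r} κ {g : Word → Vec ℕ r → ℕ} → Exp g → Exp (λ w ρ → code (κ , g w ρ))
  codeE κ a = # 9 *E a +E # tag κ

  -- Terms cannot match on a kind as `link` does, but they can compare tags.
  by-kind : Word → ℕ → ℕ → ℕ → Bool
  by-kind w τ m b =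
    if τ ≡ᵇ 0 then G.link w hub m b else
    (if τ ≡ᵇ 1 then G.link w guard m b else
    (if τ ≡ᵇ 2 then G.link w pendant m b else
    (if τ ≡ᵇ 3 then G.link w switch m b else
    (if τ ≡ᵇ 4 then G.link w joint m b else
    (if τ ≡ᵇ 5 then G.link w arm₁ m b else
    (if τ ≡ᵇ 6 then G.link w arm₂ m b else
    (if τ ≡ᵇ 7 then G.link w hand₁ m b else G.link w hand₂ m b)))))))

  by-kind-link : ∀ w τ m b → by-kind w τ m b ≡ G.link w (kindOf τ) m b
  by-kind-link w 0 m b = refl
  by-kind-link w 1 m b = refl
  by-kind-link w 2 m b = refl
  by-kind-link w 3 m b = refl
  by-kind-link w 4 m b = refl
  by-kind-link w 5 m b = refl
  by-kind-link w 6 m b = refl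
  by-kind-link w 7 m b = refl
  by-kind-link w (suc (suc (suc (suc (suc (suc (suc (suc τ)))))))) m b = refl

  by-kindF : Fun₃ (λ w τ m b → 𝟙 (by-kind w τ m b))
  by-kindF = fun₃
    (ifB (v₀ ≡E # 0) (# 0)
    (ifB (v₀ ≡E # 1) ((v₁ <E call₀ guardsF) ∧E (codeE hub (remE v₁ (call₀ hubsF)) ≡E v₂))
    (ifB (v₀ ≡E # 2) (((v₁ <E call₀ pendantsF) ∧E call₁ presentF v₁) ∧E (codeE guard (remE v₁ (call₀ guardsF)) ≡E v₂))
    (ifB (v₀ ≡E # 3) ((v₁ <E call₀ switchesF) ∧E ((codeE hub (call₁ itemEndF v₁) ≡E v₂) ∨E (codeE hub (call₁ rowEndF v₁) ≡E v₂)))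
    (ifB (v₀ ≡E # 4) ((v₁ <E call₀ switchesF) ∧E (codeE switch v₁ ≡E v₂))
    (ifB (v₀ ≡E # 5) ((v₁ <E call₀ switchesF) ∧E (codeE joint v₁ ≡E v₂))
    (ifB (v₀ ≡E # 6) ((v₁ <E call₀ switchesF) ∧E (codeE joint v₁ ≡E v₂))
    (ifB (v₀ ≡E # 7) ((v₁ <E call₀ switchesF) ∧E (codeE arm₁ v₁ ≡E v₂))
      ((v₁ <E call₀ switchesF) ∧E (codeE arm₂ v₁ ≡E v₂))))))))))

  linkF : Fun₃ (λ w τ m b → 𝟙 (G.link w (kindOf τ) m b))
  linkF = fun₃ (cast (λ w ρ → cong 𝟙 (by-kind-link w (lookup ρ zero) (lookup ρ (suc zero)) (lookup ρ (suc (suc zero)))))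
    (call₃ by-kindF v₀ v₁ v₂))

  edgeF : Pred₂ G.edge
  edgeF = fun₂ (call₃ linkF (remE v₀ (# 9)) (quotE v₀ (# 9)) v₁ ∨E call₃ linkF (remE v₁ (# 9)) (quotE v₁ (# 9)) v₀)

  outputSizeF : Fun₀ (λ w → outputSize (G.order w) (G.switches w))
  outputSizeF = fun₀ ((call₀ orderF +E # 1) +E (call₀ orderF *E call₀ orderF +E (call₀ switchesF +E # 1)))

  outputSymbolF : Pred₁ (λ w → outputSymbol (G.order w) (G.edge w) (G.switches w))
  outputSymbolF = fun₁ (ifB (v₀ <E call₀ orderF +E # 1) (v₀ <E call₀ orderF)
    (ifB (v₀ <E (call₀ orderF +E # 1) +E call₀ orderF *E call₀ orderF)
      (call₂ edgeF (quotE (v₀ ∸E (call₀ orderF +E # 1)) (call₀ orderF)) (remE (v₀ ∸E (call₀ orderF +E # 1)) (call₀ orderF)))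
      (v₀ ∸E ((call₀ orderF +E # 1) +E call₀ orderF *E call₀ orderF) <E call₀ switchesF)))

-- Assembling the reduction

opaque
  reduction-computed : ∀ top → ∃₂ λ l b → ∀ w → transduced l b w ≡ encodeGraph (ReductionGraph.graph top w) ++ unary (ReductionGraph.switches top w)
  reduction-computed top = Exp.term (Fun₀.body outputSizeF) , Exp.term (Fun₁.body outputSymbolF) , λ w →
    trans (transduced-by outputSizeF outputSymbolF w)
      (output-word (ReductionGraph.order top w) (ReductionGraph.edge top w) (ReductionGraph.switches top w) (ReductionGraph.graph top w) λ _ _ → refl)
    where
    open ReductionTerms top

module Reduction (top : ℕ) (w : Word) where

  open ReductionGraph top w

  0<variables : 0 < variables
  0<variables = <-≤-trans (go (suc top)) (m≤n+m tuples (weightCount w))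
    where
    go : ∀ e → 0 < radix e
    go zero    = z<s
    go (suc e) = *-mono-≤ (go e) (go e)

  limit≤copies : ∀ i → i < variables → limit i ≤ copies
  limit≤copies i _ with i <ᵇ weightCount w
  ... | true  = ≤-trans (m∸n≤m (inputCount w) 1) (≤-trans (m≤m+n (inputCount w) modulus) (m≤n+m _ 2))
  ... | false = ≤-trans (m≤n+m modulus (inputCount w)) (m≤n+m _ 2)

  open SystemIrregulators variables copies rows coefficient limit admits 0<variables (m≤m+n 2 _) z<s limit≤copies public

  -- `7 + tuples` is `6 + rows`, the bound on both parameters. There are (k + 1)^(2^(top + 1))
  -- tuples for weight k; with B = (k + 2)^(2^(top + 1)) the rest is 7 + B ≤ 8 B and 8 ≤ (k + 2)^3.
  7+tuples≤ : 7 + tuples ≤ (2 + weightCount w) ^ (3 + 2 ^ suc top)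
  7+tuples≤ = begin
    7 + tuples             ≤⟨ +-monoʳ-≤ 7 (radix≤ (suc top)) ⟩
    7 + B                  ≤⟨ +-monoˡ-≤ B (*-monoʳ-≤ 7 (m^n>0 b (2 ^ suc top))) ⟩
    7 * B + B              ≡⟨ +-comm (7 * B) B ⟩
    8 * B                  ≤⟨ *-monoˡ-≤ B (^-monoˡ-≤ 3 (m≤m+n 2 (weightCount w))) ⟩
    b ^ 3 * B              ≡⟨ sym (^-distribˡ-+-* b 3 (2 ^ suc top)) ⟩
    b ^ (3 + 2 ^ suc top)  ∎
    where
    open ≤-Reasoning
    b = 2 + weightCount w
    B = b ^ (2 ^ suc top)
    radix≤ : ∀ e → radix e ≤ b ^ (2 ^ e)
    radix≤ zero    = ≤-trans (n≤1+n _) (≤-reflexive (sym (*-identityʳ b)))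
    radix≤ (suc e) = ≤-trans (*-mono-≤ (radix≤ e) (radix≤ e))
      (≤-reflexive (trans (sym (^-distribˡ-+-* b (2 ^ e) (2 ^ e))) (cong (λ x → b ^ (2 ^ e + x)) (sym (+-identityʳ (2 ^ e))))))

-- The counts read off the word equal the data of the circuit only propositionally. With variables
-- in their place the equations can be matched with `refl`.
satisfying⇔solution : ∀ {n others} (C : Circuit n (suc others)) top k → Vec.head (depths C) ≤ top → Vec.head (wefts C) ≤ 1 →
  ∀ n′ k′ size′ {negation conjunction input} → n′ ≡ n → k′ ≡ k → size′ ≡ suc others → Describes negation conjunction input C →
  (∃[ A ] ∣ A ∣ ≡ k × Vec.head (values C A) ≡ true) ⇔ ∃ (CircuitSystem.Solution top n′ k′ size′ negation conjunction input)
satisfying⇔solution {n} {others} C top k deep light _ _ _ {negation} {conjunction} {input} refl refl refl described =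
  mk⇔ satisfying⇒solution solution⇒satisfying
  where open CircuitCorrectness top n k others negation conjunction input C described deep light

reduction : ∀ (π : GraphParameter) → (∀ top w → Reduction.Bounded top w π) → ∀ d → PolynomialReduction (WCS 1 d) (EdgeIrregulator π)
reduction π bounded d = record
  { reduce    = reduce
  ; correct   = correct
  ; size      = proj₁ (reduction-computed d)
  ; symbol    = proj₁ (proj₂ (reduction-computed d))
  ; encodes   = λ I → proj₂ (proj₂ (reduction-computed d)) (encode I)
  ; exponent  = 3 + 2 ^ suc d
  ; parameter = parameter
  }
  where
  open WeightedCircuit
  encode : WeightedCircuit 1 d → Word
  encode I = encodeCircuit (circuit I) ++ unary (weight I)
  reduce : WeightedCircuit 1 d → EdgeIrregulatorInstance π
  reduce I = record
    { graph      = ReductionGraph.graph d (encode I)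
    ; bound      = ReductionGraph.switches d (encode I)
    ; value      = proj₁ (bounded d (encode I))
    ; π-is-value = proj₁ (proj₂ (bounded d (encode I)))
    }
  correct : ∀ I → (∃[ A ] ∣ A ∣ ≡ weight I × Vec.head (values (circuit I) A) ≡ true) ⇔
                  (∃[ m ] Iₑ (ReductionGraph.graph d (encode I)) m × m ≤ ReductionGraph.switches d (encode I))
  correct I = mk⇔ (Equivalence.to (Reduction.solution⇔irregulator d (encode I)) ∘ Equivalence.to satisfying)
                  (Equivalence.from satisfying ∘ Equivalence.from (Reduction.solution⇔irregulator d (encode I)))
    where
    open Decoding (circuit I) (weight I)
    satisfying = satisfying⇔solution (circuit I) d (weight I) (depth≤d I) (weft≤t I)
      (inputCount (encode I)) (weightCount (encode I)) (nodeCount (encode I)) inputCount-word weightCount-word nodeCount-word describes-word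
  parameter : ∀ I → proj₁ (bounded d (encode I)) ≤ (2 + weight I) ^ (3 + 2 ^ suc d)
  parameter I = ≤-trans (proj₂ (proj₂ (bounded d (encode I)))) (≤-trans (Reduction.7+tuples≤ d (encode I))
    (≤-reflexive (cong (λ k → (2 + k) ^ (3 + 2 ^ suc d)) (Decoding.weightCount-word (circuit I) (weight I)))))

theorem6 : W[ 1 ]-hard (EdgeIrregulator FeedbackVertexSetNumber) × W[ 1 ]-hard (EdgeIrregulator Treedepth)
theorem6 = W[]-hardness (reduction FeedbackVertexSetNumber Reduction.feedback-vertex-set-bounded) ,
           W[]-hardness (reduction Treedepth Reduction.treedepth-bounded)
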